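{- Let $n\ge 0$, let $\mathcal{P}_n$ be the set of plane permutations of size $n$ and $\mathcal{B}_n$ the set of plane bipolar posets with $n+2$ vertices. The mapping $\Phi$ (dominance diagram of the completed permutation) is a bijection from $\mathcal{P}_n$ to $\mathcal{B}_n$. Its inverse is $\Psi$.
   Context: Plane bipolar posets: a planar map is a connected multigraph embedded on the oriented sphere, up to orientation-preserving homeomorphism; it is rooted if a corner is marked; the vertex and face at this corner are the root vertex and the root (outer) face. A plane bipolar orientation is a rooted planar map (with at least one edge) endowed with an acyclic orientation having a unique source $S$, which is the root vertex, and a unique sink $N$, incident to the outer face; it is drawn in the plane with $S$ at the bottom and $N$ at the top. It is known that at each non-pole vertex the ingoing edges are consecutive and the outgoing edges are consecutive, so that they are each ordered from left to right. An edge $e=(u,v)$ is transitive if there is a directed path from $u$ to $v$ avoiding $e$. A plane bipolar poset is a plane bipolar orientation with no transitive edge. Plane permutations: a permutation $\pi$ of $\{1,\dots,n\}$ is plane if it avoids the vincular pattern $2\,\underline{14}\,3$, i.e., there are no indices $i<j<j+1<k$ with $\pi(j)<\pi(i)<\pi(k)<\pi(j+1)$. A permutation is identified with its set of points $(i,\pi(i))$. The dominance order on points is $(x,y)\le(x',y')$ iff $x\le x'$ and $y\le y'$. The dominance diagram is obtained by drawing a segment $(p,p')$ for each pair of points such that $p'$ covers $p$ in this poset. It is known that a permutation is plane iff its dominance diagram is crossing-free. The completion $\overline{\pi}$ of $\pi$ is the permutation of $\{0,\dots,n+1\}$ with $\overline\pi(0)=0$, $\overline\pi(n+1)=n+1$,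 $\overline\pi(i)=\pi(i)$ for $1\le i\le n$; it is plane if $\pi$ is. Mapping $\Phi$: for $\pi\in\mathcal{P}_n$, $\Phi(\pi)\in\mathcal{B}_n$ is the plane bipolar poset underlying the dominance diagram of $\overline\pi$, with edges oriented from the dominated to the dominating point, $S=(0,0)$ and $N=(n+1,n+1)$. Mapping $\Psi$: for $B\in\mathcal{B}_n$ with set $I$ of non-pole vertices, the left tree $T_\ell$ (resp. right tree $T_r$) is the spanning tree of $I\cup\{S\}$, rooted at $S$, where the parent-edge of every $v\in I$ is its leftmost (resp. rightmost) ingoing edge. For $v\in I$, $x(v)\in\{1,\dots,n\}$ is the rank of $v$ for the order of first visit in a clockwise tour around $T_r$ (starting at $S$ from the left outer side), and $y(v)\in\{1,\dots,n\}$ is the rank of $v$ for the order of first visit in a counterclockwise tour around $T_\ell$ (starting at $S$ from the right outer side). $\Psi(B)$ is the permutation with point set $\{(x(v),y(v)):v\in I\}$. -}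

module Defs where

open import Data.Bool.Base using (Bool; true; false; if_then_else_)
open import Data.Fin.Base using (Fin; zero; suc; toℕ; fromℕ; _≤_; _<_)
open import Data.Fin.Permutation using (Permutation; Permutation′; _⟨$⟩ʳ_; lift₀; insert)
import Data.Fin.Permutation as Perm
open import Data.Fin.Properties using (_≟_; _≤?_; all?)
open import Data.List.Base
  using (List; []; _∷_; _++_; map; filter; reverse; length; lookup; takeWhile; iterate; allFin; cartesianProduct)
open import Data.List.Membership.Propositional using (_∈_)
open import Data.List.Membership.Propositional.Properties
  using (∈-map⁺; ∈-map⁻; ∈-++⁺ˡ; ∈-++⁺ʳ; ∈-++⁻; ∈-filter⁺; ∈-filter⁻; ∈-allFin; ∈-cartesianProduct⁺)
open import Data.List.Relation.Binary.Permutation.Propositional using (↭-sym; ↭⇒↭ₛ)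
open import Data.List.Relation.Binary.Permutation.Propositional.Properties using (↭-reverse)
import Data.List.Relation.Binary.Permutation.Setoid.Properties as Permutationₛ
open import Data.List.Relation.Unary.Any using (index)
open import Data.List.Relation.Unary.Any.Properties using (reverse⁺; reverse⁻)
open import Data.List.Relation.Unary.Unique.Propositional using (Unique)
import Data.List.Relation.Unary.Unique.Propositional.Properties as Unique
open import Data.Nat.Base as ℕ using (ℕ; _+_; z≤n; s≤s)
import Data.Nat.Properties as ℕ
open import Data.Product.Base using (∃; _×_; _,_; proj₁; proj₂)
open import Data.Sum.Base as Sum using (_⊎_; inj₁; inj₂; [_,_]; reduce; swap)
open import Data.Sum.Properties using (≡-dec; inj₁-injective; inj₂-injective)
open import Function.Base using (_∘_; _on_)
open import Function.Bundles using (_⇔_; mk⇔)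
open import Function.Definitions using (Surjective)
open import Level using (0ℓ)
open import Relation.Binary.Bundles using (Setoid)
open import Relation.Binary.Construct.Closure.Equivalence using (EqClosure)
open import Relation.Binary.Construct.Closure.ReflexiveTransitive using (Star)
open import Relation.Binary.Construct.Closure.Transitive using (TransClosure)
import Relation.Binary.Construct.NonStrictToStrict as ToStrict
open import Relation.Binary.Core using (Rel)
open import Relation.Binary.Definitions using (Decidable; DecidableEquality)
open import Relation.Binary.PropositionalEquality using (_≡_; _≢_; refl; sym; trans; cong; setoid)
open import Relation.Nullary using (¬_; does; ¬?; _×-dec_)
open import Relation.Unary using (Pred)

-- Positions and values are 0-based: Fin n stands for {1, …, n}.

Plane : ∀ {n} → Permutation′ n → Set
Plane {n} π = ¬ (∃ λ (i : Fin n) → ∃ λ (j : Fin n) → ∃ λ (j⁺ : Fin n) → ∃ λ (k : Fin n) →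
  i < j × toℕ j⁺ ≡ ℕ.suc (toℕ j) × j⁺ < k ×
  π ⟨$⟩ʳ j < π ⟨$⟩ʳ i × π ⟨$⟩ʳ i < π ⟨$⟩ʳ k × π ⟨$⟩ʳ k < π ⟨$⟩ʳ j⁺)

record PlanePermutation (n : ℕ) : Set where
  constructor planePermutation
  field
    perm  : Permutation′ n
    plane : Plane perm

open PlanePermutation public using (perm)

points : ∀ {n} → PlanePermutation n → Pred (ℕ × ℕ) 0ℓ
points {n} π (a , b) =
  ∃ λ (i : Fin n) → a ≡ ℕ.suc (toℕ i) × b ≡ ℕ.suc (toℕ (perm π ⟨$⟩ʳ i))

𝓟 : ℕ → Setoid 0ℓ 0ℓ
𝓟 n = record
  { Carrier       = PlanePermutation n
  ; _≈_           = Perm._≈_ on perm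
  ; isEquivalence = record
    { refl  = λ _ → refl
    ; sym   = λ p i → sym (p i)
    ; trans = λ p q i → trans (p i) (q i)
    }
  }

-- Each edge e has two darts (half-edges): out e at the origin of e, into e
-- at its end.

Dart : ℕ → Set
Dart m = Fin m ⊎ Fin m

pattern out  e = inj₁ e
pattern into e = inj₂ e

_≟ᵈ_ : ∀ {m} → DecidableEquality (Dart m)
_≟ᵈ_ = ≡-dec _≟_ _≟_

isOut : ∀ {m} → Dart m → Bool
isOut (out  _) = true
isOut (into _) = false

-- d is meant to occur exactly once in the list.

cyclicNext : ∀ {m} → List (Dart m) → Dart m → Dart m
cyclicNext []       d = d
cyclicNext (x ∷ xs) d = go x xs
  where
  go : _ → List _ → _
  go y []       = if does (y ≟ᵈ d) then x else d
  go y (z ∷ zs) = if does (y ≟ᵈ d) then z else go z zs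

-- A multigraph with V vertices embedded on an oriented closed surface, with
-- an orientation of its edges and a marked corner.  The embedding is given
-- by its rotation system: rotation v lists the darts at v in clockwise order
-- around v, starting anywhere.  The marked corner is the one that
-- immediately precedes the dart root in clockwise order.

record OrientedMap (V : ℕ) : Set where
  field
    edges             : ℕ
    src tgt           : Fin edges → Fin V

  origin : Dart edges → Fin V
  origin = [ src , tgt ]

  field
    rotation          : Fin V → List (Dart edges)
    rotation-unique   : ∀ v → Unique (rotation v)
    rotation-complete : ∀ v d → d ∈ rotation v ⇔ origin d ≡ v
    root              : Dart edges

  next prev : Dart edges → Dart edges
  next d = cyclicNext (rotation (origin d)) d
  prev d = cyclicNext (reverse (rotation (origin d))) d

  -- The face on the left of d, traversed with the face on the left-hand
  -- side.  The corner immediately preceding d belongs to it, so the root face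
  -- is the orbit of root.
  faceNext : Dart edges → Dart edges
  faceNext d = next (swap d)

  SameFace : Rel (Dart edges) 0ℓ
  SameFace = Star (λ d d′ → faceNext d ≡ d′)

  _⟶_ : Rel (Fin V) 0ℓ
  u ⟶ v = ∃ λ e → src e ≡ u × tgt e ≡ v

  _⟶[avoiding_]_ : Fin V → Fin edges → Fin V → Set
  u ⟶[avoiding e ] v = ∃ λ e′ → e′ ≢ e × src e′ ≡ u × tgt e′ ≡ v

  IsTransitive : Fin edges → Set
  IsTransitive e = Star (λ u v → u ⟶[avoiding e ] v) (src e) (tgt e)

  IsSource IsSink : Fin V → Set
  IsSource v = ∀ e → tgt e ≢ v
  IsSink   v = ∀ e → src e ≢ v

-- A connected rotation system is embedded on the sphere iff its Euler
-- characteristic is 2.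

record IsPlanar {V : ℕ} (M : OrientedMap V) : Set where
  open OrientedMap M
  field
    connected       : ∀ u v → EqClosure _⟶_ u v
    faces           : ℕ
    face            : Dart edges → Fin faces
    face-surjective : Surjective _≡_ _≡_ face
    face-orbits     : ∀ d d′ → face d ≡ face d′ ⇔ SameFace d d′
    euler           : V + faces ≡ edges + 2

record IsPlaneBipolarPoset {V : ℕ} (M : OrientedMap V) : Set where
  open OrientedMap M

  S : Fin V
  S = origin root

  field
    planar         : IsPlanar M
    acyclic        : ∀ v → ¬ TransClosure _⟶_ v v
    S-source       : IsSource S
    S-unique       : ∀ v → IsSource v → v ≡ S
    N              : Fin V
    N-sink         : IsSink N
    N-unique       : ∀ v → IsSink v → v ≡ N
    N-outer        : ∃ λ d → SameFace root d × origin d ≡ N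
    not-transitive : ∀ e → ¬ IsTransitive e

record PlaneBipolarPoset (n : ℕ) : Set where
  constructor planeBipolarPoset
  field
    orientedMap         : OrientedMap (2 + n)
    isPlaneBipolarPoset : IsPlaneBipolarPoset orientedMap

open PlaneBipolarPoset public using (orientedMap)

-- Orientation-preserving homeomorphism, respecting the marked corner and the
-- edge orientations, in terms of rotation systems.

record _≅_ {V : ℕ} (M M′ : OrientedMap V) : Set where
  private
    module M  = OrientedMap M
    module M′ = OrientedMap M′
  field
    onVertices : Permutation V V
    onEdges    : Permutation M.edges M′.edges

  onDarts : Dart M.edges → Dart M′.edges
  onDarts = Sum.map (onEdges ⟨$⟩ʳ_) (onEdges ⟨$⟩ʳ_)

  field
    src-comm  : ∀ e → M′.src (onEdges ⟨$⟩ʳ e) ≡ onVertices ⟨$⟩ʳ M.src e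
    tgt-comm  : ∀ e → M′.tgt (onEdges ⟨$⟩ʳ e) ≡ onVertices ⟨$⟩ʳ M.tgt e
    next-comm : ∀ d → M′.next (onDarts d) ≡ onDarts (M.next d)
    root-comm : M′.root ≡ onDarts M.root

module _ {V : ℕ} where

  private
    map-id : ∀ {m} (d : Dart m) → Sum.map (Perm.id ⟨$⟩ʳ_) (Perm.id ⟨$⟩ʳ_) d ≡ d
    map-id (out  _) = refl
    map-id (into _) = refl

    map-flip : ∀ {m m′} (π : Permutation m m′) (d : Dart m) →
      Sum.map (Perm.flip π ⟨$⟩ʳ_) (Perm.flip π ⟨$⟩ʳ_) (Sum.map (π ⟨$⟩ʳ_) (π ⟨$⟩ʳ_) d) ≡ d
    map-flip π (out  _) = cong out (Perm.inverseˡ π)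
    map-flip π (into _) = cong into (Perm.inverseˡ π)

    map-∘ : ∀ {m m′ m″} (π : Permutation m m′) (ρ : Permutation m′ m″) (d : Dart m) →
      Sum.map (π Perm.∘ₚ ρ ⟨$⟩ʳ_) (π Perm.∘ₚ ρ ⟨$⟩ʳ_) d ≡
      Sum.map (ρ ⟨$⟩ʳ_) (ρ ⟨$⟩ʳ_) (Sum.map (π ⟨$⟩ʳ_) (π ⟨$⟩ʳ_) d)
    map-∘ π ρ (out  _) = refl
    map-∘ π ρ (into _) = refl

  ≅-refl : {M : OrientedMap V} → M ≅ M
  ≅-refl {M} = record
    { onVertices = Perm.id
    ; onEdges    = Perm.id
    ; src-comm   = λ _ → refl
    ; tgt-comm   = λ _ → refl
    ; next-comm  = λ d → trans (cong next (map-id d)) (sym (map-id (next d)))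
    ; root-comm  = sym (map-id root)
    }
    where open OrientedMap M

  ≅-sym : {M M′ : OrientedMap V} → M ≅ M′ → M′ ≅ M
  ≅-sym {M} {M′} f = record
    { onVertices = Perm.flip onVertices
    ; onEdges    = Perm.flip onEdges
    ; src-comm   = λ e → back M.src M′.src src-comm e
    ; tgt-comm   = λ e → back M.tgt M′.tgt tgt-comm e
    ; next-comm  = λ d → trans (sym (map-flip onEdges _))
        (cong back-darts (trans (sym (next-comm (back-darts d)))
          (cong M′.next (map-flip′ d))))
    ; root-comm  = trans (sym (map-flip onEdges M.root)) (cong back-darts (sym root-comm))
    }
    where
    open _≅_ f
    module M  = OrientedMap M
    module M′ = OrientedMap M′
    back-darts : Dart M′.edges → Dart M.edges
    back-darts = Sum.map (Perm.flip onEdges ⟨$⟩ʳ_) (Perm.flip onEdges ⟨$⟩ʳ_)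
    map-flip′ : ∀ d → onDarts (back-darts d) ≡ d
    map-flip′ = map-flip (Perm.flip onEdges)
    back : (s : Fin M.edges → Fin V) (s′ : Fin M′.edges → Fin V) →
      (∀ e → s′ (onEdges ⟨$⟩ʳ e) ≡ onVertices ⟨$⟩ʳ s e) →
      ∀ e → s (Perm.flip onEdges ⟨$⟩ʳ e) ≡ Perm.flip onVertices ⟨$⟩ʳ s′ e
    back s s′ comm e = trans (sym (Perm.inverseˡ onVertices))
      (cong (Perm.flip onVertices ⟨$⟩ʳ_)
        (trans (sym (comm _)) (cong s′ (Perm.inverseʳ onEdges))))

  ≅-trans : {M M′ M″ : OrientedMap V} → M ≅ M′ → M′ ≅ M″ → M ≅ M″
  ≅-trans {M} {M′} {M″} f g = record
    { onVertices = f.onVertices Perm.∘ₚ g.onVertices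
    ; onEdges    = f.onEdges Perm.∘ₚ g.onEdges
    ; src-comm   = λ e → trans (g.src-comm _) (cong (g.onVertices ⟨$⟩ʳ_) (f.src-comm e))
    ; tgt-comm   = λ e → trans (g.tgt-comm _) (cong (g.onVertices ⟨$⟩ʳ_) (f.tgt-comm e))
    ; next-comm  = λ d → trans (cong M″.next (comp d)) (trans (g.next-comm _)
        (trans (cong g.onDarts (f.next-comm d)) (sym (comp (M.next d)))))
    ; root-comm  = trans g.root-comm (trans (cong g.onDarts f.root-comm) (sym (comp M.root)))
    }
    where
    module f  = _≅_ f
    module g  = _≅_ g
    module M  = OrientedMap M
    module M″ = OrientedMap M″
    comp = map-∘ f.onEdges g.onEdges

𝓑 : ℕ → Setoid 0ℓ 0ℓ
𝓑 n = record
  { Carrier       = PlaneBipolarPoset n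
  ; _≈_           = _≅_ on orientedMap
  ; isEquivalence = record { refl = ≅-refl ; sym = ≅-sym ; trans = ≅-trans }
  }

completion : ∀ {n} → Permutation′ n → Permutation′ (2 + n)
completion {n} π = insert (fromℕ (ℕ.suc n)) (fromℕ (ℕ.suc n)) (lift₀ π)

module Dominance {m : ℕ} (σ : Permutation′ m) where

  -- i stands for the point (i, σ(i)).

  _≼_ : Rel (Fin m) 0ℓ
  i ≼ j = i ≤ j × σ ⟨$⟩ʳ i ≤ σ ⟨$⟩ʳ j

  open ToStrict _≡_ _≼_ public using () renaming (_<_ to _≺_)

  _IsCoveredBy_ : Rel (Fin m) 0ℓ
  i IsCoveredBy j = i ≺ j × (∀ k → ¬ (i ≺ k × k ≺ j))

  _≺?_ : Decidable _≺_
  _≺?_ = ToStrict.<-decidable _≡_ _≼_ _≟_ (λ i j → (i ≤? j) ×-dec (σ ⟨$⟩ʳ i ≤? σ ⟨$⟩ʳ j))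

  _IsCoveredBy?_ : Decidable _IsCoveredBy_
  i IsCoveredBy? j = (i ≺? j) ×-dec all? (λ k → ¬? ((i ≺? k) ×-dec (k ≺? j)))

  -- In lexicographic order.
  covers : List (Fin m × Fin m)
  covers = filter (λ (i , j) → i IsCoveredBy? j) (cartesianProduct (allFin m) (allFin m))

  segments : ℕ
  segments = length covers

  lower upper : Fin segments → Fin m
  lower = proj₁ ∘ lookup covers
  upper = proj₂ ∘ lookup covers

  -- The points covering p lie in its upper-right quadrant and are pairwise
  -- incomparable, so that increasing abscissa is decreasing slope, i.e. left
  -- to right.  Likewise the points covered by p, by increasing abscissa, are
  -- met from left to right.
  outgoing ingoing : Fin m → List (Fin segments)
  outgoing p = filter (λ e → lower e ≟ p) (allFin segments)
  ingoing  p = filter (λ e → upper e ≟ p) (allFin segments)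

  -- Clockwise: over the top of p from left to right, then back below p from
  -- right to left.
  clockwise : Fin m → List (Dart segments)
  clockwise p = map inj₁ (outgoing p) ++ map inj₂ (reverse (ingoing p))

  clockwise-unique : ∀ p → Unique (clockwise p)
  clockwise-unique p = Unique.++⁺
    (Unique.map⁺ inj₁-injective (Unique.filter⁺ _ (Unique.allFin⁺ _)))
    (Unique.map⁺ inj₂-injective
      (Permutationₛ.Unique-resp-↭ (setoid _) (↭⇒↭ₛ (↭-sym (↭-reverse (ingoing p))))
        (Unique.filter⁺ _ (Unique.allFin⁺ _))))
    disjoint
    where
    disjoint : ∀ {d} → ¬ (d ∈ map inj₁ (outgoing p) × d ∈ map inj₂ (reverse (ingoing p)))
    disjoint (q , r) with ∈-map⁻ inj₁ q | ∈-map⁻ inj₂ r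
    ... | _ , _ , refl | _ , _ , ()

  clockwise-complete : ∀ p d → d ∈ clockwise p ⇔ [ lower , upper ] d ≡ p
  clockwise-complete p d = mk⇔ sound (complete d)
    where
    sound : d ∈ clockwise p → [ lower , upper ] d ≡ p
    sound q with ∈-++⁻ (map inj₁ (outgoing p)) q
    ... | inj₁ r with e , s , refl ← ∈-map⁻ inj₁ r = proj₂ (∈-filter⁻ (λ e → lower e ≟ p) {xs = allFin segments} s)
    ... | inj₂ r with e , s , refl ← ∈-map⁻ inj₂ r =
      proj₂ (∈-filter⁻ (λ e → upper e ≟ p) {xs = allFin segments} (reverse⁻ s))

    complete : ∀ d → [ lower , upper ] d ≡ p → d ∈ clockwise p
    complete (out e)  q = ∈-++⁺ˡ (∈-map⁺ inj₁ (∈-filter⁺ (λ e → lower e ≟ p) (∈-allFin e) q))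
    complete (into e) q = ∈-++⁺ʳ (map inj₁ (outgoing p))
      (∈-map⁺ inj₂ (reverse⁺ (∈-filter⁺ (λ e → upper e ≟ p) (∈-allFin e) q)))

module _ {n : ℕ} (π : Permutation′ n) where
  open Dominance (completion π)

  private
    first-cover : zero IsCoveredBy (suc zero)
    first-cover = ((z≤n , z≤n) , λ ()) , λ where
      zero          ((_ , 0≢0) , _)                     → 0≢0 refl
      (suc zero)    (_ , (_ , 1≢1))                     → 1≢1 refl
      (suc (suc _)) (_ , ((s≤s () , _) , _))

    first∈covers : (zero , suc zero) ∈ covers
    first∈covers = ∈-filter⁺ (λ (i , j) → i IsCoveredBy? j)
      (∈-cartesianProduct⁺ (∈-allFin zero) (∈-allFin (suc zero))) first-cover

  -- S = (0,0), and the root corner is the one to the left of its leftmost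
  -- edge, which leads to the point of abscissa 1.
  dominanceMap : OrientedMap (2 + n)
  dominanceMap = record
    { edges             = segments
    ; src               = lower
    ; tgt               = upper
    ; rotation          = clockwise
    ; rotation-unique   = clockwise-unique
    ; rotation-complete = clockwise-complete
    ; root              = out (index first∈covers)
    }

Φ : ∀ {n} → PlanePermutation n → OrientedMap (2 + n)
Φ π = dominanceMap (perm π)

module _ {n : ℕ} (B : PlaneBipolarPoset n) where
  open OrientedMap (orientedMap B)
  open IsPlaneBipolarPoset (PlaneBipolarPoset.isPlaneBipolarPoset B)

  -- The darts at v ∈ I are, in clockwise order, the outgoing ones from left
  -- to right followed by the ingoing ones from right to left; hence the
  -- leftmost ingoing dart is the one followed by an outgoing dart, and the
  -- rightmost one is the one preceded by an outgoing dart.  No edge ending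
  -- at N is selected, since N has no outgoing dart.
  leftTree rightTree : Fin edges → Bool
  leftTree  e = isOut (next (into e))
  rightTree e = isOut (prev (into e))

  -- Being in the corner just before d (with respect to the direction of
  -- rotation given by turn), a tour around a tree follows the edge of d and
  -- enters the corner next to it at its other end if this edge is in the
  -- tree; otherwise it crosses the edge.
  tourStep : (Fin edges → Bool) → (Dart edges → Dart edges) → Dart edges → Dart edges
  tourStep tree turn d = if tree (reduce d) then turn (swap d) else turn d

  -- A full tour has at most one step per dart.
  clockwiseTour counterclockwiseTour : List (Dart edges)
  clockwiseTour        = iterate (tourStep rightTree next) root (edges + edges)
  counterclockwiseTour = iterate (tourStep leftTree prev) (prev root) (edges + edges)

  firstVisit : List (Dart edges) → Fin (2 + n) → ℕ
  firstVisit tour v = length (takeWhile (λ d → ¬? (origin d ≟ v)) tour)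

  nonPoles : List (Fin (2 + n))
  nonPoles = filter (λ v → ¬? (v ≟ S) ×-dec ¬? (v ≟ N)) (allFin (2 + n))

  rank : List (Dart edges) → Fin (2 + n) → ℕ
  rank tour v = length (filter (λ w → firstVisit tour w ℕ.≤? firstVisit tour v) nonPoles)

  xᵛ yᵛ : Fin (2 + n) → ℕ
  xᵛ = rank clockwiseTour
  yᵛ = rank counterclockwiseTour

  Ψ : Pred (ℕ × ℕ) 0ℓ
  Ψ (a , b) = ∃ λ v → (v ≢ S × v ≢ N) × a ≡ xᵛ v × b ≡ yᵛ v

{-# OPTIONS --safe #-}
module Submission where

-- Let B be a plane bipolar poset.  Counting corners, Euler's relation forces
-- every vertex other than the poles to have just one corner on either side, and
-- every face to be bounded by two directed paths.  The left path of an inner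
-- face is, up to its last edge, a branch of the right tree; by induction along
-- the faces, every edge goes from a vertex to one visited later in the tour of
-- the right tree.  If an edge h is to the left of an edge g with the same
-- source, then the vertices above h but not above g descend in the right tree
-- from edges to the left of g, and are visited before all vertices above g.
-- Hence the two tours visit incomparable vertices in opposite orders, so that
-- the points (x(v), y(v)) have dominance diagram B.  Coordinates with this
-- property that order the edges out of every vertex from left to right are
-- determined by the map, because the order of two incomparable vertices is that
-- of two edges at which paths to them diverge.
--
-- For a plane permutation, the boundaries on both sides of a face of the
-- dominance diagram, followed downwards from a common top, meet again because
-- the diagram has no crossing.  So the faces correspond to the edges that are
-- not leftmost ingoing edges of a vertex other than the poles, which yields
-- Euler's relation.

open import Defs
open import Data.Bool.Base using (Bool; true; false; not; if_then_else_)
import Data.Bool.Properties as Bool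
open import Data.Empty using (⊥; ⊥-elim)
open import Data.Fin.Base using (Fin; zero; suc; toℕ; fromℕ; fromℕ<; punchIn; punchOut; join; splitAt)
open import Data.Fin.Permutation using (Permutation; Permutation′; _⟨$⟩ʳ_; _⟨$⟩ˡ_; lift₀; insert)
import Data.Fin.Permutation as Perm
open import Data.Fin.Properties using (_≟_)
import Data.Fin.Properties as Fin
open import Data.Fin.Induction using (spo-wellFounded; spo-noetherian)
open import Data.List.Base using (List; []; _∷_; _++_; reverse; length; takeWhile; iterate; filter; lookup; allFin; cartesianProduct)
import Data.List.Properties as List
open import Data.List.Membership.Propositional using (_∈_; _∉_)
import Data.List.Membership.Propositional.Properties as ∈
open import Data.List.Relation.Unary.All using (All; []; _∷_)
import Data.List.Relation.Unary.All as All
import Data.List.Relation.Unary.All.Properties as All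
import Data.List.Relation.Unary.Any as Any
open import Data.List.Relation.Unary.AllPairs using (AllPairs; []; _∷_)
import Data.List.Relation.Unary.AllPairs as AllPairs
import Data.List.Relation.Unary.AllPairs.Properties as AllPairs
open import Data.List.Relation.Unary.Any using (here; there; index)
open import Data.List.Relation.Unary.Any.Properties using (reverse⁺; reverse⁻; lookup-index)
open import Data.List.Relation.Binary.Permutation.Propositional using (↭-sym; ↭⇒↭ₛ)
open import Data.List.Relation.Binary.Permutation.Propositional.Properties using (↭-reverse)
import Data.List.Relation.Binary.Permutation.Setoid.Properties as Permutationₛ
open import Data.List.Relation.Unary.Unique.Propositional using (Unique)
import Data.List.Relation.Unary.Unique.Propositional.Properties as Unique
open import Data.Nat.Base using (ℕ; zero; suc; _+_; _∸_; _≤_; _<_; _≮_; z≤n; s≤s)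
import Data.Nat.Properties as ℕ
open import Data.Product.Base using (Σ-syntax; ∃; _×_; _,_; proj₁; proj₂)
open import Data.Sum.Base as Sum using (_⊎_; inj₁; inj₂; [_,_]; reduce; swap)
open import Data.Sum.Properties using (inj₁-injective; inj₂-injective)
open import Function.Base using (_∘_; id; case_of_)
open import Function.Bundles using (Inverse; Equivalence; mk⇔)
open import Data.Nat.Induction using (<-wellFounded)
open import Induction.WellFounded using (Acc; acc; WellFounded)
open import Level using (0ℓ)
open import Relation.Binary.Construct.Closure.ReflexiveTransitive using (Star; ε; _◅_; _◅◅_)
open import Relation.Binary.Construct.Closure.Equivalence using (EqClosure)
import Relation.Binary.Construct.Closure.Equivalence as EqClosure
import Relation.Binary.Construct.Closure.ReflexiveTransitive as Star
import Relation.Binary.Construct.Closure.ReflexiveTransitive.Properties as Star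
open import Relation.Binary.Construct.Closure.Symmetric using (fwd)
open import Relation.Binary.Construct.Closure.Transitive using (TransClosure; _∷_)
import Relation.Binary.Construct.Closure.Transitive as Trans
open import Relation.Binary.Core using (Rel)
open import Relation.Binary.Definitions using (Tri; tri<; tri≈; tri>)
open import Relation.Binary.Structures using (IsStrictPartialOrder)
open import Relation.Binary.PropositionalEquality using (_≡_; _≢_; refl; sym; trans; setoid; cong; subst; subst₂; isEquivalence; resp₂)
open import Relation.Nullary using (¬_; ¬?; _×-dec_; Dec; yes; no; does)
open import Relation.Nullary.Decidable using (dec-true; dec-false; decidable-stable)
open import Relation.Unary using (_≐_)

-- Cyclic orders

-- Planarity is given only as a numerical identity for a rotation system, so no Jordan curve
-- argument is available. Euler's relation is used as an equality of cardinalities: vertices and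
-- faces on one side, edges and two extra values for the poles on the other. A total relation
-- between these sets that never shares a value is then a bijection, and uniqueness of corners is
-- read off from it. For a dominance diagram the same kind of bijection has to be constructed.
-- `Bipolar` retains a structure that is stable under reflection, so that the left tree, its
-- counterclockwise tour and the ordinates are handled by applying each result to `mirror B`. Tours
-- of different maps are never compared. `Labels` collects what times of visit, ranks and
-- coordinates of a dominance diagram have in common, and any two labellings order the vertices
-- alike. This rigidity gives both that `Ψ` undoes `Φ` and that `Ψ` is invariant under isomorphism.

Step : {A : Set} → (A → A) → Rel A 0ℓ
Step f a b = f a ≡ b

-- The local loop of `cyclicNext` remembers the head of the list, to which the last dart wraps
-- around. Inductions therefore remove the second element and keep the head.
cyclicNext-skip : ∀ {m} (x y z : Dart m) zs {d} → x ≢ d → y ≢ d →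
  cyclicNext (x ∷ y ∷ z ∷ zs) d ≡ cyclicNext (x ∷ z ∷ zs) d
cyclicNext-skip x y z zs {d} x≢d y≢d
  rewrite dec-false (x ≟ᵈ d) x≢d | dec-false (y ≟ᵈ d) y≢d = refl

cyclicNext-inner : ∀ {m} (as : List (Dart m)) {d d′} bs → d ∉ as →
  cyclicNext (as ++ d ∷ d′ ∷ bs) d ≡ d′
cyclicNext-inner []           {d} bs _  rewrite dec-true (d ≟ᵈ d) refl = refl
cyclicNext-inner (x ∷ [])     {d} bs ∉
  rewrite dec-false (x ≟ᵈ d) (∉ ∘ here ∘ sym) | dec-true (d ≟ᵈ d) refl = refl
cyclicNext-inner (x ∷ y ∷ []) {d} {d′} bs ∉ =
  trans (cyclicNext-skip x y d (d′ ∷ bs) (∉ ∘ here ∘ sym) (∉ ∘ there ∘ here ∘ sym))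
    (cyclicNext-inner (x ∷ []) bs (λ { (here p) → ∉ (here p) }))
cyclicNext-inner (x ∷ y ∷ z ∷ as) {d} {d′} bs ∉ =
  trans (cyclicNext-skip x y z (as ++ d ∷ d′ ∷ bs) (∉ ∘ here ∘ sym) (∉ ∘ there ∘ here ∘ sym))
    (cyclicNext-inner (x ∷ z ∷ as) bs
      (λ { (here p) → ∉ (here p) ; (there p) → ∉ (there (there p)) }))

cyclicNext-last : ∀ {m} (x : Dart m) as {d} → d ∉ x ∷ as →
  cyclicNext (x ∷ as ++ d ∷ []) d ≡ x
cyclicNext-last x [] {d} ∉
  rewrite dec-false (x ≟ᵈ d) (∉ ∘ here ∘ sym) | dec-true (d ≟ᵈ d) refl = refl
cyclicNext-last x (y ∷ []) {d} ∉ =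
  trans (cyclicNext-skip x y d [] (∉ ∘ here ∘ sym) (∉ ∘ there ∘ here ∘ sym))
    (cyclicNext-last x [] (λ { (here p) → ∉ (here p) }))
cyclicNext-last x (y ∷ z ∷ as) {d} ∉ =
  trans (cyclicNext-skip x y z (as ++ d ∷ []) (∉ ∘ here ∘ sym) (∉ ∘ there ∘ here ∘ sym))
    (cyclicNext-last x (z ∷ as)
      (λ { (here p) → ∉ (here p) ; (there p) → ∉ (there (there p)) }))

cyclicNext-singleton : ∀ {m} (d : Dart m) → cyclicNext (d ∷ []) d ≡ d
cyclicNext-singleton d rewrite dec-true (d ≟ᵈ d) refl = refl

-- Splitting the list by the position of `d` makes the converse visible: reversing the list
-- exchanges the two darts in each case.
data CyclicallyNext {A : Set} (d : A) : List A → A → Set where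
  inner : ∀ as d′ bs → CyclicallyNext d (as ++ d ∷ d′ ∷ bs) d′
  wrap  : ∀ x as → CyclicallyNext d (x ∷ as ++ d ∷ []) x
  alone : CyclicallyNext d (d ∷ []) d

cyclicallyNext : {A : Set} {d : A} {xs : List A} → d ∈ xs → ∃ (CyclicallyNext d xs)
cyclicallyNext {d = d} p with ∈.∈-∃++ p
... | as     , d′ ∷ bs , refl = d′ , inner as d′ bs
... | []     , []      , refl = d , alone
... | x ∷ as , []      , refl = x , wrap x as

Unique-++⁻ : {A : Set} (as : List A) {bs : List A} → Unique (as ++ bs) → ∀ {d} → d ∈ bs → d ∉ as
Unique-++⁻ (a ∷ as) (p ∷ u) d∈bs (here refl) = All.lookup p (∈.∈-++⁺ʳ as d∈bs) refl
Unique-++⁻ (a ∷ as) (p ∷ u) d∈bs (there q)   = Unique-++⁻ as u d∈bs q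

cyclicNext-CyclicallyNext : ∀ {m} {d d′ : Dart m} {xs} → Unique xs → CyclicallyNext d xs d′ →
  cyclicNext xs d ≡ d′
cyclicNext-CyclicallyNext u (inner as d′ bs) = cyclicNext-inner as bs (Unique-++⁻ as u (here refl))
cyclicNext-CyclicallyNext u (wrap x as) = cyclicNext-last x as (Unique-++⁻ (x ∷ as) u (here refl))
cyclicNext-CyclicallyNext u alone       = cyclicNext-singleton _

CyclicallyNext-reverse : {A : Set} {d d′ : A} {xs : List A} →
  CyclicallyNext d xs d′ → CyclicallyNext d′ (reverse xs) d
CyclicallyNext-reverse {d = d} (inner as d′ bs) =
  subst (λ l → CyclicallyNext d′ l d) (sym eq) (inner (reverse bs) d (reverse as))
  where
  eq : reverse (as ++ d ∷ d′ ∷ bs) ≡ reverse bs ++ d′ ∷ d ∷ reverse as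
  eq = trans (List.reverse-++ as (d ∷ d′ ∷ bs))
    (trans (cong (_++ reverse as) (List.reverse-++ (d ∷ d′ ∷ []) bs))
      (List.++-assoc (reverse bs) (d′ ∷ d ∷ []) (reverse as)))
CyclicallyNext-reverse {d = d} (wrap x as) =
  subst (λ l → CyclicallyNext x l d) (sym eq) (wrap d (reverse as))
  where
  eq : reverse (x ∷ as ++ d ∷ []) ≡ d ∷ reverse as ++ x ∷ []
  eq = trans (List.reverse-++ (x ∷ as) (d ∷ [])) (cong (d ∷_) (List.unfold-reverse x as))
CyclicallyNext-reverse alone = alone

CyclicallyNext-∈ : {A : Set} {d d′ : A} {xs : List A} → CyclicallyNext d xs d′ → d′ ∈ xs
CyclicallyNext-∈ (inner as d′ bs) = ∈.∈-++⁺ʳ as (there (here refl))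
CyclicallyNext-∈ (wrap x as)      = here refl
CyclicallyNext-∈ alone            = here refl

module _ {m : ℕ} {xs : List (Dart m)} (u : Unique xs) where

  private
    Next : Rel (Dart m) 0ℓ
    Next = Step (cyclicNext xs)

    suffix : ∀ as {d} bs → xs ≡ as ++ d ∷ bs → ∀ {d′} → d′ ∈ d ∷ bs → Star Next d d′
    suffix as bs       eq (here refl) = ε
    suffix as {d} (b ∷ bs) eq (there p) =
      subst (λ l → cyclicNext l d ≡ b) (sym eq)
        (cyclicNext-CyclicallyNext (subst Unique eq u) (inner as b bs))
      ◅ suffix (as ++ d ∷ []) bs (trans eq (sym (List.++-assoc as (d ∷ []) _))) p

    to-head : ∀ as {d} bs {x ys} → xs ≡ as ++ d ∷ bs → xs ≡ x ∷ ys → Star Next d x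
    to-head []       {d} [] eq refl with refl ← eq = ε
    to-head (a ∷ as) {d} [] eq refl with refl ← eq = cyclicNext-CyclicallyNext u (wrap a as) ◅ ε
    to-head as {d} (b ∷ bs) eq eq′ =
      subst (λ l → cyclicNext l d ≡ b) (sym eq)
        (cyclicNext-CyclicallyNext (subst Unique eq u) (inner as b bs))
      ◅ to-head (as ++ d ∷ []) bs (trans eq (sym (List.++-assoc as (d ∷ []) _))) eq′

  cyclicNext-orbit : ∀ {d d′} → d ∈ xs → d′ ∈ xs → Star Next d d′
  cyclicNext-orbit {d} {d′} d∈xs d′∈xs = go xs refl
    where
    go : ∀ ys → xs ≡ ys → Star Next d d′
    go []       eq with () ← subst (d ∈_) eq d∈xs
    go (y ∷ ys) eq with as , bs , eq′ ← ∈.∈-∃++ d∈xs =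
      to-head as bs eq′ eq ◅◅ suffix [] ys eq (subst (d′ ∈_) eq d′∈xs)

module Rotation {V : ℕ} (M : OrientedMap V) where
  open OrientedMap M

  private
    ∈-rotation : ∀ d → d ∈ rotation (origin d)
    ∈-rotation d = Equivalence.from (rotation-complete (origin d) d) refl

    cyc : ∀ d → ∃ (CyclicallyNext d (rotation (origin d)))
    cyc d = cyclicallyNext (∈-rotation d)

    next-cyc : ∀ d → next d ≡ proj₁ (cyc d)
    next-cyc d = cyclicNext-CyclicallyNext (rotation-unique (origin d)) (proj₂ (cyc d))

    CyclicallyNext-unreverse : ∀ {d d′} {xs : List (Dart edges)} →
      CyclicallyNext d (reverse xs) d′ → CyclicallyNext d′ xs d
    CyclicallyNext-unreverse {d} {d′} {xs} c =
      subst (λ l → CyclicallyNext d′ l d) (List.reverse-involutive xs) (CyclicallyNext-reverse c)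

    cyc′ : ∀ d → ∃ (CyclicallyNext d (reverse (rotation (origin d))))
    cyc′ d = cyclicallyNext (reverse⁺ (∈-rotation d))

  next-origin : ∀ d → origin (next d) ≡ origin d
  next-origin d = trans (cong origin (next-cyc d))
    (Equivalence.to (rotation-complete (origin d) _) (CyclicallyNext-∈ (proj₂ (cyc d))))

  private
    Unique-reverse : ∀ v → Unique (reverse (rotation v))
    Unique-reverse v = Permutationₛ.Unique-resp-↭ (setoid _)
      (↭⇒↭ₛ (↭-sym (↭-reverse (rotation v)))) (rotation-unique v)

    prev-cyc : ∀ d → prev d ≡ proj₁ (cyc′ d)
    prev-cyc d = cyclicNext-CyclicallyNext (Unique-reverse (origin d)) (proj₂ (cyc′ d))

  prev-origin : ∀ d → origin (prev d) ≡ origin d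
  prev-origin d = trans (cong origin (prev-cyc d))
    (Equivalence.to (rotation-complete (origin d) _)
      (reverse⁻ (CyclicallyNext-∈ (proj₂ (cyc′ d)))))

  prev-next : ∀ d → prev (next d) ≡ d
  prev-next d = subst (λ v → cyclicNext (reverse (rotation v)) (next d) ≡ d) (sym (next-origin d))
    (subst (λ d′ → cyclicNext (reverse (rotation (origin d))) d′ ≡ d) (sym (next-cyc d))
      (cyclicNext-CyclicallyNext (Unique-reverse _) (CyclicallyNext-reverse (proj₂ (cyc d)))))

  next-prev : ∀ d → next (prev d) ≡ d
  next-prev d = subst (λ v → cyclicNext (rotation v) (prev d) ≡ d) (sym (prev-origin d))
    (subst (λ d′ → cyclicNext (rotation (origin d)) d′ ≡ d) (sym (prev-cyc d))
      (cyclicNext-CyclicallyNext (rotation-unique _) (CyclicallyNext-unreverse (proj₂ (cyc′ d)))))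

  next-orbit : ∀ {d d′} → origin d ≡ origin d′ → Star (Step next) d d′
  next-orbit {d} {d′} eq = go refl
    (cyclicNext-orbit (rotation-unique (origin d)) (∈-rotation d)
      (Equivalence.from (rotation-complete _ _) (sym eq)))
    where
    go : ∀ {a b} → origin a ≡ origin d → Star (Step (cyclicNext (rotation (origin d)))) a b →
      Star (Step next) a b
    go _ ε = ε
    go {a} p (q ◅ s) =
      r ◅ go (trans (sym (cong origin r)) (trans (next-origin a) p)) s
      where r = trans (cong (λ v → cyclicNext (rotation v) a) p) q

-- Finite sets, orbits and paths

-- Two iterates of `a` coincide by the pigeonhole principle; cancelling the injective `f` shows that
-- `a` itself recurs, so every step can be undone by going around the orbit.
Star-symmetric : ∀ {n} {A : Set} (ι : A → Fin n) → (∀ {a b} → ι a ≡ ι b → a ≡ b) →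
  (f : A → A) → (∀ {a b} → f a ≡ f b → a ≡ b) →
  ∀ {a b} → Star (Step f) a b → Star (Step f) b a
Star-symmetric {n} ι ι-inj f f-inj = rev
  where
  iter : ℕ → _ → _
  iter zero    a = a
  iter (suc k) a = f (iter k a)

  path : ∀ k a → Star (Step f) a (iter k a)
  path zero    a = ε
  path (suc k) a = path k a ◅◅ (refl ◅ ε)

  cancel : ∀ i j a → i < j → iter i a ≡ iter j a → ∃ λ k → iter (suc k) a ≡ a
  cancel zero    (suc j) a _       p = j , sym p
  cancel (suc i) (suc j) a (s≤s q) p = cancel i j a q (f-inj p)

  shift : ∀ k a → iter k (f a) ≡ f (iter k a)
  shift zero    a = refl
  shift (suc k) a = cong f (shift k a)

  back : ∀ a → Star (Step f) (f a) a
  back a with i , j , i<j , eq ← Fin.pigeonhole (ℕ.n<1+n n) (λ i → ι (iter (toℕ i) a))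
         with k , p ← cancel (toℕ i) (toℕ j) a i<j (ι-inj eq) =
    subst (Star (Step f) (f a)) (trans (shift k a) p) (path k (f a))

  rev : ∀ {a b} → Star (Step f) a b → Star (Step f) b a
  rev ε                = ε
  rev (_◅_ {i = a} refl s) = rev s ◅◅ back a

injective⇒surjective : ∀ {m n} {f : Fin m → Fin n} → m ≡ n → (∀ {i j} → f i ≡ f j → i ≡ j) →
  ∀ y → ∃ λ x → f x ≡ y
injective⇒surjective {suc m} {.(suc m)} {f} refl f-inj y with Fin.any? (λ x → f x ≟ y)
... | yes p = p
... | no ¬p = ⊥-elim (ℕ.1+n≰n (Fin.injective⇒≤
  {f = λ x → punchOut (y≢f x)} (λ {i} {j} eq → f-inj (Fin.punchOut-injective (y≢f i) (y≢f j) eq))))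
  where
  y≢f : ∀ x → y ≢ f x
  y≢f x eq = ¬p (x , sym eq)

⊎-injective⇒surjective : ∀ {a b c d} → a + b ≡ c + d → (f : Fin a ⊎ Fin b → Fin c ⊎ Fin d) →
  (∀ {i j} → f i ≡ f j → i ≡ j) → ∀ y → ∃ λ x → f x ≡ y
⊎-injective⇒surjective {a} {b} {c} {d} eq f f-inj y
  with x , p ← injective⇒surjective {f = λ i → join c d (f (splitAt a i))} eq
    (λ {i} {j} q → trans (sym (Fin.join-splitAt a b i)) (trans (cong (join a b)
      (f-inj (trans (sym (Fin.splitAt-join c d _))
          (trans (cong (splitAt c) q) (Fin.splitAt-join c d _)))))
      (Fin.join-splitAt a b j))) (join c d y) =
  splitAt a x , trans (sym (Fin.splitAt-join c d _))
      (trans (cong (splitAt c) p) (Fin.splitAt-join c d y))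

-- Choosing a value for each index gives an injection between sets of equal size, hence a
-- surjection. A second value of `i` would be the chosen value of some index, and that index can
-- only be `i`.
functional : ∀ {a b c d} → a + b ≡ c + d → (R : Fin a ⊎ Fin b → Fin c ⊎ Fin d → Set) →
  (∀ i → ∃ (R i)) → (∀ {i j y} → R i y → R j y → i ≡ j) →
  ∀ {i y y′} → R i y → R i y′ → y ≡ y′
functional eq R total inj {i} r r′ = trans (sym (value r)) (value r′)
  where
  f = proj₁ ∘ total
  f-inj : ∀ {i j} → f i ≡ f j → i ≡ j
  f-inj {i} {j} p = inj (proj₂ (total i)) (subst (R j) (sym p) (proj₂ (total j)))
  value : ∀ {y} → R i y → f i ≡ y
  value {y} s with x , refl ← ⊎-injective⇒surjective eq f f-inj y =
      cong f (sym (inj (proj₂ (total x)) s))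

-- A discrete intermediate value theorem; the step found is the first at which `f` changes.
crossing : {A : Set} {R : Rel A 0ℓ} (f : A → Bool) (b : Bool) {a a′ : A} → Star R a a′ →
  f a ≡ b → f a′ ≡ not b →
  ∃ λ x → ∃ λ y → Star R a x × R x y × f x ≡ b × f y ≡ not b × Star R y a′
crossing f true  ε p q with () ← trans (sym p) q
crossing f false ε p q with () ← trans (sym p) q
crossing f b (_◅_ {j = c} r s) p q with f c in eq
crossing f true  (_◅_ {j = c} r s) p q | false = _ , c , ε , r , p , eq , s
crossing f false (_◅_ {j = c} r s) p q | true  = _ , c , ε , r , p , eq , s
crossing f true  (_◅_ {j = c} r s) p q | true
  with x , y , s′ , t ← crossing f true s eq q = x , y , r ◅ s′ , t
crossing f false (_◅_ {j = c} r s) p q | false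
  with x , y , s′ , t ← crossing f false s eq q = x , y , r ◅ s′ , t

Star-deterministic : {A : Set} {R : Rel A 0ℓ} → (∀ {a b c} → R a b → R a c → b ≡ c) →
  ∀ {a b c} → Star R a b → Star R a c → Star R b c ⊎ Star R c b
Star-deterministic det ε       t       = inj₁ t
Star-deterministic det (r ◅ s) ε       = inj₂ (r ◅ s)
Star-deterministic det (r ◅ s) (q ◅ t) with refl ← det r q = Star-deterministic det s t

unsnoc : {A : Set} {R : Rel A 0ℓ} → ∀ {a b c} → R a b → Star R b c → ∃ λ z → Star R a z × R z c
unsnoc p ε       = _ , ε , p
unsnoc p (q ◅ s) with z , t , r ← unsnoc q s = z , p ◅ t , r

module _ {n : ℕ} {_⟶_ : Rel (Fin n) 0ℓ} (acyclic : ∀ v → ¬ TransClosure _⟶_ v v) where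

  private
    closure : IsStrictPartialOrder _≡_ (TransClosure _⟶_)
    closure = record
      { isEquivalence = isEquivalence
      ; irrefl        = λ { refl p → acyclic _ p }
      ; trans         = Trans.transitive _
      ; <-resp-≈      = resp₂ _
      }

    mono : {_<₁_ _<₂_ : Rel (Fin n) 0ℓ} → (∀ {u v} → u <₁ v → u <₂ v) →
      ∀ {v} → Acc _<₂_ v → Acc _<₁_ v
    mono f (acc rs) = acc λ r → mono f (rs (f r))

  acyclic⇒wellFounded : WellFounded _⟶_
  acyclic⇒wellFounded v = mono Trans.[_] (spo-wellFounded closure v)

  acyclic⇒noetherian : WellFounded (λ v u → u ⟶ v)
  acyclic⇒noetherian v = mono Trans.[_] (spo-noetherian closure v)

-- A plane bipolar poset, in a form that is symmetric under reflection: the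
-- corners at a vertex other than S and N change only once from outgoing to
-- ingoing darts and once back, and every inner face consists of two directed
-- paths.  The outer face has its corners at S just before the dart root, and
-- at N between the darts into ν and into ν′.
record Bipolar (V E : ℕ) : Set where
  field
    src tgt : Fin E → Fin V

  origin : Dart E → Fin V
  origin = [ src , tgt ]

  _⟶_ : Rel (Fin V) 0ℓ
  _⟶_ = λ u v → ∃ λ e → src e ≡ u × tgt e ≡ v

  _⊴_ : Rel (Fin V) 0ℓ
  _⊴_ = Star _⟶_

  field
    next prev   : Dart E → Dart E
    next-prev   : ∀ d → next (prev d) ≡ d
    prev-next   : ∀ d → prev (next d) ≡ d
    next-origin : ∀ d → origin (next d) ≡ origin d
    next-orbit  : ∀ {d d′} → origin d ≡ origin d′ → Star (Step next) d d′
    S N         : Fin V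
    S-source    : ∀ e → tgt e ≢ S
    N-sink      : ∀ e → src e ≢ N
    ingoing     : ∀ {v} → v ≢ S → ∃ λ e → tgt e ≡ v
    outgoing    : ∀ {v} → v ≢ N → ∃ λ e → src e ≡ v
    root        : Dart E
    root-origin : origin root ≡ S
    ν ν′        : Fin E
    next-ν      : next (into ν) ≡ into ν′
    ν-N         : tgt ν ≡ N
    wellFounded : WellFounded _⟶_
    noetherian  : WellFounded (λ v u → u ⟶ v)
    not-transitive : ∀ {e e′} → src e ≡ src e′ → e ≢ e′ → ¬ (tgt e′ ⊴ tgt e)

  -- OutAdj h g and InAdj h g: h is the left neighbour of g.  RTurn p e and
  -- LTurn p e: the path p, e has a corner to its right, resp. its left, with
  -- no other edge in it.
  OutAdj : Rel (Fin E) 0ℓ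
  OutAdj = λ h g → next (out h) ≡ out g × out g ≢ root

  InAdj : Rel (Fin E) 0ℓ
  InAdj = λ e e′ → next (into e′) ≡ into e × e′ ≢ ν

  RTurn : Rel (Fin E) 0ℓ
  RTurn = λ p e → next (out e) ≡ into p

  LTurn : Rel (Fin E) 0ℓ
  LTurn = λ p e → next (into p) ≡ out e

  field
    RTurn-unique : ∀ {p p′ e e′} → RTurn p e → RTurn p′ e′ → src e ≡ src e′ → e ≡ e′
    LTurn-unique : ∀ {p p′ e e′} → LTurn p e → LTurn p′ e′ → tgt p ≡ tgt p′ → p ≡ p′
    face-below   : ∀ {e e′} → InAdj e e′ →
      ∃ λ h → ∃ λ g → OutAdj h g × Star RTurn h e × Star LTurn g e′

  next-injective : ∀ {d d′} → next d ≡ next d′ → d ≡ d′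
  next-injective {d} {d′} eq = trans (sym (prev-next d)) (trans (cong prev eq) (prev-next d′))

  next⇒prev : ∀ {d d′} → next d ≡ d′ → prev d′ ≡ d
  next⇒prev {d} refl = prev-next d

  prev⇒next : ∀ {d d′} → prev d ≡ d′ → next d′ ≡ d
  prev⇒next {d} refl = next-prev d

  next≡⇒origin≡ : ∀ {d d′} → next d ≡ d′ → origin d ≡ origin d′
  next≡⇒origin≡ {d} refl = sym (next-origin d)

  OutAdj-src : ∀ {h g} → OutAdj h g → src h ≡ src g
  OutAdj-src (p , _) = next≡⇒origin≡ p

  InAdj-tgt : ∀ {e e′} → InAdj e e′ → tgt e ≡ tgt e′
  InAdj-tgt (p , _) = sym (next≡⇒origin≡ p)

  RTurn-meet : ∀ {p e} → RTurn p e → tgt p ≡ src e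
  RTurn-meet p = sym (next≡⇒origin≡ p)

  LTurn-meet : ∀ {p e} → LTurn p e → tgt p ≡ src e
  LTurn-meet p = next≡⇒origin≡ p

-- The marked corner lies between `prev root` and `root`, so that seen counterclockwise it precedes
-- `prev root`. In the same way the outer corner at `N` exchanges `ν` and `ν′`. Right and left turns
-- are exchanged, and with them their uniqueness laws and the two sides of each face.
mirror : ∀ {V E} → Bipolar V E → Bipolar V E
mirror B = record
  { src = src ; tgt = tgt ; next = prev ; prev = next ; next-prev = prev-next ; prev-next =
      next-prev
  ; next-origin = prev-origin ; next-orbit = λ p → reversed (next-orbit (sym p)) ; S = S ; N = N
  ; S-source = S-source ; N-sink = N-sink ; ingoing = ingoing ; outgoing = outgoing
  ; root = prev root ; root-origin = trans (prev-origin root) root-origin ; ν = ν′ ; ν′ = ν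
  ; next-ν = next⇒prev next-ν ; ν-N = trans (sym (next≡⇒origin≡ next-ν)) ν-N
  ; wellFounded = wellFounded ; noetherian = noetherian ; not-transitive = not-transitive
  ; RTurn-unique = λ p q eq → out-injective (LTurn-unique (prev⇒next p) (prev⇒next q)
      (trans (LTurn-meet (prev⇒next p)) (trans eq (sym (LTurn-meet (prev⇒next q))))))
          (prev⇒next p) (prev⇒next q)
  ; LTurn-unique = λ p q eq → into-injective (RTurn-unique (prev⇒next p) (prev⇒next q)
      (trans (sym (RTurn-meet (prev⇒next p))) (trans eq (RTurn-meet (prev⇒next q)))))
          (prev⇒next p) (prev⇒next q)
  ; face-below = λ { (p , e′≢ν′) →
      let h , g , (q , g≢root) , s , t =
            face-below (prev⇒next p , λ { refl →
                e′≢ν′ (sym (inj₂-injective (trans (sym next-ν) (prev⇒next p)))) })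
      in g , h , (next⇒prev q , λ r → g≢root (trans (sym q) (prev⇒next (sym r)))) ,
         Star.gmap id next⇒prev t , Star.gmap id next⇒prev s }
  }
  where
  open Bipolar B
  prev-origin : ∀ d → origin (prev d) ≡ origin d
  prev-origin d = trans (sym (next-origin (prev d))) (cong origin (next-prev d))
  reversed : ∀ {d d′} → Star (Step next) d d′ → Star (Step prev) d′ d
  reversed = Star.reverse next⇒prev
  out-injective : ∀ {p p′ e e′} → p ≡ p′ → LTurn p e → LTurn p′ e′ → e ≡ e′
  out-injective refl q r = inj₁-injective (trans (sym q) r)
  into-injective : ∀ {p p′ e e′} → e ≡ e′ → RTurn p e → RTurn p′ e′ → p ≡ p′
  into-injective refl q r = inj₂-injective (trans (sym q) r)

not≢ : ∀ {b} → b ≢ not b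
not≢ {true}  ()
not≢ {false} ()

bool-cases : ∀ x b → x ≡ b ⊎ x ≡ not b
bool-cases true  true  = inj₁ refl
bool-cases true  false = inj₂ refl
bool-cases false true  = inj₂ refl
bool-cases false false = inj₁ refl

-- Corners of a plane bipolar poset, counted by Euler's relation

module Counting {V : ℕ} (M : OrientedMap V) (P : IsPlaneBipolarPoset M) where
  open OrientedMap M
  open IsPlaneBipolarPoset P
  open IsPlanar planar
  open Rotation M

  wellFounded : WellFounded _⟶_
  wellFounded = acyclic⇒wellFounded acyclic

  noetherian : WellFounded (λ v u → u ⟶ v)
  noetherian = acyclic⇒noetherian acyclic

  ingoing : ∀ {v} → v ≢ S → ∃ λ e → tgt e ≡ v
  ingoing {v} v≢S with Fin.any? (λ e → tgt e ≟ v)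
  ... | yes p = p
  ... | no ¬p = ⊥-elim (v≢S (S-unique v (λ e q → ¬p (e , q))))

  outgoing : ∀ {v} → v ≢ N → ∃ λ e → src e ≡ v
  outgoing {v} v≢N with Fin.any? (λ e → src e ≟ v)
  ... | yes p = p
  ... | no ¬p = ⊥-elim (v≢N (N-unique v (λ e q → ¬p (e , q))))

  dart : Bool → Fin edges → Dart edges
  dart true  = out
  dart false = into

  dart-isOut : ∀ d {b} → isOut d ≡ b → ∃ λ e → d ≡ dart b e
  dart-isOut (out  e) refl = e , refl
  dart-isOut (into e) refl = e , refl

  -- These classify the corner that follows `dart b e` clockwise. For `true` a lateral corner is on
  -- the right of its vertex and an extremal one at the bottom of a face; for `false` they are on
  -- the left and at the top.
  Lateral Extremal : Bool → Fin edges → Set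
  Lateral  b e = isOut (next (dart b e)) ≡ not b
  Extremal b e = isOut (next (dart b e)) ≡ b

  -- As `faceNext` swaps before it turns, the face of this dart is the one that contains the corner
  -- after `dart b e`.
  peak : Bool → Fin edges → Dart edges
  peak b e = swap (dart b e)

  lateral-exists : ∀ b v → v ≢ S → v ≢ N → ∃ λ e → origin (dart b e) ≡ v × Lateral b e
  lateral-exists b v v≢S v≢N
    with i , p ← ingoing v≢S | o , q ← outgoing v≢N = from (darts b)
    where
    darts : ∀ b → ∃ λ d → ∃ λ d′ → isOut d ≡ b × isOut d′ ≡ not b × origin d ≡ v × origin d′ ≡ v
    darts true  = out o , into i , refl , refl , q , p
    darts false = into i , out o , refl , refl , p , q
    next-origins : ∀ {d d′} → Star (Step next) d d′ → origin d ≡ origin d′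
    next-origins ε = refl
    next-origins (refl ◅ s) = trans (sym (next-origin _)) (next-origins s)
    from : (∃ λ d → ∃ λ d′ → isOut d ≡ b × isOut d′ ≡ not b × origin d ≡ v × origin d′ ≡ v) → _
    from (d , d′ , d-b , d′-b , refl , d′-v)
      with x , y , s , refl , x-b , y-b , _ ← crossing isOut b (next-orbit (sym d′-v)) d-b d′-b
      with e , refl ← dart-isOut x x-b = e , sym (next-origins s) , y-b

  RTurn LTurn : Rel (Fin edges) 0ℓ
  RTurn p e = next (out e) ≡ into p
  LTurn p e = next (into p) ≡ out e

  -- The walk goes down along `e` with the face on its right and continues through right turns.
  -- Well-foundedness makes it end, and it can only end between two outgoing darts.
  descend : ∀ e → Acc _⟶_ (src e) →
    ∃ λ h → ∃ λ g → next (out h) ≡ out g × Star RTurn h e × SameFace (into e) (into h)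
  descend e (acc rs) with next (out e) in eq
  ... | out g  = e , g , eq , ε , ε
  ... | into p
    with h , g , x , t , s ←
      descend p (rs (p , refl , trans (sym (cong origin eq)) (next-origin (out e)))) =
    h , g , x , t ◅◅ (eq ◅ ε) , eq ◅ s

  ascend : ∀ e → Acc (λ v u → u ⟶ v) (tgt e) →
    ∃ λ h → ∃ λ g → next (into h) ≡ into g × Star LTurn e h × SameFace (out e) (out h)
  ascend e (acc rs) with next (into e) in eq
  ... | into g = e , g , eq , ε , ε
  ... | out g′
    with h , g , x , t , s ←
      ascend g′ (rs (g′ , trans (sym (cong origin eq)) (next-origin (into e)) , refl)) =
    h , g , x , eq ◅ t , eq ◅ s

  face-peak : ∀ b d → ∃ λ e → Extremal b e × SameFace d (peak b e)
  face-peak true  (into e) with h , _ , x , _ , s ← descend e (wellFounded _) = h , cong isOut x , s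
  face-peak false (out e)  with h , _ , x , _ , s ← ascend e (noetherian _) = h , cong isOut x , s
  face-peak true  (out e)
    with h , g , x , _ , s ← ascend e (noetherian _)
    with k , _ , y , _ , t ← descend g (wellFounded _) = k , cong isOut y , s ◅◅ (x ◅ t)
  face-peak false (into e)
    with h , g , x , _ , s ← descend e (wellFounded _)
    with k , _ , y , _ , t ← ascend g (noetherian _) = k , cong isOut y , s ◅◅ (x ◅ t)

  -- By Euler's relation, counting corners shows that a vertex other than S, N
  -- has only one lateral corner of each kind and a face only one peak of each kind.
  Corner : Bool → Fin V ⊎ Fin faces → Fin edges ⊎ Fin 2 → Set
  Corner b (inj₁ v) (inj₁ e)          = Lateral b e × origin (dart b e) ≡ v
  Corner b (inj₁ v) (inj₂ zero)       = v ≡ S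
  Corner b (inj₁ v) (inj₂ (suc zero)) = v ≡ N
  Corner b (inj₂ f) (inj₁ e)          = Extremal b e × face (peak b e) ≡ f
  Corner b (inj₂ f) (inj₂ _)          = ⊥

  Corner-total : ∀ b i → ∃ (Corner b i)
  Corner-total b (inj₁ v) with v ≟ S | v ≟ N
  ... | yes p | _     = inj₂ zero , p
  ... | no _  | yes p = inj₂ (suc zero) , p
  ... | no p  | no q  with e , r , s ← lateral-exists b v p q = inj₁ e , s , r
  Corner-total b (inj₂ f) with d , p ← face-surjective f
    with e , x , s ← face-peak b d =
    inj₁ e , x , trans (sym (Equivalence.from (face-orbits _ _) s)) (p refl)

  Corner-disjoint : ∀ b {i j y} → Corner b i y → Corner b j y → i ≡ j
  Corner-disjoint b {inj₁ v} {inj₁ w} {inj₁ e} (_ , p) (_ , q) = cong inj₁ (trans (sym p) q)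
  Corner-disjoint b {inj₁ v} {inj₁ w} {inj₂ zero} p q = cong inj₁ (trans p (sym q))
  Corner-disjoint b {inj₁ v} {inj₁ w} {inj₂ (suc zero)} p q = cong inj₁ (trans p (sym q))
  Corner-disjoint b {inj₁ v} {inj₂ f} {inj₁ e} (p , _) (q , _) = ⊥-elim (not≢ (trans (sym q) p))
  Corner-disjoint b {inj₂ f} {inj₁ v} {inj₁ e} (p , _) (q , _) = ⊥-elim (not≢ (trans (sym p) q))
  Corner-disjoint b {inj₂ f} {inj₂ g} {inj₁ e} (_ , p) (_ , q) = cong inj₂ (trans (sym p) q)

  lateral-unique : ∀ b {e e′} → Lateral b e → Lateral b e′ →
    origin (dart b e) ≡ origin (dart b e′) → e ≡ e′
  lateral-unique b {e} {e′} x y p = inj₁-injective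
    (functional euler (Corner b) (Corner-total b) (Corner-disjoint b)
      {inj₁ (origin (dart b e))} {inj₁ e} {inj₁ e′} (x , refl) (y , sym p))

  extremal-unique : ∀ b {e e′} → Extremal b e → Extremal b e′ →
    SameFace (peak b e) (peak b e′) → e ≡ e′
  extremal-unique b {e} {e′} x y s = inj₁-injective
    (functional euler (Corner b) (Corner-total b) (Corner-disjoint b)
      {inj₂ (face (peak b e))} {inj₁ e} {inj₁ e′} (x , refl)
      (y , sym (Equivalence.from (face-orbits _ _) s)))

  SameFace-sym : ∀ {d d′} → SameFace d d′ → SameFace d′ d
  SameFace-sym s = Equivalence.to (face-orbits _ _) (sym (Equivalence.from (face-orbits _ _) s))

  N-into : ∀ d → origin d ≡ N → ∃ λ e → d ≡ into e
  N-into (out e)  p = ⊥-elim (N-sink e p)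
  N-into (into e) p = e , refl

  bipolar : Bipolar V edges
  bipolar = record
    { src = src ; tgt = tgt ; next = next ; prev = prev ; next-prev = next-prev
    ; prev-next = prev-next ; next-origin = next-origin ; next-orbit = next-orbit ; S = S ; N = N
    ; S-source = S-source ; N-sink = N-sink ; ingoing = ingoing ; outgoing = outgoing
    ; root = root ; root-origin = refl ; ν = ν ; ν′ = ν′ ; next-ν = next-ν ; ν-N = ν-N
    ; wellFounded = wellFounded ; noetherian = noetherian ; not-transitive = bypass
    ; RTurn-unique = λ p q → lateral-unique true (cong isOut p) (cong isOut q)
    ; LTurn-unique = λ p q → lateral-unique false (cong isOut p) (cong isOut q)
    ; face-below = face-below
    }
    where
    top : ∃ λ e → SameFace root (into e) × tgt e ≡ N
    top with d , s , p ← N-outer with e , refl ← N-into d p = e , s , p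

    ν′ = proj₁ top

    before-top : ∃ λ e → prev (into ν′) ≡ into e
    before-top = N-into _ (trans (prev-origin (into ν′)) (proj₂ (proj₂ top)))

    ν = proj₁ before-top

    next-ν : next (into ν) ≡ into ν′
    next-ν = trans (cong next (sym (proj₂ before-top))) (next-prev (into ν′))

    ν-N : tgt ν ≡ N
    ν-N = trans (sym (next-origin (into ν))) (trans (cong origin next-ν) (proj₂ (proj₂ top)))

    -- Only the first edge has to differ from `e`: no later edge of the path can be `e`, since a
    -- return to `src e` would close a cycle.
    bypass : ∀ {e e′} → src e ≡ src e′ → e ≢ e′ → ¬ Star _⟶_ (tgt e′) (tgt e)
    bypass {e} {e′} p e≢e′ s = not-transitive e
      ((e′ , e≢e′ ∘ sym , sym p , refl) ◅ avoid s (Trans.[_] (e′ , sym p , refl)))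
      where
      avoid : ∀ {u w} → Star _⟶_ u w → TransClosure _⟶_ (src e) u →
        Star (λ u v → u ⟶[avoiding e ] v) u w
      avoid ε _ = ε
      avoid (x@(e″ , q , r) ◅ s) t =
        (e″ , (λ { refl → acyclic _ (subst (TransClosure _⟶_ (src e)) (sym q) t) }) , q , r)
        ◅ avoid s (t Trans.∷ʳ x)

    face-below : ∀ {e e′} → next (into e′) ≡ into e × e′ ≢ ν →
      ∃ λ h → ∃ λ g → (next (out h) ≡ out g × out g ≢ root) × Star RTurn h e × Star LTurn g e′
    face-below {e} {e′} (p , e′≢ν)
      with h , g , x , t , s ← descend e (wellFounded _)
      with k , _ , y , t′ , s′ ← ascend g (noetherian _) =
      h , g , (x , g≢root) , t , subst (Star LTurn g) (sym e′≡k) t′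
      where
      -- Both edges precede a top corner of the same face, and a face has just one.
      e′≡k : e′ ≡ k
      e′≡k = extremal-unique false (cong isOut p) (cong isOut y) (p ◅ s ◅◅ (x ◅ s′))
      -- If `out g` were the root, this would be the outer face, whose top corner follows `ν`.
      g≢root : out g ≢ root
      g≢root q = e′≢ν (extremal-unique false (cong isOut p) (cong isOut next-ν)
        ((p ◅ s ◅◅ (trans x q ◅ ε)) ◅◅ (proj₁ (proj₂ top) ◅◅ SameFace-sym (next-ν ◅ ε))))

isOut-true : ∀ {m} (d : Dart m) → isOut d ≡ true → ∃ λ e → d ≡ out e
isOut-true (out e) _ = e , refl

isOut-false : ∀ {m} (d : Dart m) → isOut d ≡ false → ∃ λ e → d ≡ into e
isOut-false (into e) _ = e , refl

-- Linear orders around the vertices, paths and forks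

module Chains {V E : ℕ} (B : Bipolar V E) where
  open Bipolar B

  -- At every vertex the clockwise order is cut into a linear order, with the
  -- outgoing darts from left to right first and the ingoing ones from right
  -- to left after them.
  Last : Dart E → Set
  Last (out e)  = next (out e) ≡ root
  Last (into e) = isOut (next (into e)) ≡ true ⊎ e ≡ ν

  Last? : ∀ d → Dec (Last d)
  Last? (out e)  = next (out e) ≟ᵈ root
  Last? (into e) with isOut (next (into e)) | e ≟ ν
  ... | true  | _     = yes (inj₁ refl)
  ... | false | yes p = yes (inj₂ p)
  ... | false | no ¬p = no λ { (inj₂ p) → ¬p p }

  Next : Rel (Dart E) 0ℓ
  Next d d′ = next d ≡ d′ × ¬ Last d

  private
    ν-not-lateral : ∀ {e} → isOut (next (into e)) ≡ true → tgt e ≢ N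
    ν-not-lateral {e} p q with g , r ← isOut-true _ p =
      N-sink g (trans (sym (cong origin r)) (trans (next-origin (into e)) q))

  Last-unique : ∀ {d d′} → Last d → Last d′ → origin d ≡ origin d′ → d ≡ d′
  Last-unique {out _}  {out _}  p q _ = next-injective (trans p (sym q))
  Last-unique {out e}  {into i} p _ r =
    ⊥-elim (S-source i (trans (sym r) (trans (next≡⇒origin≡ p) root-origin)))
  Last-unique {into i} {out e}  _ q r =
    ⊥-elim (S-source i (trans r (trans (next≡⇒origin≡ q) root-origin)))
  Last-unique {into e} {into e′} (inj₁ p) (inj₁ q) r
    with _ , p′ ← isOut-true _ p | _ , q′ ← isOut-true _ q = cong into (LTurn-unique p′ q′ r)
  Last-unique {into e} {into e′} (inj₁ p) (inj₂ refl) r = ⊥-elim (ν-not-lateral p (trans r ν-N))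
  Last-unique {into e} {into e′} (inj₂ refl) (inj₁ q) r =
    ⊥-elim (ν-not-lateral q (trans (sym r) ν-N))
  Last-unique {into e} {into e′} (inj₂ refl) (inj₂ refl) r = refl

  next-origins : ∀ {d d′} → Star (Step next) d d′ → origin d ≡ origin d′
  next-origins ε          = refl
  next-origins (refl ◅ s) = trans (sym (next-origin _)) (next-origins s)

  private abstract
    last-at : ∀ v → ∃ λ d → origin d ≡ v × Last d
    last-at v with v ≟ S | v ≟ N
    ... | yes refl | _ = prev root , origin-S , last (prev root) origin-S (next-prev root)
      where
      origin-S : origin (prev root) ≡ S
      origin-S = trans (next≡⇒origin≡ (next-prev root)) root-origin
      last : ∀ d → origin d ≡ S → next d ≡ root → Last d
      last (out e)  _ p = p
      last (into e) q _ = ⊥-elim (S-source e q)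
    ... | no _ | yes refl = into ν , ν-N , inj₂ refl
    ... | no v≢S | no v≢N
      with i , refl ← ingoing v≢S | o , q ← outgoing v≢N
      with x , y , s , refl , x-in , y-out , _ ←
        crossing isOut false (next-orbit {into i} {out o} (sym q)) refl refl
      with e , refl ← isOut-false x x-in = into e , sym (next-origins s) , inj₁ y-out

  last : Fin V → Dart E
  last v = proj₁ (last-at v)

  last-origin : ∀ v → origin (last v) ≡ v
  last-origin v = proj₁ (proj₂ (last-at v))

  Last-last : ∀ v → Last (last v)
  Last-last v = proj₂ (proj₂ (last-at v))

  first : Fin V → Dart E
  first v = next (last v)

  Last⇒≡last : ∀ {d v} → Last d → origin d ≡ v → d ≡ last v
  Last⇒≡last {v = v} p q = Last-unique p (Last-last v) (trans q (sym (last-origin v)))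

  first-origin : ∀ v → origin (first v) ≡ v
  first-origin v = trans (next-origin _) (last-origin v)

  first-S : first S ≡ root
  first-S with last S in eq | Last-last S | last-origin S
  ... | out e  | p | _ = p
  ... | into e | _ | q = ⊥-elim (S-source e q)

  first-Last : ∀ {d v} → Last d → origin d ≡ v → next d ≡ first v
  first-Last p q = cong next (Last⇒≡last p q)

  -- The cyclic orbit that leads to `d` may wrap around. Each time it passes the last dart, the
  -- chain collected so far is dropped and a new one begins at `first`.
  from-first : ∀ d → Star Next (first (origin d)) d
  from-first d = go (next-orbit (first-origin (origin d))) (first-origin (origin d)) ε
    where
    go : ∀ {a} → Star (Step next) a d → origin a ≡ origin d →
      Star Next (first (origin d)) a → Star Next (first (origin d)) d
    go ε _ t = t
    go {a} (refl ◅ s) p t with Last? a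
    ... | yes l = go s (trans (next-origin a) p)
      (subst (Star Next (first (origin d))) (sym (first-Last l p)) ε)
    ... | no ¬l = go s (trans (next-origin a) p) (t ◅◅ ((refl , ¬l) ◅ ε))

  Next-linear : ∀ {d d′} → origin d ≡ origin d′ → Star Next d d′ ⊎ Star Next d′ d
  Next-linear {d} {d′} p = Star-deterministic (λ (q , _) (r , _) → trans (sym q) r)
    (from-first d) (subst (λ v → Star Next (first v) d′) (sym p) (from-first d′))

  -- As `next` is injective, a cycle can be shifted back one dart at a time to the first dart, which
  -- would then have a predecessor in the chain; but its predecessor under `next` is the last dart.
  Next-acyclic : ∀ {d d′} → Next d d′ → ¬ Star Next d′ d
  Next-acyclic {d} = go (Star.reverse id (from-first d))
    where
    go : ∀ {a b} → Star (λ x y → Next y x) a (first (origin d)) → Next a b → ¬ Star Next b a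
    go ε p s with z , _ , r , ¬l ← unsnoc p s =
      ¬l (subst Last (next-injective (sym r)) (Last-last (origin d)))
    go ((q , ¬l) ◅ u) p s with z , t , r ,
        _ ← unsnoc p s with refl ← next-injective (trans r (sym q)) =
      go u (q , ¬l) t

  private
    from-Last : ∀ {l d} → Last l → Star Next l d → Star Next d l
    from-Last l ε              = ε
    from-Last l ((_ , ¬l) ◅ _) = ⊥-elim (¬l l)

  to-last : ∀ d → Star Next d (last (origin d))
  to-last d = Sum.fromInj₁ (from-Last (Last-last (origin d)))
    (Next-linear {d} {last (origin d)} (sym (last-origin (origin d))))

  into-Next-out : ∀ {e g} → ¬ Star Next (into e) (out g)
  into-Next-out {e} (_◅_ {j = into _} _ s) = into-Next-out s
  into-Next-out {e} (_◅_ {j = out _} (p , ¬l) s) = ¬l (inj₁ (cong isOut p))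

  Next⇒OutAdj : ∀ {h g} → Star Next (out h) (out g) → Star OutAdj h g
  Next⇒OutAdj ε = ε
  Next⇒OutAdj (_◅_ {j = out _} (p , ¬l) s) = (p , λ q → ¬l (trans p q)) ◅ Next⇒OutAdj s
  Next⇒OutAdj (_◅_ {j = into _} _ s) = ⊥-elim (into-Next-out s)

  OutAdj⇒Next : ∀ {h g} → OutAdj h g → Next (out h) (out g)
  OutAdj⇒Next (p , q) = p , λ r → q (trans (sym p) r)

  Next⇒InAdj : ∀ {e e′} → Star Next (into e′) (into e) → Star InAdj e e′
  Next⇒InAdj ε = ε
  Next⇒InAdj (_◅_ {j = into _} (p , ¬l) s) = Next⇒InAdj s ◅◅ ((p , λ { q → ¬l (inj₂ q) }) ◅ ε)
  Next⇒InAdj (_◅_ {j = out _} (p , ¬l) s) = ⊥-elim (¬l (inj₁ (cong isOut p)))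

  InAdj*-tgt : ∀ {e e′} → Star InAdj e e′ → tgt e ≡ tgt e′
  InAdj*-tgt ε       = refl
  InAdj*-tgt (a ◅ s) = trans (InAdj-tgt a) (InAdj*-tgt s)

  OutLt : Rel (Fin E) 0ℓ
  OutLt h g = ∃ λ k → OutAdj h k × Star OutAdj k g

  OutAdj*-src : ∀ {h g} → Star OutAdj h g → src h ≡ src g
  OutAdj*-src ε       = refl
  OutAdj*-src (q ◅ s) = trans (OutAdj-src q) (OutAdj*-src s)

  OutLt-src : ∀ {h g} → OutLt h g → src h ≡ src g
  OutLt-src (k , q , s) = OutAdj*-src (q ◅ s)

  OutLt-irrefl : ∀ {h} → ¬ OutLt h h
  OutLt-irrefl (k , p , s) = Next-acyclic (OutAdj⇒Next p) (Star.gmap out OutAdj⇒Next s)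

  OutLt-cases : ∀ {h g} → src h ≡ src g → h ≢ g → OutLt h g ⊎ OutLt g h
  OutLt-cases {h} {g} p h≢g = Sum.map (lt h≢g ∘ Next⇒OutAdj) (lt (h≢g ∘ sym) ∘ Next⇒OutAdj)
    (Next-linear {out h} {out g} p)
    where
    lt : ∀ {h g} → h ≢ g → Star OutAdj h g → OutLt h g
    lt h≢g ε       = ⊥-elim (h≢g refl)
    lt h≢g (p ◅ s) = _ , p , s

  -- p is the rightmost ingoing edge of a vertex other than S and N.
  Tree : Fin E → Set
  Tree p = ∃ (RTurn p)

  Tree-unique : ∀ {p p′} → Tree p → Tree p′ → tgt p ≡ tgt p′ → p ≡ p′
  Tree-unique (x , r) (x′ , r′) q
    with refl ← RTurn-unique r r′ (trans (sym (RTurn-meet r)) (trans q (RTurn-meet r′))) =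
    inj₂-injective (trans (sym r) r′)

  Tree-N : ∀ {p} → Tree p → tgt p ≢ N
  Tree-N (x , r) q = N-sink x (trans (sym (RTurn-meet r)) q)

  root-out : isOut root ≡ true
  root-out with root | root-origin
  ... | out _  | _ = refl
  ... | into e | p = ⊥-elim (S-source e p)

  S≢N : S ≢ N
  S≢N p with e , q ← isOut-true root root-out =
    N-sink e (trans (cong origin (sym q)) (trans root-origin p))

  first-out : ∀ {v} → v ≢ N → isOut (first v) ≡ true
  first-out {v} v≢N with last v | Last-last v | last-origin v
  ... | into x | inj₁ p    | q = p
  ... | into x | inj₂ refl | q = ⊥-elim (v≢N (trans (sym q) ν-N))
  ... | out x  | p         | q = trans (cong isOut p) root-out

  leftmost : ∀ g → ∃ λ g₀ → first (src g) ≡ out g₀ × Star OutAdj g₀ g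
  leftmost g with g₀ , p ← isOut-true _ (first-out (N-sink g)) =
    g₀ , p , Next⇒OutAdj (subst (λ d → Star Next d (out g)) p (from-first (out g)))

  rightmost : ∀ e → tgt e ≢ N → ∃ λ p → Tree p × Star InAdj e p
  rightmost e e≢N
    with x , y , s , (p , _) , x-out , y-in , t ←
      crossing isOut true (from-first (into e)) (first-out e≢N) refl
    with g , refl ← isOut-true x x-out | i , refl ← isOut-false y y-in = i , (g , p) , Next⇒InAdj t

  tree-parent : ∀ {v} → v ≢ S → v ≢ N → ∃ λ p → Tree p × tgt p ≡ v
  tree-parent v≢S v≢N with e , refl ← ingoing v≢S with p , t , s ← rightmost e v≢N = p , t ,
      sym (InAdj*-tgt s)

  S⊴ : ∀ v → S ⊴ v
  S⊴ v = go v (wellFounded v)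
    where
    go : ∀ v → Acc _⟶_ v → S ⊴ v
    go v (acc rs) with v ≟ S
    ... | yes refl = ε
    ... | no v≢S with e , p ← ingoing v≢S = go (src e) (rs (e , refl , p)) ◅◅ ((e , refl , p) ◅ ε)

  ⊴N : ∀ v → v ⊴ N
  ⊴N v = go v (noetherian v)
    where
    go : ∀ v → Acc (λ v u → u ⟶ v) v → v ⊴ N
    go v (acc rs) with v ≟ N
    ... | yes refl = ε
    ... | no v≢N with e , p ← outgoing v≢N = (e , p , refl) ◅ go (tgt e) (rs (e , p , refl))

  ⟶-⊴-acyclic : ∀ {u v} → u ⟶ v → ¬ v ⊴ u
  ⟶-⊴-acyclic {u} {v} p s = go u (wellFounded u) p s
    where
    go : ∀ u {v} → Acc _⟶_ u → u ⟶ v → ¬ v ⊴ u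
    go u (acc rs) p ε       = go u (rs p) p ε
    go u (acc rs) p (q ◅ s) with z , t , r ← unsnoc q s = go z (rs r) r (p ◅ t)

  _⊴?_ : ∀ u v → Dec (u ⊴ v)
  u ⊴? v = go u (noetherian u)
    where
    go : ∀ u → Acc (λ v u → u ⟶ v) u → Dec (u ⊴ v)
    go u (acc rs) with u ≟ v
    ... | yes refl = yes ε
    ... | no u≢v with Fin.any? via
      where
      via : ∀ e → Dec (src e ≡ u × tgt e ⊴ v)
      via e with src e ≟ u
      ... | no ¬p = no (¬p ∘ proj₁)
      ... | yes p with go (tgt e) (rs (e , p , refl))
      ... | yes q = yes (p , q)
      ... | no ¬q = no (¬q ∘ proj₂)
    ... | yes (e , p , q) = yes ((e , p , refl) ◅ q)
    ... | no ¬q = no λ { ε → u≢v refl ; ((e , p , refl) ◅ s) → ¬q (e , p , s) }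

  Fork : Rel (Fin V) 0ℓ
  Fork u v = ∃ λ h → ∃ λ g → src h ≡ src g × tgt h ⊴ u × tgt g ⊴ v × ¬ tgt g ⊴ u × ¬ tgt h ⊴ v

  -- Climb from `S` through vertices below both `u` and `v`. The climb ends, and there the edge
  -- towards `u` no longer leads to `v`, nor the edge towards `v` to `u`.
  fork : ∀ {u v} → ¬ u ⊴ v → ¬ v ⊴ u → Fork u v
  fork {u} {v} u⋬v v⋬u = go S (noetherian S) (S⊴ u) (S⊴ v)
    where
    go : ∀ s → Acc (λ v u → u ⟶ v) s → s ⊴ u → s ⊴ v → Fork u v
    go s _ ε q = ⊥-elim (u⋬v q)
    go s _ p@(_ ◅ _) ε = ⊥-elim (v⋬u p)
    go s (acc rs) ((h , refl , refl) ◅ p) ((g , r , refl) ◅ q) with tgt h ⊴? v | tgt g ⊴? u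
    ... | yes x | _     = go (tgt h) (rs (h , refl , refl)) p x
    ... | no _  | yes y = go (tgt g) (rs (g , r , refl)) y q
    ... | no ¬x | no ¬y = h , g , sym r , p , q , ¬y , ¬x

-- Tours of the right tree

iter : {A : Set} → (A → A) → A → ℕ → A
iter f a zero    = a
iter f a (suc k) = iter f (f a) k

module _ {A : Set} (f : A → A) where

  iter-+ : ∀ a i r → iter f a (i + r) ≡ iter f (iter f a i) r
  iter-+ a zero    r = refl
  iter-+ a (suc i) r = iter-+ (f a) i r

  -- Whenever `k` is at least `n`, two of the first `n + 1` iterates coincide and the loop between
  -- them can be cut out. Applied to darts, this shows that a tour truncated after `E + E` steps
  -- misses nothing.
  shorten : ∀ {n} (ι : A → Fin n) → (∀ {a b} → ι a ≡ ι b → a ≡ b) →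
    ∀ a k → ∃ λ k′ → k′ < n × iter f a k′ ≡ iter f a k
  shorten {n} ι ι-inj a k = go k (<-wellFounded k)
    where
    go : ∀ k → Acc _<_ k → ∃ λ k′ → k′ < n × iter f a k′ ≡ iter f a k
    go k (acc rs) with k ℕ.<? n
    ... | yes k<n = k , k<n , refl
    ... | no k≮n = loop k≮n
      where
      j≤k : k ≮ n → ∀ (j : Fin (suc n)) → toℕ j ≤ k
      j≤k k≮n j = ℕ.≤-trans (ℕ.≤-pred (Fin.toℕ<n j)) (ℕ.≮⇒≥ k≮n)
      loop : k ≮ n → ∃ λ k′ → k′ < n × iter f a k′ ≡ iter f a k
      loop k≮n
       with i , j , i<j , p ← Fin.pigeonhole (ℕ.n<1+n n) (λ i → ι (iter f a (toℕ i)))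
       with k′ , k′<n , q ← go (toℕ i + (k ∸ toℕ j)) (rs
        (subst (toℕ i + (k ∸ toℕ j) <_) (ℕ.m+[n∸m]≡n (j≤k k≮n j)) (ℕ.+-monoˡ-< _ i<j))) =
       k′ , k′<n , trans q (trans (iter-+ a (toℕ i) _)
           (trans (cong (λ b → iter f b (k ∸ toℕ j)) (ι-inj p))
        (trans (sym (iter-+ a (toℕ j) _)) (cong (iter f a) (ℕ.m+[n∸m]≡n (j≤k k≮n j))))))

  module _ {P : A → Set} (P? : ∀ a → Dec (P a)) where

    prefix : A → ℕ → ℕ
    prefix a n = length (takeWhile P? (iterate f a n))

    prefix-before : ∀ a n {j} → j < prefix a n → P (iter f a j)
    prefix-before a (suc n) {j} p with P? a
    prefix-before a (suc n) {zero}  _       | yes x = x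
    prefix-before a (suc n) {suc j} (s≤s p) | yes x = prefix-before (f a) n p

    prefix-at : ∀ a n → prefix a n < n → ¬ P (iter f a (prefix a n))
    prefix-at a (suc n) p with P? a
    ... | no ¬x = ¬x
    prefix-at a (suc n) (s≤s p) | yes _ = prefix-at (f a) n p

module Tour {V E : ℕ} (B : Bipolar V E) where
  open Bipolar B
  open Chains B

  inTree : Fin E → Bool
  inTree e = isOut (prev (into e))

  step : Dart E → Dart E
  step d = if inTree (reduce d) then next (swap d) else next d

  -- In mirror B this is the counterclockwise tour of the left tree of B.
  time : Fin V → ℕ
  time v = prefix step (λ d → ¬? (origin d ≟ v)) root (E + E)

  private
    at : ℕ → Dart E
    at = iter step root

  Tree⇒inTree : ∀ {p} → Tree p → inTree p ≡ true
  Tree⇒inTree (x , r) = cong isOut (next⇒prev r)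

  inTree⇒Tree : ∀ {p} → inTree p ≡ true → Tree p
  inTree⇒Tree {p} q with prev (into p) in eq
  ... | out x = x , prev⇒next eq

  step-tree : ∀ d → Tree (reduce d) → step d ≡ next (swap d)
  step-tree d t rewrite Tree⇒inTree t = refl

  step-other : ∀ d → ¬ Tree (reduce d) → step d ≡ next d
  step-other d ¬t with inTree (reduce d) in eq
  ... | true  = ⊥-elim (¬t (inTree⇒Tree eq))
  ... | false = refl

  Tree? : ∀ p → Dec (Tree p)
  Tree? p with inTree p in eq
  ... | true  = yes (inTree⇒Tree eq)
  ... | false = no λ t → case trans (sym eq) (Tree⇒inTree t) of λ ()

  _⊑_ : Rel (Fin V) 0ℓ
  _⊑_ = Star (λ u v → ∃ λ p → Tree p × src p ≡ u × tgt p ≡ v)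

  ⊑⇒⊴ : ∀ {u v} → u ⊑ v → u ⊴ v
  ⊑⇒⊴ = Star.map λ (p , _ , q) → p , q

  ⊑-child : ∀ {p} → Tree p → src p ⊑ tgt p
  ⊑-child t = (_ , t , refl , refl) ◅ ε

  ⊑-parent : ∀ {v p} → Tree p → v ⊑ tgt p → v ≡ tgt p ⊎ v ⊑ src p
  ⊑-parent t ε = inj₁ refl
  ⊑-parent {p = p} t (_◅_ {i = v} (q , x , refl , refl) s) with ⊑-parent t s
  ... | inj₁ eq = inj₂ (subst (λ p → src q ⊑ src p) (Tree-unique x t eq) ε)
  ... | inj₂ u = inj₂ ((q , x , refl , refl) ◅ u)

  ⊑-linear : ∀ {u v w} → u ⊑ w → v ⊑ w → u ⊑ v ⊎ v ⊑ u
  ⊑-linear s t = Sum.swap (Sum.map rev rev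
      (Star-deterministic det (Star.reverse id s) (Star.reverse id t)))
    where
    Edge = λ v u → ∃ λ p → Tree p × src p ≡ u × tgt p ≡ v
    det : ∀ {a b c} → Edge a b → Edge a c → b ≡ c
    det (p , x , refl , q) (p′ , x′ , refl , q′) = cong src (Tree-unique x x′ (trans q (sym q′)))
    rev : ∀ {u v} → Star Edge u v → v ⊑ u
    rev = Star.reverse id

  siblings-disjoint : ∀ {h g z} → Tree h → Tree g → src h ≡ src g → h ≢ g →
    tgt h ⊑ z → ¬ tgt g ⊑ z
  siblings-disjoint {h} {g} x y p h≢g s t with ⊑-linear s t
  ... | inj₁ u with ⊑-parent y u
  ...   | inj₁ eq = h≢g (Tree-unique x y eq)
  ...   | inj₂ v  = ⟶-⊴-acyclic (h , p , refl) (⊑⇒⊴ v)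
  siblings-disjoint {h} {g} x y p h≢g s t | inj₂ u with ⊑-parent x u
  ...   | inj₁ eq = h≢g (Tree-unique x y (sym eq))
  ...   | inj₂ v  = ⟶-⊴-acyclic (g , sym p , refl) (⊑⇒⊴ v)

  S⊑ : ∀ {v} → v ≢ N → S ⊑ v
  S⊑ {v} = go v (wellFounded v)
    where
    go : ∀ v → Acc _⟶_ v → v ≢ N → S ⊑ v
    go v (acc rs) v≢N with v ≟ S
    ... | yes refl = ε
    ... | no v≢S with p , x , refl ← tree-parent v≢S v≢N =
      go (src p) (rs (p , refl , refl)) (N-sink p) ◅◅ ⊑-child x

  -- P holds at all darts of a part of the tour, except its end.
  Tours : (Dart E → Set) → Rel (Dart E) 0ℓ
  Tours P = Star (λ d d′ → P d × step d ≡ d′)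

  weaken : ∀ {P Q : Dart E → Set} → (∀ {d} → P d → Q d) → ∀ {d d′} → Tours P d d′ → Tours Q d d′
  weaken f = Star.map λ (p , q) → f p , q

  -- After the tree edge `p`, the chain at its end contains only other ingoing darts, and none of
  -- these is in the tree. The tour crosses them all and wraps around to the leftmost outgoing dart.
  enter : ∀ {p} → Tree p → Tours (λ d → origin d ≡ tgt p) (next (into p)) (first (tgt p))
  enter {p} x = start (Last-last _) (last-origin _) (to-last (into p))
    where
    skip : ∀ {a b} → Next (into p) b → Star Next b a → origin a ≡ tgt p × step a ≡ next a
    skip {into e} r s = o , step-other (into e) λ y → Next-acyclic r
      (subst (λ e → Star Next _ (into e)) (Tree-unique y x o) s)
      where o = sym (next-origins (Star.map proj₁ (r ◅ s)))
    skip {out g} r s = ⊥-elim (into-Next-out (r ◅ s))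
    go : ∀ {a b l} → Last l → origin l ≡ tgt p → Next (into p) b → Star Next b a → Star Next a l →
      Tours (λ d → origin d ≡ tgt p) a (first (tgt p))
    go l q r s ε with o , eq ← skip r s = (o , trans eq (first-Last l q)) ◅ ε
    go l q r s (t@(q′ , _) ◅ u) with o , eq ← skip r s =
      (o , trans eq q′) ◅ go l q r (s ◅◅ (t ◅ ε)) u
    start : ∀ {l} → Last l → origin l ≡ tgt p → Star Next (into p) l →
      Tours (λ d → origin d ≡ tgt p) (next (into p)) (first (tgt p))
    start l q ε = subst (Tours _ (next (into p))) (first-Last l q) ε
    start l q (r@(q′ , _) ◅ s) = subst (λ d → Tours _ d (first (tgt p))) (sym q′) (go l q r ε s)

  Sub : Fin E → Set
  Sub h = Tree h → Tours (λ d → tgt h ⊑ origin d) (next (into h)) (next (out h))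

  across : ∀ {h} → Sub h →
    Tours (λ d → origin d ≡ src h ⊎ (Tree h × tgt h ⊑ origin d)) (out h) (next (out h))
  across {h} sub with Tree? h
  ... | yes x = (inj₁ refl , step-tree (out h) x) ◅ weaken (λ s → inj₂ (x , s)) (sub x)
  ... | no ¬x = (inj₁ refl , step-other (out h) ¬x) ◅ ε

  LeftOf : Fin E → Dart E → Set
  LeftOf g d = origin d ≡ src g ⊎ ∃ λ h → OutLt h g × Tree h × tgt h ⊑ origin d

  walk : ∀ {h g} → (∀ h → src h ≡ src g → Sub h) → Star OutAdj h g →
      Tours (LeftOf g) (out h) (out g)
  walk sub ε = ε
  walk {h} {g} sub (q ◅ s) =
    weaken (Sum.map (λ r → trans r h-src) (λ (x , t) → h , (_ , q , s) , x , t))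
      (subst (Tours _ (out h)) (proj₁ q) (across (sub h h-src)))
    ◅◅ walk sub s
    where
    h-src : src h ≡ src g
    h-src = OutAdj*-src (q ◅ s)

  -- Induction from the top of the map. Having entered along `p`, the tour passes the outgoing edges
  -- of `tgt p` from left to right, with the subtrees of those in the tree. After the rightmost one,
  -- `x`, it meets `into p` again and goes back along `p`.
  sub : ∀ p → Sub p
  sub p = go p (noetherian (tgt p))
    where
    go : ∀ p → Acc (λ v u → u ⟶ v) (tgt p) → Sub p
    go p (acc rs) t@(x , r) with g₀ , q , s ← leftmost x =
      weaken (λ o → subst (tgt p ⊑_) (sym o) ε) (enter t) ◅◅
      subst (λ d → Tours (λ d → tgt p ⊑ origin d) d (out x))
          (trans (sym q) (cong first (sym (RTurn-meet r))))
        (weaken (λ { (inj₁ o) → below (sym o) ; (inj₂ (h , lt , y , u)) →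
            (h , y , trans (OutLt-src lt) (sym (RTurn-meet r)) , refl) ◅ u })
          (walk (λ h o → go h (rs (h , trans o (sym (RTurn-meet r)) , refl))) s)) ◅◅
      subst (Tours (λ d → tgt p ⊑ origin d) (out x)) r
        (weaken (λ { (inj₁ o) → below (sym o) ; (inj₂ (y , u)) →
            (x , y , sym (RTurn-meet r) , refl) ◅ u })
          (across (go x (rs (x , sym (RTurn-meet r) , refl))))) ◅◅
      ((ε , step-tree (into p) t) ◅ ε)
      where
      below : ∀ {v} → src x ≡ v → tgt p ⊑ v
      below refl = subst (tgt p ⊑_) (RTurn-meet r) ε

  -- Induction on the depth of `src h`. Before `src h` is entered its whole subtree is avoided, and
  -- this contains the subtree of `g`. At `src h` the tour goes only through subtrees of edges to
  -- the left of `h`, which are disjoint from that of `g`.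
  arrive : ∀ {h} → Tree h → ∀ {g} → Tree g → Star OutAdj h g →
    Tours (λ d → ¬ tgt g ⊑ origin d) root (next (into h))
  arrive {h} x = go h (wellFounded (src h)) x
    where
    go : ∀ h → Acc _⟶_ (src h) → Tree h → ∀ {g} → Tree g → Star OutAdj h g →
      Tours (λ d → ¬ tgt g ⊑ origin d) root (next (into h))
    go h (acc rs) x {g} y s with g₀ , q , t ← leftmost h =
      to-first ◅◅
      subst (λ d → Tours (λ d → ¬ tgt g ⊑ origin d) d (out h)) (sym q)
          (weaken (λ {d} → before {d}) (walk (λ h _ → sub h) t))
      ◅◅ ((not-below refl , step-tree (out h) x) ◅ ε)
      where
      h-src : src h ≡ src g
      h-src = OutAdj*-src s
      not-below : ∀ {v} → v ≡ src h → ¬ tgt g ⊑ v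
      not-below refl u = ⟶-⊴-acyclic (g , sym h-src , refl) (⊑⇒⊴ u)
      before : ∀ {d} → LeftOf h d → ¬ tgt g ⊑ origin d
      before (inj₁ o) = not-below o
      before (inj₂ (k , lt@(_ , q , t) , z , u)) =
          siblings-disjoint z y (trans (OutLt-src lt) h-src)
        (λ { refl → OutLt-irrefl (_ , q , t ◅◅ s) }) u
      to-first : Tours (λ d → ¬ tgt g ⊑ origin d) root (first (src h))
      to-first with src h ≟ S
      ... | yes p = subst (Tours _ root) (trans (sym first-S) (cong first (sym p))) ε
      ... | no p with k , z , r ← tree-parent p (N-sink h) =
        weaken (λ {d} ¬u u → ¬u (subst (_⊑ origin d) (sym r) (⊑-child′ u)))
          (go k (rs (k , refl , r)) z z ε)
        ◅◅ subst (λ v → Tours (λ d → ¬ tgt g ⊑ origin d) (next (into k)) (first v)) r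
          (weaken (λ o → not-below (trans o r)) (enter z))
        where
        ⊑-child′ : ∀ {v} → tgt g ⊑ v → src h ⊑ v
        ⊑-child′ u = (g , y , sym h-src , refl) ◅ u

  inside : ∀ {w u} → w ⊑ u → Tours (λ d → w ⊑ origin d) (first w) (first u)
  inside ε = ε
  inside {w} {u} ((p , x , refl , refl) ◅ s) with g₀ , q , t ← leftmost p =
    subst (λ d → Tours (λ d → w ⊑ origin d) d (out p)) (sym q)
      (weaken (λ { (inj₁ o) → subst (w ⊑_) (sym o) ε
                 ; (inj₂ (h , lt , z , v)) → (h , z , OutLt-src lt , refl) ◅ v })
        (walk (λ h _ → sub h) t))
    ◅◅ ((ε , step-tree (out p) x) ◅ ε)
    ◅◅ weaken (λ o → (p , x , refl , refl) ◅ subst (tgt p ⊑_) (sym o) ε) (enter x)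
    ◅◅ weaken ((p , x , refl , refl) ◅_) (inside s)

  private
    Tours⇒iter : ∀ {P a b} → Tours P a b → ∃ λ k →
        iter step a k ≡ b × (∀ {j} → j < k → P (iter step a j))
    Tours⇒iter ε = 0 , refl , λ ()
    Tours⇒iter ((p , refl) ◅ s) with k , q , r ← Tours⇒iter s =
      suc k , q , λ { {zero} _ → p ; {suc j} (s≤s l) → r l }

    iter⇒Tours : ∀ {P : Dart E → Set} a k → (∀ {j} → j < k → P (iter step a j)) →
        Tours P a (iter step a k)
    iter⇒Tours a zero    f = ε
    iter⇒Tours a (suc k) f = (f (s≤s z≤n) , refl) ◅ iter⇒Tours (step a) k (f ∘ s≤s)

    at-time : ∀ {v} → time v < E + E → origin (at (time v)) ≡ v
    at-time {v} l = decidable-stable (_ ≟ v) (prefix-at step _ root (E + E) l)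

    before-time : ∀ {v j} → j < time v → origin (at j) ≢ v
    before-time = prefix-before step _ root (E + E)

    time≤ : ∀ {v k} → origin (at k) ≡ v → time v ≤ k
    time≤ {v} {k} p = ℕ.≮⇒≥ λ l → before-time l p

    join-injective : ∀ {a b : Dart E} → join E E a ≡ join E E b → a ≡ b
    join-injective {a} {b} q =
      trans (sym (Fin.splitAt-join E E a)) (trans (cong (splitAt E) q) (Fin.splitAt-join E E b))

    visited : ∀ {v k} → origin (at k) ≡ v → time v < E + E
    visited {v} {k} p
      with k′ , l , q ← shorten step (join E E) join-injective root k =
      ℕ.≤-<-trans (time≤ (trans (cong origin q) p)) l

    earlier : ∀ {u v d} → Tours (λ d → origin d ≢ v) root d → origin d ≡ u → u ≢ v → time u < time v
    earlier {u} {v} s p u≢v with k , refl , avoids ← Tours⇒iter s with time v ℕ.<? E + E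
    -- If the truncated tour misses `v`, then `time v` is the length `E + E` of the tour, which
    -- exceeds the time of any visited vertex.
    ... | no l = ℕ.<-≤-trans (visited {k = k} p) (ℕ.≮⇒≥ l)
    ... | yes l = ℕ.≰⇒> λ time-v≤ → case ℕ.m≤n⇒m<n∨m≡n (ℕ.≤-trans time-v≤ (time≤ p)) of λ
      { (inj₁ m)  → avoids m (at-time l)
      ; (inj₂ eq) → u≢v (trans (sym p) (trans (cong (origin ∘ at) (sym eq)) (at-time l))) }

    step-origin : ∀ d → origin d ≢ N → origin (step d) ≢ N
    step-origin d p with inTree (reduce d) in eq
    step-origin (out e)  p | true  = Tree-N (inTree⇒Tree eq) ∘ trans (sym (next-origin (into e)))
    step-origin (into e) p | true  = N-sink e ∘ trans (sym (next-origin (out e)))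
    step-origin (out e)  p | false = p ∘ trans (sym (next-origin (out e)))
    step-origin (into e) p | false = p ∘ trans (sym (next-origin (into e)))

    N-unvisited : ∀ k {d} → origin d ≢ N → origin (iter step d k) ≢ N
    N-unvisited zero    p = p
    N-unvisited (suc k) p = N-unvisited k (step-origin _ p)

    time-visited : ∀ {v} → v ≢ N → time v < E + E
    time-visited {v} v≢N with k , p , _ ← Tours⇒iter (inside (S⊑ v≢N)) =
      visited {v} {k} (trans (cong origin (trans (cong (λ d → iter step d k) (sym first-S)) p))
          (first-origin v))

    ≤time : ∀ {v k} → origin (at k) ≡ v → (∀ {j} → j < k → origin (at j) ≢ v) → k ≤ time v
    ≤time {v} {k} p avoids = ℕ.≮⇒≥ λ l → avoids l (at-time (visited {v} {k} p))

  time-S : ∀ {v} → v ≢ S → time S < time v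
  time-S v≢S = earlier ε root-origin (v≢S ∘ sym)

  -- No tree edge ends at `N`, so the tour never gets there and `time N` is the default value
  -- `E + E`.
  time-N : ∀ {v} → v ≢ N → time v < time N
  time-N v≢N = ℕ.<-≤-trans (time-visited v≢N) (ℕ.≮⇒≥ λ l →
    N-unvisited (time N) (S≢N ∘ trans (sym root-origin)) (at-time l))

  time-injective : ∀ {u v} → time u ≡ time v → u ≡ v
  time-injective {u} {v} p with u ≟ N | v ≟ N
  ... | yes q | yes r = trans q (sym r)
  ... | yes refl | no r = ⊥-elim (ℕ.<⇒≢ (time-N r) (sym p))
  ... | no q | yes refl = ⊥-elim (ℕ.<⇒≢ (time-N q) p)
  ... | no q | no r =
    trans (sym (at-time (time-visited q))) (trans (cong (origin ∘ at) p) (at-time (time-visited r)))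

  ⊑-time : ∀ {w u} → w ⊑ u → w ≢ u → time w < time u
  ⊑-time {w} {u} s w≢u with w ≟ S | w ≟ N
  ... | yes refl | _ = earlier ε root-origin w≢u
  ... | no _ | yes refl = ⊥-elim (N-minimal s)
    where
    N-minimal : ¬ N ⊑ u
    N-minimal ε = w≢u refl
    N-minimal ((p , _ , q , _) ◅ _) = N-sink p q
  ... | no w≢S | no w≢N with p , x , refl ← tree-parent w≢S w≢N =
    earlier (weaken (λ { ¬q refl → ¬q s }) (arrive x x ε)) (next-origin (into p)) w≢u

  -- From the arrival at `w` to the first visit of `u` the tour stays in the subtree of `w`, which
  -- does not contain `v`; before that arrival, `v` has not been visited because `w` has the smaller
  -- time.
  subtree-time : ∀ {u v w} → ¬ w ⊑ v → w ⊑ u → time w < time v → time u < time v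
  subtree-time {u} {v} {w} ¬s t l with v ≟ N | u ≟ N | w ≟ S | w ≟ N
  ... | yes refl | yes refl | _ | _ = ⊥-elim (¬s t)
  ... | yes refl | no u≢N   | _ | _ = time-N u≢N
  ... | no v≢N | _ | yes refl | _ = ⊥-elim (¬s (S⊑ v≢N))
  ... | no v≢N | _ | no _ | yes refl = ⊥-elim (ℕ.<-asym l (time-N v≢N))
  ... | no v≢N | _ | no w≢S | no w≢N
    with p , x , refl ← tree-parent w≢S w≢N
    with k , q , avoids ← Tours⇒iter
        (weaken {Q = λ d → origin d ≢ tgt p} (λ ¬q r → ¬q (subst (tgt p ⊑_) (sym r) ε))
        (arrive x x ε)) =
    earlier
      (subst (Tours _ root) q (iter⇒Tours root k
          (λ j<k → before-time (ℕ.<-trans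
          (ℕ.<-≤-trans j<k (≤time {k = k} (trans (cong origin q) (next-origin (into p))) avoids))
          l)))
        ◅◅ weaken (λ { o refl → ¬s (subst (_ ⊑_) (sym o) ε) }) (enter x)
        ◅◅ weaken (λ { r refl → ¬s r }) (inside t))
      (first-origin u) (λ { refl → ¬s t })

  siblings-time : ∀ {h g} → Tree h → Tree g → OutLt h g → time (tgt h) < time (tgt g)
  siblings-time {h} {g} x y lt@(_ , q , s) = earlier
    (weaken (λ ¬t r → ¬t (subst (tgt g ⊑_) (sym r) ε)) (arrive x y (q ◅ s))) (next-origin (into h))
    (λ p → OutLt-irrefl (subst (OutLt h) (sym (Tree-unique x y p)) lt))

-- Left and right

module Order {V E : ℕ} (B : Bipolar V E) where
  open Bipolar B
  open Chains B
  open Tour B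

  src≢tgt : ∀ e → src e ≢ tgt e
  src≢tgt e p = ⟶-⊴-acyclic (e , refl , refl) (subst (tgt e ⊴_) (sym p) ε)

  RTurns⇒⊑ : ∀ {h e} → Star RTurn h e → h ≡ e ⊎ (Tree h × tgt h ⊑ src e)
  RTurns⇒⊑ ε = inj₁ refl
  RTurns⇒⊑ {h} (r ◅ s) with RTurns⇒⊑ s
  ... | inj₁ refl    = inj₂ ((_ , r) , subst (tgt h ⊑_) (RTurn-meet r) ε)
  ... | inj₂ (x , t) = inj₂ ((_ , r) , (_ , x , sym (RTurn-meet r) , refl) ◅ t)

  LTurns⇒⊴ : ∀ {g e} → Star LTurn g e → g ≡ e ⊎ tgt g ⊴ src e
  LTurns⇒⊴ ε = inj₁ refl
  LTurns⇒⊴ {g} (r ◅ s) with LTurns⇒⊴ s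
  ... | inj₁ refl = inj₂ (subst (tgt g ⊴_) (LTurn-meet r) ε)
  ... | inj₂ t    = inj₂ ((_ , sym (LTurn-meet r) , refl) ◅ t)

  record FaceBelow (e e′ : Fin E) : Set where
    field
      {h g}     : Fin E
      adjacent  : OutAdj h g
      left      : Star RTurn h e
      h-tree    : Tree h
      left-⊑    : tgt h ⊑ src e
      right-⊴   : tgt g ⊴ src e′

  -- A side of the face that consisted of a single edge would make this edge transitive. Hence both
  -- sides have at least two edges, and the left one without its last edge is a branch of the tree.
  faceBelow : ∀ {e e′} → InAdj e e′ → FaceBelow e e′
  faceBelow {e} {e′} a with h , g , q , s , t ← face-below a = cases (RTurns⇒⊑ s) (LTurns⇒⊴ t)
    where
    h≢g : h ≢ g
    h≢g refl = OutLt-irrefl (_ , q , ε)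
    end : ∀ {u} → u ⊴ src e′ → u ⊴ tgt e
    end u = u ◅◅ ((e′ , refl , sym (InAdj-tgt a)) ◅ ε)
    cases : h ≡ e ⊎ (Tree h × tgt h ⊑ src e) → g ≡ e′ ⊎ tgt g ⊴ src e′ → FaceBelow e e′
    cases (inj₁ refl) (inj₁ refl) =
      ⊥-elim (not-transitive (OutAdj-src q) h≢g (subst (_⊴ tgt h) (InAdj-tgt a) ε))
    cases (inj₁ refl) (inj₂ v)    = ⊥-elim (not-transitive (OutAdj-src q) h≢g (end v))
    cases (inj₂ (x , u)) (inj₁ refl) = ⊥-elim (not-transitive (sym (OutAdj-src q)) (h≢g ∘ sym)
      (⊑⇒⊴ u ◅◅ ((e , refl , InAdj-tgt a) ◅ ε)))
    cases (inj₂ (x , u)) (inj₂ v) = record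
      { adjacent = q ; left = s ; h-tree = x ; left-⊑ = u ; right-⊴ = v }

  -- If `g` is not in the tree, then `tgt g` is not in the subtree of `src g` at all, because a
  -- branch leading to it would make `g` transitive. This whole subtree, including `u`, is then
  -- visited before `tgt g`.
  left-subtree-time : ∀ {h g u} → time (src g) < time (tgt g) → OutLt h g → Tree h →
    tgt h ⊑ u → time u < time (tgt g)
  left-subtree-time {h} {g} l lt x t with Tree? g
  ... | yes y = subtree-time
    (λ s → siblings-disjoint x y (OutLt-src lt) (λ { refl → OutLt-irrefl lt }) s ε) t
        (siblings-time x y lt)
  ... | no ¬y = subtree-time other ((h , x , OutLt-src lt , refl) ◅ t) l
    where
    split : ∀ {v} → v ≡ tgt g → ¬ src g ⊑ v
    split p ε = src≢tgt g p
    split p ((q , z , r , refl) ◅ s) =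
      not-transitive {g} {q} (sym r) (λ { refl → ¬y z }) (subst (tgt q ⊴_) p (⊑⇒⊴ s))
    other : ¬ src g ⊑ tgt g
    other = split refl

  private
    ⊴-time′ : ∀ {u w} → (∀ e → tgt e ⊴ w → time (src e) < time (tgt e)) → u ⊴ w → time u ≤ time w
    ⊴-time′ f ε = ℕ.≤-refl
    ⊴-time′ f ((e , refl , refl) ◅ s) = ℕ.≤-trans (ℕ.<⇒≤ (f e s)) (⊴-time′ f s)

    -- The edges into a vertex are treated from right to left, beginning with the tree edge. If `d`
    -- is just left of `c`, then `src d` is in the subtree of the left bottom edge of the face below
    -- them, so it is visited before the end of the right bottom edge `g`, which is below `src c`.
    -- This requires the inequality for `g` and along the right side; hence the induction is over
    -- all edges below a vertex.
    edge-time′ : ∀ v → Acc _⟶_ v → ∀ e → tgt e ⊴ v → time (src e) < time (tgt e)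
    edge-time′ v (acc rs) e (q ◅ s) with w , t , r ← unsnoc q s = edge-time′ w (rs r) e t
    edge-time′ .(tgt e) (acc rs) e ε with tgt e ≟ N
    ... | yes p = subst (λ v → time (src e) < time v) (sym p) (time-N (N-sink e))
    ... | no e≢N with p , x , s ← rightmost e e≢N = go s refl
      where
      go : ∀ {d} → Star InAdj d p → tgt d ≡ tgt e → time (src d) < time (tgt d)
      go ε       _  = ⊑-time (⊑-child x) (src≢tgt p)
      go {d} (_◅_ {j = c} a s) eq = ℕ.<-≤-trans
        (left-subtree-time (below g F.right-⊴) (g , F.adjacent , ε) F.h-tree F.left-⊑)
        (ℕ.≤-trans (⊴-time′ below F.right-⊴)
          (ℕ.<⇒≤ (subst (λ v → time (src c) < time v) (sym (InAdj-tgt a)) (go s c-tgt))))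
        where
        module F = FaceBelow (faceBelow a)
        g = F.g
        c-tgt : tgt c ≡ tgt e
        c-tgt = trans (sym (InAdj-tgt a)) eq
        below : ∀ e → tgt e ⊴ src c → time (src e) < time (tgt e)
        below = edge-time′ (src c) (rs (c , refl , c-tgt))

  edge-time : ∀ e → time (src e) < time (tgt e)
  edge-time e = edge-time′ (tgt e) (wellFounded _) e ε

  ⊴-time : ∀ {u w} → u ⊴ w → time u ≤ time w
  ⊴-time = ⊴-time′ λ e _ → edge-time e

  InAdj-time : ∀ {e e′} → InAdj e e′ → time (src e) < time (src e′)
  InAdj-time a = ℕ.<-≤-trans
    (left-subtree-time (edge-time g) (g , adjacent , ε) h-tree left-⊑) (⊴-time right-⊴)
    where open FaceBelow (faceBelow a)

  RTurns-last : ∀ {h e} → Star RTurn h e → h ≢ e → ∃ λ p → RTurn p e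
  RTurns-last ε h≢e = ⊥-elim (h≢e refl)
  RTurns-last (r ◅ s) _ with _ , _ , q ← unsnoc r s = _ , q

  private
    same-child : ∀ {h k z} → Tree h → Tree k → src h ≡ src k → tgt h ⊑ z → tgt k ⊑ z → h ≡ k
    same-child {h} {k} x y p s t = decidable-stable (h ≟ k) λ h≢k → siblings-disjoint x y p h≢k s t

  -- Up to `e`, the right-turning path from `h` is the branch of the tree from `tgt h` to `src e`.
  -- This branch is unique, so `k` lies on the path after `h`.
  RTurns-through : ∀ {h e k} → Star RTurn h e → tgt h ⊑ src k → Tree k → tgt k ⊑ src e →
    ∃ λ p → RTurn p k
  RTurns-through {h} {.h} {k} ε t x u = ⊥-elim (⟶-⊴-acyclic (h , refl , refl)
    (⊑⇒⊴ (t ◅◅ (⊑-child x ◅◅ u))))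
  RTurns-through {h} {e} {k} (_◅_ {j = j} r s) t x u with RTurns⇒⊑ s | RTurn-meet r
  ... | inj₁ refl | p = ⊥-elim (⟶-⊴-acyclic (k , refl , refl)
    (⊑⇒⊴ u ◅◅ subst (_⊴ src k) p (⊑⇒⊴ t)))
  ... | inj₂ (y , v) | p = go t refl
    where
    go : ∀ {z} → tgt h ⊑ z → z ≡ src k → ∃ λ p → RTurn p k
    go ε q with refl ← same-child y x (trans (sym p) q) v u = h , r
    go ((q , z , a , refl) ◅ t′) refl
      with refl ← same-child y z (trans (sym p) (sym a)) v (t′ ◅◅ (⊑-child x ◅◅ u)) =
      RTurns-through s t′ x u

  -- Geometrically, the rightmost path down from u cannot cross the paths
  -- that start with g, so it reaches the source of g from the left of g.
  fork-subtree : ∀ {h g u} → OutLt h g → tgt h ⊴ u → ¬ tgt g ⊴ u →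
    ∃ λ k → Tree k × OutLt k g × tgt k ⊑ u
  fork-subtree {h} {g} {u} lt s ¬s = go u (wellFounded u) (h , lt , s) ¬s
    where
    Result : Fin V → Set
    Result u = ∃ λ k → Tree k × OutLt k g × tgt k ⊑ u
    LeftAbove : Fin V → Set
    LeftAbove u = ∃ λ h → OutLt h g × tgt h ⊴ u
    Good : Fin E → Set
    Good e = OutLt e g ⊎ LeftAbove (src e)

    last-edge : ∀ {u} → LeftAbove u → ∃ λ e → tgt e ≡ u × Good e
    last-edge (h , lt , ε) = h , refl , inj₁ lt
    last-edge (h , lt , q ◅ s) with _ , t , (e , refl , p) ← unsnoc q s = e , p , inj₂ (h , lt , t)

    module _ {u} (¬s : ¬ tgt g ⊴ u) (IH : ∀ {w} → w ⟶ u → LeftAbove w → Result w) where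

      OutAdj-functional : ∀ {k m m′} → OutAdj k m → OutAdj k m′ → m ≡ m′
      OutAdj-functional (p , _) (q , _) = inj₁-injective (trans (sym p) q)

      not-RTurn : ∀ {p k} → OutLt k g → ¬ RTurn p k
      not-RTurn (_ , (q , _) , _) r with () ← trans (sym q) r

      shift : ∀ {e e′} → tgt e′ ≡ u → InAdj e e′ → Good e → Good e′
      shift refl a (inj₁ lt) =
        -- The left side of the face has at least two edges and so makes a right turn into `e`. But
        -- then `e` is the rightmost edge out of its source and cannot be to the left of `g`.
        ⊥-elim (not-RTurn lt (proj₂ (RTurns-last F.left λ eq →
          ⟶-⊴-acyclic (F.h , refl , refl)
            (subst (λ d → tgt F.h ⊴ src d) (sym eq) (⊑⇒⊴ F.left-⊑)))))
        where module F = FaceBelow (faceBelow a)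
      shift {e} {e′} refl a (inj₂ above)
        with k , x , lt@(m , q , t) , v ← IH (e , refl , InAdj-tgt a) above =
        -- The bottom `src F.h` of the face and `tgt k` lie on one branch. If the bottom is above
        -- `tgt k` or equal to it, the right side of the face is above `k` too. If it is `src k`,
        -- the right side starts with the right neighbour of `k`, which is not `g` as `u` is not
        -- above `g`. If it is lower, the left side makes a right turn into `k`, impossible for an
        -- edge to the left of `g`.
        cases (⊑-linear (⊑-child F.h-tree ◅◅ F.left-⊑) v)
        where
        module F = FaceBelow (faceBelow a)
        up : ∀ {z} → z ⊴ src F.h → z ⊴ src e′
        up s = s ◅◅ ((F.g , sym (OutAdj-src F.adjacent) , refl) ◅ F.right-⊴)
        at-fork : F.h ≡ k → Good e′
        at-fork refl with refl ← OutAdj-functional q F.adjacent = beyond t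
          where
          beyond : Star OutAdj F.g g → Good e′
          beyond ε       = ⊥-elim (¬s (F.right-⊴ ◅◅ ((e′ , refl , refl) ◅ ε)))
          beyond (r ◅ t) = inj₂ (F.g , (_ , r , t) , F.right-⊴)
        below : ∀ {z} → src F.h ⊑ z → z ≡ src k → Good e′
        below ε r = at-fork (same-child F.h-tree x r F.left-⊑ v)
        below ((p , y , r , refl) ◅ s) refl
          with refl ← same-child F.h-tree y (sym r) F.left-⊑ (s ◅◅ (⊑-child x ◅◅ v)) =
          ⊥-elim (not-RTurn lt (proj₂ (RTurns-through F.left s x v)))
        cases : src F.h ⊑ tgt k ⊎ tgt k ⊑ src F.h → Good e′
        cases (inj₂ s) = inj₂ (k , lt , up (⊑⇒⊴ s))
        cases (inj₁ s) with ⊑-parent x s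
        ... | inj₁ r = inj₂ (k , lt , up (subst (_⊴ src F.h) r ε))
        ... | inj₂ s = below s refl

      shifts : ∀ {e e′} → tgt e ≡ u → Star InAdj e e′ → Good e → tgt e′ ≡ u × Good e′
      shifts p ε       good = p , good
      shifts p (a ◅ s) good = shifts q s (shift q a good)
        where q = trans (sym (InAdj-tgt a)) p

    go : ∀ u → Acc _⟶_ u → LeftAbove u → ¬ tgt g ⊴ u → Result u
    go u (acc rs) above ¬s
      with e , refl , good ← last-edge above
      with p , x , s ← rightmost e (λ { r → ¬s (subst (tgt g ⊴_) (sym r) (⊴N _)) })
      with r , good′ ← shifts ¬s (λ q a → go _ (rs q) a λ s → ¬s (s ◅◅ (q ◅ ε))) refl s good =
      finish x r good′
      where
      finish : ∀ {p} → Tree p → tgt p ≡ tgt e → Good p → Result (tgt e)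
      finish {p} x r (inj₁ lt) = p , x , lt , subst (tgt p ⊑_) r ε
      finish {p} x r (inj₂ above)
        with k , y , lt , t ← go _ (rs (p , refl , r)) above
            (λ s → ¬s (s ◅◅ ((p , refl , r) ◅ ε))) =
        k , y , lt , t ◅◅ ((p , x , refl , r) ◅ ε)

  fork-time : ∀ {h g u v} → OutLt h g → tgt h ⊴ u → tgt g ⊴ v → ¬ tgt g ⊴ u → time u < time v
  fork-time {g = g} lt s t ¬s with k , x , lt′ , v ← fork-subtree lt s ¬s =
    ℕ.<-≤-trans (left-subtree-time (edge-time g) lt′ x v) (⊴-time t)

uncons : {A : Set} {R : Rel A 0ℓ} → ∀ {a b c} → Star R a b → R b c → ∃ λ z → R a z × Star R z c
uncons ε       q = _ , q , ε
uncons (p ◅ s) q with _ , r , t ← uncons s q = _ , p , s ◅◅ (q ◅ ε)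

-- Labellings of the vertices by two coordinates

module _ {V E : ℕ} (B : Bipolar V E) where
  open Bipolar B
  open Chains B

  private
    module L = Chains (mirror B)

  mirror-OutAdj : ∀ {h g} → OutAdj h g → Bipolar.OutAdj (mirror B) g h
  mirror-OutAdj (p , q) = next⇒prev p , λ r → q (trans (sym p) (prev⇒next (sym r)))

  mirror-OutLt : ∀ {h g} → OutLt h g → L.OutLt g h
  mirror-OutLt (k , p , s) = uncons (Star.reverse mirror-OutAdj s) (mirror-OutAdj p)

  -- All fields but the last are symmetric in `x` and `y`; the last one says which coordinate
  -- increases to the right. Only the two induced orders matter, so ranks inherit the property from
  -- times.
  record Labels (x y : Fin V → ℕ) : Set where
    field
      x-injective : ∀ {u v} → x u ≡ x v → u ≡ v
      y-injective : ∀ {u v} → y u ≡ y v → u ≡ v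
      edge-x      : ∀ e → x (src e) < x (tgt e)
      edge-y      : ∀ e → y (src e) < y (tgt e)
      above       : ∀ {u v} → x u < x v → y u < y v → u ⊴ v
      OutAdj-x    : ∀ {h g} → OutAdj h g → x (tgt h) < x (tgt g)

    ⊴-x : ∀ {u v} → u ⊴ v → x u ≤ x v
    ⊴-x ε = ℕ.≤-refl
    ⊴-x ((e , refl , refl) ◅ s) = ℕ.≤-trans (ℕ.<⇒≤ (edge-x e)) (⊴-x s)

    ⊴-y : ∀ {u v} → u ⊴ v → y u ≤ y v
    ⊴-y ε = ℕ.≤-refl
    ⊴-y ((e , refl , refl) ◅ s) = ℕ.≤-trans (ℕ.<⇒≤ (edge-y e)) (⊴-y s)

    OutLt-x : ∀ {h g} → OutLt h g → x (tgt h) < x (tgt g)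
    OutLt-x (_ , p , s) = go p s
      where
      go : ∀ {h k g} → OutAdj h k → Star OutAdj k g → x (tgt h) < x (tgt g)
      go p ε       = OutAdj-x p
      go p (q ◅ s) = ℕ.<-trans (OutAdj-x p) (go q s)

    <-total-x : ∀ {u v} → u ≢ v → x u < x v ⊎ x v < x u
    <-total-x u≢v = Sum.map₂ (λ p → ℕ.≤∧≢⇒< p (u≢v ∘ sym ∘ x-injective)) (ℕ.<-≤-connex _ _)

    <-total-y : ∀ {u v} → u ≢ v → y u < y v ⊎ y v < y u
    <-total-y u≢v = Sum.map₂ (λ p → ℕ.≤∧≢⇒< p (u≢v ∘ sym ∘ y-injective)) (ℕ.<-≤-connex _ _)

    OutLt-y : ∀ {h g} → OutLt h g → y (tgt g) < y (tgt h)
    OutLt-y {h} {g} lt with <-total-y {tgt h} {tgt g} (λ p → ℕ.<⇒≢ (OutLt-x lt) (cong x p))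
    ... | inj₂ p = p
    ... | inj₁ p = ⊥-elim (not-transitive (sym (OutLt-src lt)) (λ { refl → OutLt-irrefl lt })
                     (above (OutLt-x lt) p))

    -- Suppose that `x v < x u`. If `y v < y u`, then `v` is below `u`. Otherwise `tgt g` has
    -- smaller coordinates than `u`: its abscissa is at most `x v`, and its ordinate is less than
    -- that of `tgt h`.
    fork-x : ∀ {u v h g} → u ≢ v → ¬ v ⊴ u → OutLt h g → tgt h ⊴ u → tgt g ⊴ v → ¬ tgt g ⊴ u →
        x u < x v
    fork-x {u} {v} u≢v v⋬u lt s t ¬s with <-total-x u≢v | <-total-y u≢v
    ... | inj₁ p | _      = p
    ... | inj₂ p | inj₁ q = ⊥-elim (¬s
        (above (ℕ.≤-<-trans (⊴-x t) p) (ℕ.<-≤-trans (OutLt-y lt) (⊴-y s))))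
    ... | inj₂ p | inj₂ q = ⊥-elim (v⋬u (above p q))

  module _ {x y x′ y′ : Fin V → ℕ} (l : Labels x y) (l′ : Labels x′ y′) where
    private
      module l = Labels l
      module l′ = Labels l′

    labels-x : ∀ {u v} → x u < x v → x′ u < x′ v
    labels-x {u} {v} p with u ⊴? v | v ⊴? u
    ... | yes s | _ = ℕ.≤∧≢⇒< (l′.⊴-x s) (λ q → ℕ.<⇒≢ p (cong x (l′.x-injective q)))
    ... | no _ | yes s = ⊥-elim (ℕ.<⇒≱ p (l.⊴-x s))
    ... | no u⋬v | no v⋬u with h , g , q , s , t , ¬s , ¬t ← fork u⋬v v⋬u =
      [_,_] (λ lt → l′.fork-x u≢v v⋬u lt s t ¬s)
        (λ lt → ⊥-elim (ℕ.<-asym p (l.fork-x (u≢v ∘ sym) u⋬v lt t s ¬t)))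
        (OutLt-cases q λ { refl → ¬s s })
      where
      u≢v : u ≢ v
      u≢v refl = ℕ.<-irrefl refl p

    -- Incomparable vertices are ordered oppositely by the two coordinates, so their ordinates are
    -- governed by their abscissas.
    labels-y : ∀ {u v} → y u < y v → y′ u < y′ v
    labels-y {u} {v} p with u ⊴? v | v ⊴? u
    ... | yes s | _ = ℕ.≤∧≢⇒< (l′.⊴-y s) (λ q → ℕ.<⇒≢ p (cong y (l′.y-injective q)))
    ... | no _ | yes s = ⊥-elim (ℕ.<⇒≱ p (l.⊴-y s))
    ... | no u⋬v | no v⋬u with l.<-total-x {u} {v} (λ { refl → u⋬v ε })
    ...   | inj₁ q = ⊥-elim (u⋬v (l.above q p))
    ...   | inj₂ q with l′.<-total-y {u} {v} (λ { refl → u⋬v ε })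
    ...     | inj₁ r = r
    ...     | inj₂ r = ⊥-elim (v⋬u (l′.above (labels-x q) r))

  relabel : ∀ {x y x′ y′} → Labels x y → (∀ {u v} → x u < x v → x′ u < x′ v) →
    (∀ {u v} → y u < y v → y′ u < y′ v) → Labels x′ y′
  relabel {x} {y} {x′} {y′} l f g = record
    { x-injective = λ p → x-injective (equal x x′ f p)
    ; y-injective = λ p → y-injective (equal y y′ g p)
    ; edge-x      = f ∘ edge-x
    ; edge-y      = g ∘ edge-y
    ; above       = λ p q → above (reflect x x′ f p (cong x′ ∘ x-injective))
        (reflect y y′ g q (cong y′ ∘ y-injective))
    ; OutAdj-x    = f ∘ OutAdj-x
    }
    where
    open Labels l
    equal : (z z′ : Fin V → ℕ) → (∀ {u v} → z u < z v → z′ u < z′ v) → ∀ {u v} → z′ u ≡ z′ v →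
        z u ≡ z v
    equal z z′ h {u} {v} p with ℕ.<-cmp (z u) (z v)
    ... | tri< q _ _ = ⊥-elim (ℕ.<⇒≢ (h q) p)
    ... | tri≈ _ q _ = q
    ... | tri> _ _ q = ⊥-elim (ℕ.<⇒≢ (h q) (sym p))
    reflect : (z z′ : Fin V → ℕ) → (∀ {u v} → z u < z v → z′ u < z′ v) →
      ∀ {u v} → z′ u < z′ v → (z u ≡ z v → z′ u ≡ z′ v) → z u < z v
    reflect z z′ h {u} {v} p c with ℕ.<-cmp (z u) (z v)
    ... | tri< q _ _ = q
    ... | tri≈ _ q _ = ⊥-elim (ℕ.<⇒≢ p (c q))
    ... | tri> _ _ q = ⊥-elim (ℕ.<-asym p (h q))

  module _ where
    open Tour B using (time)
    open Tour (mirror B) using () renaming (time to timeᵧ)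
    private
      module R = Order B
      module T = Tour B
      module L′ = Order (mirror B)
      module T′ = Tour (mirror B)

    fork-times : ∀ {h g u v} → OutLt h g → tgt h ⊴ u → tgt g ⊴ v → ¬ tgt g ⊴ u → ¬ tgt h ⊴ v →
      time u < time v × timeᵧ v < timeᵧ u
    fork-times lt s t ¬s ¬t = R.fork-time lt s t ¬s , L′.fork-time (mirror-OutLt lt) t s ¬t

    times : Labels time timeᵧ
    times = record
      { x-injective = T.time-injective
      ; y-injective = T′.time-injective
      ; edge-x      = R.edge-time
      ; edge-y      = L′.edge-time
      ; above       = above
      ; OutAdj-x    = λ {h} {g} a → R.fork-time (_ , a , ε) ε ε
          (not-transitive (OutAdj-src a) (λ { refl → OutLt-irrefl (_ , a , ε) }))
      }
      where
      above : ∀ {u v} → time u < time v → timeᵧ u < timeᵧ v → u ⊴ v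
      above {u} {v} p q with u ⊴? v | v ⊴? u
      ... | yes s | _ = s
      ... | no _ | yes s = ⊥-elim (ℕ.<⇒≱ p (R.⊴-time s))
      ... | no u⋬v | no v⋬u with h , g , r , s , t , ¬s , ¬t ← fork u⋬v v⋬u =
        ⊥-elim ([_,_] (λ lt → ℕ.<-asym q (proj₂ (fork-times lt s t ¬s ¬t)))
          (λ lt → ℕ.<-asym p (proj₁ (fork-times lt t s ¬t ¬s))) (OutLt-cases r λ { refl → ¬s s }))

    open Labels times

    -- The vertices `a`, `b`, `c`, `d` are the letters 2, 1, 4, 3 of the pattern. Adjacency in time
    -- yields an edge `e` from `b` to `c`. A path from `b` to `d` cannot start to the left of `e`,
    -- for `d` would be visited before `c`; so it starts to the right, and `d` descends in the left
    -- tree from an edge out of `b` to the right of `e`. Such a vertex is not above `a`, whereas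
    -- both coordinates put `d` above `a`.
    times-plane : ∀ {a b c d} → time a < time b → time b < time c →
      (∀ z → ¬ (time b < time z × time z < time c)) → time c < time d →
      timeᵧ b < timeᵧ a → timeᵧ a < timeᵧ d → timeᵧ d < timeᵧ c → ⊥
    times-plane {a} {b} {c} {d} a<b b<c adjacent c<d b<ᵧa a<ᵧd d<ᵧc =
      right-of (first-edge (above b<d b<ᵧd) (ℕ.<⇒≢ b<d ∘ cong time))
      where
      b<d = ℕ.<-trans b<c c<d
      b<ᵧd = ℕ.<-trans b<ᵧa a<ᵧd

      first-edge : ∀ {u v} → u ⊴ v → u ≢ v → ∃ λ e → src e ≡ u × tgt e ⊴ v
      first-edge ε u≢v = ⊥-elim (u≢v refl)
      first-edge ((e , p , refl) ◅ s) _ = e , p , s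

      b⟶c : ∃ λ e → src e ≡ b × tgt e ≡ c
      b⟶c with e , p , s ← first-edge (above b<c (ℕ.<-trans b<ᵧd d<ᵧc)) (ℕ.<⇒≢ b<c ∘ cong time) =
        e , p , decidable-stable (tgt e ≟ c) λ e≢c → adjacent (tgt e)
          ( subst (λ v → time v < time (tgt e)) p (edge-x e)
          , ℕ.≤∧≢⇒< (⊴-x s) (e≢c ∘ x-injective))

      e = proj₁ b⟶c

      c⋬d : ¬ c ⊴ d
      c⋬d s = ℕ.<⇒≱ d<ᵧc (⊴-y s)

      -- The parent of v in the left tree has the greatest ordinate among the
      -- lower neighbours of v.  If v is above a and its parent is not, then the
      -- parent is to the left of a, hence of b.
      blocked : ∀ {u v} → b ⊴ u → u T′.⊑ v → ¬ a ⊴ u → ¬ a ⊴ v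
      blocked s ε ¬a = ¬a
      blocked {u} s ((q , x , refl , refl) ◅ t) ¬a = blocked (s ◅◅ ((q , refl , refl) ◅ ε)) t λ r →
        step r refl
        where
        chain : ∀ {r p} → Star (Bipolar.InAdj (mirror B)) r p → timeᵧ (src r) ≤ timeᵧ (src p)
        chain ε       = ℕ.≤-refl
        chain (i ◅ s) = ℕ.≤-trans (ℕ.<⇒≤ (L′.InAdj-time i)) (chain s)
        higher : ∀ r → tgt r ≡ tgt q → timeᵧ (src r) ≤ timeᵧ (src q)
        higher r r-q with p , x′ , c ← L.rightmost r (L.Tree-N x ∘ trans (sym r-q)) =
          subst (λ p → timeᵧ (src r) ≤ timeᵧ (src p))
            (L.Tree-unique x′ x (trans (sym (L.InAdj*-tgt c)) r-q)) (chain c)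
        step : ∀ {z} → a ⊴ z → z ≢ tgt q
        step ε refl = ℕ.<⇒≱ a<b (⊴-x (s ◅◅ ((q , refl , refl) ◅ ε)))
        step (i ◅ t) refl with _ , u , (r , refl , r-q) ← unsnoc i t =
          ¬a (above
            (ℕ.<-≤-trans a<b (⊴-x s))
            (ℕ.≤∧≢⇒< (ℕ.≤-trans (⊴-y u) (higher r r-q))
                (λ eq → ¬a (subst (a ⊴_) (y-injective eq) ε))))

      right-of : (∃ λ g → src g ≡ b × tgt g ⊴ d) → ⊥
      right-of (g , p , s) with g ≟ e
      ... | yes refl = c⋬d (subst (_⊴ d) (proj₂ (proj₂ b⟶c)) s)
      ... | no g≢e with OutLt-cases (trans p (sym (proj₁ (proj₂ b⟶c)))) g≢e
      ...   | inj₁ lt = ℕ.<-asym c<d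
        (R.fork-time lt s ε′ (c⋬d ∘ subst (_⊴ d) (proj₂ (proj₂ b⟶c))))
        where
        ε′ : tgt e ⊴ c
        ε′ = subst (tgt e ⊴_) (proj₂ (proj₂ b⟶c)) ε
      ...   | inj₂ lt with k , x , lt′ , t ←
                L′.fork-subtree (mirror-OutLt lt) s (c⋬d ∘ subst (_⊴ d) (proj₂ (proj₂ b⟶c))) =
        blocked ε ((k , x , trans (L.OutLt-src lt′) (proj₁ (proj₂ b⟶c)) , refl) ◅ t)
          (λ u → ℕ.<⇒≱ b<ᵧa (⊴-y u)) (above a<d a<ᵧd)
        where
        a<d = ℕ.<-trans a<b b<d

⟨$⟩ʳ-injective : ∀ {m n} (π : Permutation m n) {i j} → π ⟨$⟩ʳ i ≡ π ⟨$⟩ʳ j → i ≡ j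
⟨$⟩ʳ-injective π p = trans (sym (Perm.inverseˡ π)) (trans (cong (π ⟨$⟩ˡ_) p) (Perm.inverseˡ π))

-- From tours to permutations

injective⇒permutation : ∀ {n} (f : Fin n → Fin n) → (∀ {i j} → f i ≡ f j → i ≡ j) → Permutation′ n
injective⇒permutation f f-inj = Perm.permutation f (proj₁ ∘ preimage)
  (proj₂ ∘ preimage) (λ i → f-inj (proj₂ (preimage (f i))))
  where preimage = injective⇒surjective refl f-inj

module _ {A : Set} {P Q : A → Set} (P? : ∀ a → Dec (P a)) (Q? : ∀ a → Dec (Q a)) (P⇒Q : ∀ {a} → P a → Q a) where

  filter-length-≤ : ∀ xs → length (filter P? xs) ≤ length (filter Q? xs)
  filter-length-≤ [] = z≤n
  filter-length-≤ (x ∷ xs) with P? x | Q? x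
  ... | yes p | yes q = s≤s (filter-length-≤ xs)
  ... | yes p | no ¬q = ⊥-elim (¬q (P⇒Q p))
  ... | no ¬p | yes q = ℕ.m≤n⇒m≤1+n (filter-length-≤ xs)
  ... | no ¬p | no ¬q = filter-length-≤ xs

  filter-length-< : ∀ {a xs} → a ∈ xs → ¬ P a → Q a → length (filter P? xs) < length (filter Q? xs)
  filter-length-< {xs = x ∷ xs} (here refl) ¬p q with P? x | Q? x
  ... | yes p | _     = ⊥-elim (¬p p)
  ... | no _  | yes _ = s≤s (filter-length-≤ xs)
  ... | no _  | no ¬q = ⊥-elim (¬q q)
  filter-length-< {xs = x ∷ xs} (there r) ¬p q with P? x | Q? x
  ... | yes p′ | yes q′ = s≤s (filter-length-< r ¬p q)
  ... | yes p′ | no ¬q′ = ⊥-elim (¬q′ (P⇒Q p′))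
  ... | no ¬p′ | yes q′ = ℕ.m≤n⇒m≤1+n (filter-length-< r ¬p q)
  ... | no ¬p′ | no ¬q′ = filter-length-< r ¬p q

module Rank {n : ℕ} (S N : Fin (2 + n)) (S≢N : S ≢ N) (t : Fin (2 + n) → ℕ)
  (t-S : ∀ {v} → v ≢ S → t S < t v) (t-N : ∀ {v} → v ≢ N → t v < t N) where

  nonPole? : ∀ v → Dec (v ≢ S × v ≢ N)
  nonPole? v = ¬? (v ≟ S) ×-dec ¬? (v ≟ N)

  inner-vertices : List (Fin (2 + n))
  inner-vertices = filter nonPole? (allFin (2 + n))

  rankᵗ : Fin (2 + n) → ℕ
  rankᵗ v = length (filter (λ w → t w ℕ.≤? t v) inner-vertices)

  private
    inner∈ : ∀ {v} → v ≢ S → v ≢ N → v ∈ inner-vertices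
    inner∈ {v} p q = ∈.∈-filter⁺ nonPole? (∈.∈-allFin v) (p , q)

  rank-mono : ∀ {u v} → v ≢ S → v ≢ N → t u < t v → rankᵗ u < rankᵗ v
  rank-mono {u} {v} p q u<v = filter-length-< (λ w → t w ℕ.≤? t u) (λ w → t w ℕ.≤? t v)
    (λ w≤u → ℕ.≤-trans w≤u (ℕ.<⇒≤ u<v)) (inner∈ p q) (ℕ.<⇒≱ u<v) ℕ.≤-refl

  rank>0 : ∀ {v} → v ≢ S → v ≢ N → 0 < rankᵗ v
  rank>0 {v} p q = ℕ.≤-<-trans z≤n (rank-mono {S} p q (t-S p))

  rank≤n : ∀ v → rankᵗ v ≤ n
  rank≤n v = ℕ.≤-trans (List.length-filter (λ w → t w ℕ.≤? t v) inner-vertices)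
    -- Removing `S` and then `N` from the `2 + n` vertices shortens the list at least once each
    -- time.
    (ℕ.≤-pred (ℕ.≤-pred (ℕ.≤-trans (s≤s
      (filter-length-< nonPole? (λ v → ¬? (v ≟ S)) proj₁ (∈.∈-allFin N) (λ x → proj₂ x refl)
          (S≢N ∘ sym)))
      (ℕ.≤-trans (List.filter-notAll (λ v → ¬? (v ≟ S)) (allFin (2 + n))
          (Any.map (λ { refl ¬p → ¬p refl }) (∈.∈-allFin S)))
        (ℕ.≤-reflexive (List.length-tabulate id))))))

  -- The values `0` and `suc n` at the poles are those of the two points added by the completion.
  position : Fin (2 + n) → ℕ
  position v with v ≟ S | v ≟ N
  ... | yes _ | _     = 0
  ... | no _  | yes _ = suc n
  ... | no _  | no _  = rankᵗ v

  position-S : position S ≡ 0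
  position-S with S ≟ S
  ... | yes _ = refl
  ... | no p = ⊥-elim (p refl)

  position-N : position N ≡ suc n
  position-N with N ≟ S | N ≟ N
  ... | yes p | _     = ⊥-elim (S≢N (sym p))
  ... | no _  | yes _ = refl
  ... | no _  | no p  = ⊥-elim (p refl)

  position-inner : ∀ {v} → v ≢ S → v ≢ N → position v ≡ rankᵗ v
  position-inner {v} p q with v ≟ S | v ≟ N
  ... | yes r | _     = ⊥-elim (p r)
  ... | no _  | yes r = ⊥-elim (q r)
  ... | no _  | no _  = refl

  position<2+n : ∀ v → position v < 2 + n
  position<2+n v with v ≟ S | v ≟ N
  ... | yes _ | _     = s≤s z≤n
  ... | no _  | yes _ = ℕ.≤-refl
  ... | no _  | no _  = s≤s (ℕ.m≤n⇒m≤1+n (rank≤n v))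

  position-mono : ∀ {u v} → t u < t v → position u < position v
  position-mono {u} {v} l with u ≟ S | u ≟ N | v ≟ S | v ≟ N
  ... | yes refl | _ | yes refl | _ = ⊥-elim (ℕ.<-irrefl refl l)
  ... | yes _ | _ | no _ | yes _ = s≤s z≤n
  ... | yes _ | _ | no p | no q = rank>0 p q
  ... | no p | _ | yes refl | _ = ⊥-elim (ℕ.<-asym l (t-S p))
  ... | no _ | yes refl | no _ | yes refl = ⊥-elim (ℕ.<-irrefl refl l)
  ... | no _ | yes refl | no _ | no q = ⊥-elim (ℕ.<-asym l (t-N q))
  ... | no _ | no _ | no _ | yes _ = s≤s (rank≤n u)
  ... | no _ | no _ | no p | no q = rank-mono p q l

insert-self : ∀ {m n} i j (π : Permutation m n) → insert i j π ⟨$⟩ʳ i ≡ j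
insert-self i j π with i ≟ i
... | yes _ = refl
... | no p  = ⊥-elim (p refl)

remove-fixed : ∀ {m} i (σ : Permutation′ (suc m)) → σ ⟨$⟩ʳ i ≡ i →
  ∃ λ (ρ : Permutation′ m) → ∀ k → σ ⟨$⟩ʳ punchIn i k ≡ punchIn i (ρ ⟨$⟩ʳ k)
remove-fixed i σ p = Perm.remove i σ , λ k →
  trans (Perm.punchIn-permute σ i k) (cong (λ j → punchIn j (Perm.remove i σ ⟨$⟩ʳ k)) p)

module _ {n : ℕ} where

  top : Fin (2 + n)
  top = fromℕ (suc n)

  -- Fin n stands for {1, …, n}, as a part of {0, …, n+1}.
  interior : Fin n → Fin (2 + n)
  interior i = punchIn top (suc i)

  toℕ-punchIn-fromℕ : ∀ m (k : Fin m) → toℕ (punchIn (fromℕ m) k) ≡ toℕ k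
  toℕ-punchIn-fromℕ (suc m) zero    = refl
  toℕ-punchIn-fromℕ (suc m) (suc k) = cong suc (toℕ-punchIn-fromℕ m k)

  toℕ-interior : ∀ i → toℕ (interior i) ≡ suc (toℕ i)
  toℕ-interior i = toℕ-punchIn-fromℕ (suc n) (suc i)

  toℕ-top : toℕ top ≡ suc n
  toℕ-top = Fin.toℕ-fromℕ (suc n)

  completion-interior : ∀ (π : Permutation′ n) i →
      completion π ⟨$⟩ʳ interior i ≡ interior (π ⟨$⟩ʳ i)
  completion-interior π i = Perm.insert-punchIn top top (lift₀ π) (suc i)

  completion-top : ∀ (π : Permutation′ n) → completion π ⟨$⟩ʳ top ≡ top
  completion-top π = insert-self top top (lift₀ π)

  completion-zero : ∀ (π : Permutation′ n) → completion π ⟨$⟩ʳ zero ≡ zero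
  completion-zero π = Perm.insert-punchIn top top (lift₀ π) zero

  data Position : Fin (2 + n) → Set where
    isZero : Position zero
    isInterior : ∀ i → Position (interior i)
    isTop  : Position top

  position-view : ∀ j → Position j
  position-view j with top ≟ j
  ... | yes refl = isTop
  ... | no p = subst Position (Fin.punchIn-punchOut p) (go (punchOut p))
    where
    go : ∀ k → Position (punchIn top k)
    go zero    = isZero
    go (suc i) = isInterior i

  completion-cong : ∀ {π ρ : Permutation′ n} → π Perm.≈ ρ → completion π Perm.≈ completion ρ
  completion-cong {π} {ρ} p j with position-view j
  ... | isZero   = refl
  ... | isInterior i = trans (completion-interior π i)
      (trans (cong interior (p i)) (sym (completion-interior ρ i)))
  ... | isTop    = trans (completion-top π) (sym (completion-top ρ))

  restriction : (σ : Permutation′ (2 + n)) → σ ⟨$⟩ʳ zero ≡ zero → σ ⟨$⟩ʳ top ≡ top →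
    ∃ λ π → completion π Perm.≈ σ
  restriction σ σ-0 σ-top with ρ , ρ-σ ← remove-fixed top σ σ-top
    with π , π-ρ ← remove-fixed zero ρ
        (Fin.punchIn-injective top _ _ (trans (sym (ρ-σ zero)) σ-0)) = π , agree
    where
    agree : ∀ j → completion π ⟨$⟩ʳ j ≡ σ ⟨$⟩ʳ j
    agree j with position-view j
    ... | isZero   = trans (completion-zero π) (sym σ-0)
    ... | isInterior i = trans (completion-interior π i)
        (trans (cong (punchIn top) (sym (π-ρ i))) (sym (ρ-σ (suc i))))
    ... | isTop    = trans (completion-top π) (sym σ-top)

  -- As `X` and `Y` agree at both poles, passing from abscissa to ordinate fixes `zero` and `top`;
  -- hence it is the completion of a permutation of the other points.
  transition : (X Y : Permutation′ (2 + n)) → ∀ {s t} → X ⟨$⟩ʳ s ≡ zero → Y ⟨$⟩ʳ s ≡ zero →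
    X ⟨$⟩ʳ t ≡ top → Y ⟨$⟩ʳ t ≡ top →
    ∃ λ (π : Permutation′ n) → ∀ v → completion π ⟨$⟩ʳ (X ⟨$⟩ʳ v) ≡ Y ⟨$⟩ʳ v
  transition X Y {s} {t} Xs Ys Xt Yt = proj₁ restricted ,
    λ v → trans (proj₂ restricted (X ⟨$⟩ʳ v)) (cong (Y ⟨$⟩ʳ_) (Perm.inverseˡ X))
    where
    σ-at : ∀ {v j} → X ⟨$⟩ʳ v ≡ j → Y ⟨$⟩ʳ v ≡ j → Y ⟨$⟩ʳ (X ⟨$⟩ˡ j) ≡ j
    σ-at refl q = trans (cong (Y ⟨$⟩ʳ_) (Perm.inverseˡ X)) q
    restricted = restriction (Perm.flip X Perm.∘ₚ Y) (σ-at Xs Ys) (σ-at Xt Yt)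

  interior-injective : ∀ {i j} → interior i ≡ interior j → i ≡ j
  interior-injective p = Fin.suc-injective (Fin.punchIn-injective top _ _ p)

module Coordinate {n E : ℕ} (B : Bipolar (2 + n) E) where
  open Bipolar B
  open Chains B using (S≢N)
  open Tour B
  open Rank S N S≢N time time-S time-N public

  private
    place : Fin (2 + n) → Fin (2 + n)
    place v = fromℕ< (position<2+n v)

    position-injective : ∀ {u v} → position u ≡ position v → u ≡ v
    position-injective {u} {v} p with ℕ.<-cmp (time u) (time v)
    ... | tri< q _ _ = ⊥-elim (ℕ.<⇒≢ (position-mono q) p)
    ... | tri≈ _ q _ = time-injective q
    ... | tri> _ _ q = ⊥-elim (ℕ.<⇒≢ (position-mono q) (sym p))

    toℕ-place : ∀ v → toℕ (place v) ≡ position v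
    toℕ-place v = Fin.toℕ-fromℕ< (position<2+n v)

  abstract
    coordinate : Permutation′ (2 + n)
    coordinate = injective⇒permutation place λ {u} {v} p →
      position-injective (trans (sym (toℕ-place u)) (trans (cong toℕ p) (toℕ-place v)))

    coordinate-position : ∀ v → toℕ (coordinate ⟨$⟩ʳ v) ≡ position v
    coordinate-position = toℕ-place

  coord : Fin (2 + n) → ℕ
  coord v = toℕ (coordinate ⟨$⟩ʳ v)

  coord-position : ∀ v → coord v ≡ position v
  coord-position = coordinate-position

  coord-mono : ∀ {u v} → time u < time v → coord u < coord v
  coord-mono {u} {v} p = subst₂ _<_ (sym (coord-position u)) (sym (coord-position v))
      (position-mono p)

  coordinate-S : coordinate ⟨$⟩ʳ S ≡ zero
  coordinate-S = Fin.toℕ-injective (trans (coord-position S) position-S)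

  coordinate-N : coordinate ⟨$⟩ʳ N ≡ top
  coordinate-N = Fin.toℕ-injective (trans (coord-position N) (trans position-N (sym toℕ-top)))

module Code {n E : ℕ} (bipolar : Bipolar (2 + n) E) where
  open Bipolar bipolar using (S; N)
  module X = Coordinate bipolar
  module Y = Coordinate (mirror bipolar)

  labels : Labels bipolar X.coord Y.coord
  labels = relabel bipolar (times bipolar) X.coord-mono Y.coord-mono

  abstract
    private
      transitions : ∃ λ (π : Permutation′ n) →
        ∀ v → completion π ⟨$⟩ʳ (X.coordinate ⟨$⟩ʳ v) ≡ Y.coordinate ⟨$⟩ʳ v
      transitions = transition X.coordinate Y.coordinate
        X.coordinate-S Y.coordinate-S X.coordinate-N Y.coordinate-N

    code : Permutation′ n
    code = proj₁ transitions

    code-coordinate : ∀ v → completion code ⟨$⟩ʳ (X.coordinate ⟨$⟩ʳ v) ≡ Y.coordinate ⟨$⟩ʳ v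
    code-coordinate = proj₂ transitions

  vertex : Fin n → Fin (2 + n)
  vertex i = X.coordinate ⟨$⟩ˡ interior i

  vertex-x : ∀ i → X.coordinate ⟨$⟩ʳ vertex i ≡ interior i
  vertex-x i = Perm.inverseʳ X.coordinate

  vertex-X : ∀ i → X.coord (vertex i) ≡ suc (toℕ i)
  vertex-X i = trans (cong toℕ (vertex-x i)) (toℕ-interior i)

  vertex-Y : ∀ i → Y.coord (vertex i) ≡ suc (toℕ (code ⟨$⟩ʳ i))
  vertex-Y i = trans (cong toℕ (trans (sym (code-coordinate (vertex i)))
    (trans (cong (completion code ⟨$⟩ʳ_) (vertex-x i)) (completion-interior code i))))
    (toℕ-interior (code ⟨$⟩ʳ i))

  vertex-≢S : ∀ i → vertex i ≢ S
  vertex-≢S i p = ℕ.1+n≢0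
    (trans (sym (vertex-X i)) (trans (cong X.coord p) (cong toℕ X.coordinate-S)))

  vertex-≢N : ∀ i → vertex i ≢ N
  vertex-≢N i p = ℕ.<⇒≢ (Fin.toℕ<n i) (ℕ.suc-injective (trans (sym (vertex-X i))
    (trans (cong X.coord p) (trans (cong toℕ X.coordinate-N) toℕ-top))))

  vertex-surjective : ∀ {v} → v ≢ S → v ≢ N → ∃ λ i → v ≡ vertex i
  vertex-surjective {v} v≢S v≢N = go (position-view _) refl
    where
    go : ∀ {j} → Position j → X.coordinate ⟨$⟩ʳ v ≡ j → ∃ λ i → v ≡ vertex i
    go isZero eq = ⊥-elim (v≢S (⟨$⟩ʳ-injective X.coordinate (trans eq (sym X.coordinate-S))))
    go isTop eq = ⊥-elim (v≢N (⟨$⟩ʳ-injective X.coordinate (trans eq (sym X.coordinate-N))))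
    go (isInterior i) eq = i , ⟨$⟩ʳ-injective X.coordinate (trans eq (sym (vertex-x i)))

  code-plane : Plane code
  code-plane (i , j , j⁺ , k , i<j , j⁺≡1+j , j⁺<k , j<ᵧi , i<ᵧk , k<ᵧj⁺) =
    times-plane bipolar {vertex i} {vertex j} {vertex j⁺} {vertex k}
      (x-time i<j) (x-time (ℕ.≤-reflexive (sym j⁺≡1+j)))
      -- A vertex visited between these two would have its abscissa strictly between consecutive
      -- integers.
      (λ z (p , q) → ℕ.<⇒≱ (subst (_< X.coord z) (vertex-X j) (X.coord-mono p))
        (ℕ.≤-pred (subst (X.coord z <_) (trans (vertex-X j⁺) (cong suc j⁺≡1+j)) (X.coord-mono q))))
      (x-time j⁺<k) (y-time j<ᵧi) (y-time i<ᵧk) (y-time k<ᵧj⁺)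
    where
    open Tour bipolar using (time; time-injective)
    module Tʸ = Tour (mirror bipolar)
    x-time : ∀ {a b} → toℕ a < toℕ b → time (vertex a) < time (vertex b)
    x-time {a} {b} p with ℕ.<-cmp (time (vertex a)) (time (vertex b))
    ... | tri< q _ _ = q
    ... | tri≈ _ q _ = ⊥-elim (ℕ.<⇒≢ p (ℕ.suc-injective (trans (sym (vertex-X a))
      (trans (cong X.coord (time-injective q)) (vertex-X b)))))
    ... | tri> _ _ q = ⊥-elim (ℕ.<-asym p
        (ℕ.≤-pred (subst₂ _<_ (vertex-X b) (vertex-X a) (X.coord-mono q))))
    y-time : ∀ {a b} → toℕ (code ⟨$⟩ʳ a) < toℕ (code ⟨$⟩ʳ b) →
        Tʸ.time (vertex a) < Tʸ.time (vertex b)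
    y-time {a} {b} p with ℕ.<-cmp (Tʸ.time (vertex a)) (Tʸ.time (vertex b))
    ... | tri< q _ _ = q
    ... | tri≈ _ q _ = ⊥-elim (ℕ.<⇒≢ p (ℕ.suc-injective (trans (sym (vertex-Y a))
      (trans (cong Y.coord (Tʸ.time-injective q)) (vertex-Y b)))))
    ... | tri> _ _ q = ⊥-elim (ℕ.<-asym p
        (ℕ.≤-pred (subst₂ _<_ (vertex-Y b) (vertex-Y a) (Y.coord-mono q))))

  rank-x : ∀ {v} → v ≢ S → v ≢ N → X.coord v ≡ X.rankᵗ v
  rank-x p q = trans (X.coord-position _) (X.position-inner p q)

  rank-y : ∀ {v} → v ≢ S → v ≢ N → Y.coord v ≡ Y.rankᵗ v
  rank-y p q = trans (Y.coord-position _) (Y.position-inner p q)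

  codePermutation : PlanePermutation n
  codePermutation = planePermutation code code-plane

  code-points : ∀ a b → points codePermutation (a , b) →
    ∃ λ v → (v ≢ S × v ≢ N) × a ≡ X.rankᵗ v × b ≡ Y.rankᵗ v
  code-points a b (i , p , q) = vertex i , (vertex-≢S i , vertex-≢N i) ,
    trans p (trans (sym (vertex-X i)) (rank-x (vertex-≢S i) (vertex-≢N i))) ,
    trans q (trans (sym (vertex-Y i)) (rank-y (vertex-≢S i) (vertex-≢N i)))

  points-code : ∀ a b → (∃ λ v → (v ≢ S × v ≢ N) × a ≡ X.rankᵗ v × b ≡ Y.rankᵗ v) →
    points codePermutation (a , b)
  points-code a b (v , (p , q) , r , s) with i , refl ← vertex-surjective p q =
    i , trans r (trans (sym (rank-x p q)) (vertex-X i)) ,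
        trans s (trans (sym (rank-y p q)) (vertex-Y i))

toBipolar : ∀ {n} (B : PlaneBipolarPoset n) → Bipolar (2 + n) (OrientedMap.edges (orientedMap B))
toBipolar B = Counting.bipolar (orientedMap B) (PlaneBipolarPoset.isPlaneBipolarPoset B)

decode : ∀ {n} → PlaneBipolarPoset n → PlanePermutation n
decode B = Code.codePermutation (toBipolar B)

points-decode : ∀ {n} (B : PlaneBipolarPoset n) → points (decode B) ≐ Ψ B
points-decode B = (λ {p} → Code.code-points (toBipolar B) (proj₁ p) (proj₂ p)) ,
  (λ {p} → Code.points-code (toBipolar B) (proj₁ p) (proj₂ p))

-- Dominance diagrams

extremum : ∀ {m} {P : Fin m → Set} (P? : ∀ v → Dec (P v)) {_≺_ : Rel (Fin m) 0ℓ} →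
  (∀ u v → Dec (u ≺ v)) → WellFounded _≺_ → ∀ {a} → P a → ∃ λ r → P r × (∀ c → P c → ¬ c ≺ r)
extremum {P = P} P? {_≺_} _≺?_ wf {a} = go a (wf a)
  where
  go : ∀ a → Acc _≺_ a → P a → ∃ λ r → P r × (∀ c → P c → ¬ c ≺ r)
  go a (acc rs) p with Fin.any? (λ c → P? c ×-dec (c ≺? a))
  ... | yes (c , q , r) = go c (rs r) q
  ... | no ¬q = a , p , λ c q r → ¬q (c , q , r)

module _ {m : ℕ} (f : Fin m → ℕ) where

  private
    acyclic : ∀ v → ¬ TransClosure (λ u v → f u < f v) v v
    acyclic v p = ℕ.<-irrefl refl (increasing p)
      where
      increasing : ∀ {u v} → TransClosure (λ u v → f u < f v) u v → f u < f v
      increasing (Trans.[_] p) = p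
      increasing (p ∷ s)       = ℕ.<-trans p (increasing s)

  below-wellFounded : WellFounded (λ u v → f u < f v)
  below-wellFounded = acyclic⇒wellFounded acyclic

  above-wellFounded : WellFounded (λ v u → f u < f v)
  above-wellFounded = acyclic⇒noetherian acyclic

module Points {m : ℕ} (x y : Fin m → ℕ)
  (x-injective : ∀ {u v} → x u ≡ x v → u ≡ v) (y-injective : ∀ {u v} → y u ≡ y v → u ≡ v) where

  _≪_ : Rel (Fin m) 0ℓ
  u ≪ v = x u < x v × y u < y v

  ≪-trans : ∀ {u v w} → u ≪ v → v ≪ w → u ≪ w
  ≪-trans (p , q) (r , s) = ℕ.<-trans p r , ℕ.<-trans q s

  _≪?_ : ∀ u v → Dec (u ≪ v)
  u ≪? v = (x u ℕ.<? x v) ×-dec (y u ℕ.<? y v)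

  Cover : Rel (Fin m) 0ℓ
  Cover u v = u ≪ v × (∀ k → ¬ (u ≪ k × k ≪ v))

  _⊑_ : Rel (Fin m) 0ℓ
  u ⊑ v = u ≡ v ⊎ u ≪ v

  ⊑-≪ : ∀ {u v w} → u ⊑ v → v ≪ w → u ≪ w
  ⊑-≪ (inj₁ refl) q = q
  ⊑-≪ (inj₂ p)    q = ≪-trans p q

  ≪-⊑ : ∀ {u v w} → u ≪ v → v ⊑ w → u ≪ w
  ≪-⊑ p (inj₁ refl) = p
  ≪-⊑ p (inj₂ q)    = ≪-trans p q

  ⊑-x : ∀ {u v} → u ⊑ v → x u ≤ x v
  ⊑-x (inj₁ refl)    = ℕ.≤-refl
  ⊑-x (inj₂ (p , _)) = ℕ.<⇒≤ p

  ⊑-y : ∀ {u v} → u ⊑ v → y u ≤ y v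
  ⊑-y (inj₁ refl)    = ℕ.≤-refl
  ⊑-y (inj₂ (_ , p)) = ℕ.<⇒≤ p

  private
    _⊑?_ : ∀ u v → Dec (u ⊑ v)
    u ⊑? v with u ≟ v | u ≪? v
    ... | yes p | _     = yes (inj₁ p)
    ... | no _  | yes q = yes (inj₂ q)
    ... | no p  | no q  = no [ p , q ]

  upper-cover : ∀ {u v} → u ≪ v → ∃ λ k → Cover u k × k ⊑ v
  upper-cover {u} {v} p
    with k , (q , r) , min ← extremum (λ k → (u ≪? k) ×-dec (k ⊑? v)) (λ k l → x k ℕ.<? x l)
      (below-wellFounded x) (p , inj₁ refl) =
    k , (q , λ l (a , b) → min l (a , inj₂ (≪-⊑ b r)) (proj₁ b)) , r

  lower-cover : ∀ {u v} → u ≪ v → ∃ λ k → Cover k v × u ⊑ k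
  lower-cover {u} {v} p
    with k , (q , r) , max ← extremum (λ k → (u ⊑? k) ×-dec (k ≪? v)) (λ k l → x l ℕ.<? x k)
      (above-wellFounded x) (inj₁ refl , p) =
    k , (r , λ l (a , b) → max l (inj₂ (⊑-≪ q a) , b) (proj₁ a)) , q

  -- This excludes crossings by flatter segments; crossings by steeper ones
  -- are excluded by NoCrossing-mirror.
  NoCrossing : Set
  NoCrossing = ∀ {a b c d} → Cover b c → x a < x b → x c < x d → y b < y a → y a < y d →
      y d < y c → ⊥

  RightmostIn : Rel (Fin m) 0ℓ
  RightmostIn r v = Cover r v × (∀ c → c ≪ v → x c ≤ x r)

  rightmost-in : ∀ {u v} → u ≪ v → ∃ λ r → RightmostIn r v
  rightmost-in {u} {v} p
    with r , q , max ← extremum (_≪? v) (λ k l → x l ℕ.<? x k) (above-wellFounded x) p =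
    r , (q , λ k (a , b) → max k b (proj₁ a)) , λ c s → ℕ.≮⇒≥ (max c s)

  module _ (nc : NoCrossing) where

    -- The left boundary of the face below two neighbouring edges a → v and
    -- b → v, with a to the left of b.
    module LeftPath {a b v} (a⋖v : Cover a v) (b⋖v : Cover b v) (a<b : x a < x b)
      (neighbours : ∀ {c} → Cover c v → x a < x c → x c < x b → ⊥) where

      b<ᵧa : y b < y a
      b<ᵧa with ℕ.<-cmp (y a) (y b)
      ... | tri< p _ _ = ⊥-elim (proj₂ a⋖v b ((a<b , p) , proj₁ b⋖v))
      ... | tri≈ _ p _ = ⊥-elim (ℕ.<⇒≢ a<b (cong x (y-injective p)))
      ... | tri> _ _ p = p

      -- Such a `c` is weakly below some `ℓ` covered by `v`. Then `ℓ` lies between the neighbours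
      -- `a` and `b`, or it is `b` and too low for `c`, or it separates `b` from `v`.
      gap : ∀ {c} → c ≪ v → x a < x c → y b < y c → ⊥
      gap {c} c≪v a<c b<c with ℓ , ℓ⋖v , c⊑ℓ ← lower-cover c≪v with ℕ.<-cmp (x ℓ) (x b)
      ... | tri< p _ _ = neighbours ℓ⋖v (ℕ.<-≤-trans a<c (⊑-x c⊑ℓ)) p
      ... | tri≈ _ p _ with refl ← x-injective p = ℕ.<⇒≱ b<c (⊑-y c⊑ℓ)
      ... | tri> _ _ p = proj₂ b⋖v ℓ ((p , ℕ.<-≤-trans b<c (⊑-y c⊑ℓ)) , proj₁ ℓ⋖v)

      -- The invariant of the descent.
      Clear : Fin m → Set
      Clear z = ∀ c → y c < y z → x z < x c → x a < x c

      clear-a : Clear a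
      clear-a c _ p = p

      clear-v : Clear v
      clear-v c _ p = ℕ.<-trans (proj₁ (proj₁ a⋖v)) p

      clear-step : ∀ {r z} → RightmostIn r z → Clear z → Clear r
      clear-step {r} {z} ((r≪z , _) , max) clear c c<r r<c with ℕ.<-cmp (x c) (x z)
      ... | tri< p _ _ = ⊥-elim (ℕ.<⇒≱ r<c (max c (p , ℕ.<-trans c<r (proj₂ r≪z))))
      ... | tri≈ _ p _ with refl ← x-injective p = ⊥-elim (ℕ.<-asym c<r (proj₂ r≪z))
      ... | tri> _ _ p = clear c (ℕ.<-trans c<r (proj₂ r≪z)) p

      -- A point `c` above `z` but lower than `z⁺` would be to the right of `a`. If it is also left
      -- of `v`, it falls into the empty region of `gap`; if it is right of `v`, the pair `z ≪ c`
      -- crosses the segment from `b` to `v`.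
      rightmost-out : ∀ {z z⁺} → Cover z z⁺ → Clear z⁺ → y b < y z → z⁺ ⊑ v → ∀ c → z ≪ c →
          y z⁺ ≤ y c
      rightmost-out {z} {z⁺} (z≪z⁺ , z⋖z⁺) clear b<z z⁺⊑v c z≪c = ℕ.≮⇒≥ λ c<z⁺ →
          beyond c<z⁺ (right c<z⁺)
        where
        right : y c < y z⁺ → x a < x c
        right c<z⁺ with ℕ.<-cmp (x c) (x z⁺)
        ... | tri< p _ _ = ⊥-elim (z⋖z⁺ c (z≪c , p , c<z⁺))
        ... | tri≈ _ p _ = ⊥-elim (ℕ.<⇒≢ c<z⁺ (cong y (x-injective p)))
        ... | tri> _ _ p = clear c c<z⁺ p
        z≪v : z ≪ v
        z≪v = ≪-⊑ z≪z⁺ z⁺⊑v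
        z<b : x z < x b
        z<b with ℕ.<-cmp (x z) (x b)
        ... | tri< p _ _ = p
        ... | tri≈ _ p _ = ⊥-elim (ℕ.<⇒≢ b<z (cong y (sym (x-injective p))))
        ... | tri> _ _ p = ⊥-elim (proj₂ b⋖v z ((p , b<z) , z≪v))
        beyond : y c < y z⁺ → x a < x c → ⊥
        beyond c<z⁺ a<c with ℕ.<-cmp (x c) (x v)
        ... | tri< p _ _ = gap (p , ℕ.<-≤-trans c<z⁺ (⊑-y z⁺⊑v)) a<c (ℕ.<-trans b<z (proj₂ z≪c))
        ... | tri≈ _ p _ = ℕ.<⇒≱ c<z⁺ (subst (λ c → y z⁺ ≤ y c) (sym (x-injective p)) (⊑-y z⁺⊑v))
        ... | tri> _ _ p = nc b⋖v z<b p b<z (proj₂ z≪c) (ℕ.<-≤-trans c<z⁺ (⊑-y z⁺⊑v))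

      record Bottom (z z⁺ : Fin m) : Set where
        field
          cover    : Cover z z⁺
          below-a  : z⁺ ⊑ a
          not-below-b : y b < y z⁺
          below-b  : z ≪ b
          clear    : Clear z
          clear⁺   : Clear z⁺

      bottom-x : ∀ {z z⁺ w} → Bottom z z⁺ → w ≪ a → w ≪ b → x w ≤ x z ⊎ z ≪ w
      bottom-x {z} {z⁺} {w} β w≪a w≪b with ℕ.<-cmp (x z) (x w) | ℕ.<-cmp (y z) (y w)
      ... | tri≈ _ p _ | _ = inj₁ (ℕ.≤-reflexive (sym p))
      ... | tri> _ _ p | _ = inj₁ (ℕ.<⇒≤ p)
      ... | tri< p _ _ | tri< q _ _ = inj₂ (p , q)
      ... | tri< p _ _ | tri≈ _ q _ = inj₁ (ℕ.≤-reflexive (cong x (y-injective (sym q))))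
      ... | tri< p _ _ | tri> _ _ q = ⊥-elim (ℕ.<-asym (proj₁ w≪a) (Bottom.clear β w q p))

      -- If `w` were above `z`, it would still be lower than `z⁺`, since it is lower than `b`. Then
      -- it would separate `z` from its cover `z⁺`, or be right of `z⁺` and hence, by clearness,
      -- right of `a`.
      bottom-x≤ : ∀ {z z⁺ w} → Bottom z z⁺ → w ≪ a → w ≪ b → x w ≤ x z
      bottom-x≤ {z} {z⁺} {w} β w≪a w≪b with bottom-x β w≪a w≪b
      ... | inj₁ p = p
      ... | inj₂ z≪w = ⊥-elim (beyond (ℕ.<-cmp (x w) (x z⁺)))
        where
        open Bottom β
        w<z⁺ : y w < y z⁺
        w<z⁺ = ℕ.<-trans (proj₂ w≪b) not-below-b
        beyond : Tri (x w < x z⁺) (x w ≡ x z⁺) (x z⁺ < x w) → ⊥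
        beyond (tri< p _ _) = proj₂ cover w (z≪w , p , w<z⁺)
        beyond (tri≈ _ p _) = ℕ.<⇒≢ w<z⁺ (cong y (x-injective p))
        beyond (tri> _ _ p) = ℕ.<-asym (proj₁ w≪a) (clear⁺ w w<z⁺ p)

      -- The walk moves to the rightmost point below until it is no higher than `b`; then it is
      -- below `b` while its previous point is not. The relation `Q` stands for whatever has to be
      -- transported along the way.
      descent : (s : Fin m) → (∀ v → s ⊑ v) → (Q : Rel (Fin m) 0ℓ) → Q a v →
        (∀ {r z z⁺} → RightmostIn r z → Cover z z⁺ → (∀ c → z ≪ c → y z⁺ ≤ y c) → Q z z⁺ → Q r z) →
        ∃ λ z → ∃ λ z⁺ → Bottom z z⁺ × Q z z⁺
      descent s s⊑ Q q step =
        go (below-wellFounded x a) a⋖v (inj₁ refl) clear-a clear-v (inj₁ refl) (inj₁ refl) q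
        where
        go : ∀ {z z⁺} → Acc (λ u v → x u < x v) z → Cover z z⁺ → z ⊑ a → Clear z → Clear z⁺ →
            z⁺ ⊑ v →
          z ≡ a ⊎ (y b < y z⁺ × z⁺ ⊑ a) → Q z z⁺ → ∃ λ z → ∃ λ z⁺ → Bottom z z⁺ × Q z z⁺
        go {z} {z⁺} (acc rs) z⋖z⁺ z⊑a clear clear⁺ z⁺⊑v start q with y b ℕ.<? y z
        ... | yes b<z = down (rightmost-in (s≪z (s⊑ z)))
          where
          s≪z : s ⊑ z → s ≪ z
          s≪z (inj₁ refl) = ⊥-elim (ℕ.<⇒≱ b<z (⊑-y (s⊑ b)))
          s≪z (inj₂ p)    = p
          down : (∃ λ r → RightmostIn r z) → ∃ λ z → ∃ λ z⁺ → Bottom z z⁺ × Q z z⁺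
          down (r , ρ@(r⋖z@(r≪z , _) , _)) =
            go (rs (proj₁ r≪z)) r⋖z (inj₂ (≪-⊑ r≪z z⊑a)) (clear-step ρ clear) clear
              (inj₂ (⊑-≪ z⊑a (proj₁ a⋖v))) (inj₂ (b<z , z⊑a))
              (step ρ z⋖z⁺ (rightmost-out z⋖z⁺ clear⁺ b<z z⁺⊑v) q)
        ... | no b≮z with start
        ...   | inj₁ refl = ⊥-elim (b≮z b<ᵧa)
        ...   | inj₂ (b<z⁺ , z⁺⊑a) = z , z⁺ , record
          { cover = z⋖z⁺ ; below-a = z⁺⊑a ; not-below-b = b<z⁺ ; clear = clear ; clear⁺ = clear⁺
          ; below-b = z<b , ℕ.≤∧≢⇒< (ℕ.≮⇒≥ b≮z) (λ p → ℕ.<⇒≢ z<b (cong x (y-injective p)))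
          } , q
          where
          z<b : x z < x b
          z<b = ℕ.<-≤-trans (proj₁ (proj₁ z⋖z⁺)) (ℕ.≤-trans (⊑-x z⁺⊑a) (ℕ.<⇒≤ a<b))

  -- The right boundary of the whole diagram.
  outer-descent : ∀ {s t a} → (∀ v → s ⊑ v) → (∀ v → v ⊑ t) → RightmostIn a t →
      (Q : Rel (Fin m) 0ℓ) → Q a t →
    (∀ {r z z⁺} → RightmostIn r z → Cover z z⁺ → (∀ c → z ≪ c → y z⁺ ≤ y c) → Q z z⁺ → Q r z) →
    ∃ λ z → Cover s z × (∀ c → s ≪ c → y z ≤ y c) × Q s z
  outer-descent {s} {t} {a} s⊑ ⊑t (a⋖t , max) Q q step =
    go (below-wellFounded x a) a⋖t clear-a (λ c _ p → ℕ.<⇒≱ p (⊑-x (⊑t c))) q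
    where
    Clear : Fin m → Set
    Clear z = ∀ c → y c < y z → x z < x c → ⊥
    clear-a : Clear a
    clear-a c c<a a<c with ⊑t c
    ... | inj₁ refl = ℕ.<-asym c<a (proj₂ (proj₁ a⋖t))
    ... | inj₂ c≪t  = ℕ.<⇒≱ a<c (max c c≪t)
    go : ∀ {z z⁺} → Acc (λ u v → x u < x v) z → Cover z z⁺ → Clear z → Clear z⁺ → Q z z⁺ →
      ∃ λ z → Cover s z × (∀ c → s ≪ c → y z ≤ y c) × Q s z
    go {z} {z⁺} (acc rs) z⋖z⁺ clear clear⁺ q = continue (s⊑ z)
      where
      rightmost : ∀ c → z ≪ c → y z⁺ ≤ y c
      rightmost c z≪c = ℕ.≮⇒≥ λ c<z⁺ → case ℕ.<-cmp (x c) (x z⁺) of λ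
        { (tri< p _ _) → proj₂ z⋖z⁺ c (z≪c , p , c<z⁺)
        ; (tri≈ _ p _) → ℕ.<⇒≢ c<z⁺ (cong y (x-injective p))
        ; (tri> _ _ p) → clear⁺ c c<z⁺ p }
      clear-step : ∀ {r} → RightmostIn r z → Clear r
      clear-step {r} ((r≪z , _) , max) c c<r r<c with ℕ.<-cmp (x c) (x z)
      ... | tri< p _ _ = ℕ.<⇒≱ r<c (max c (p , ℕ.<-trans c<r (proj₂ r≪z)))
      ... | tri≈ _ p _ = ℕ.<⇒≢ (ℕ.<-trans c<r (proj₂ r≪z)) (cong y (x-injective p))
      ... | tri> _ _ p = clear c (ℕ.<-trans c<r (proj₂ r≪z)) p
      continue : s ⊑ z → ∃ λ z → Cover s z × (∀ c → s ≪ c → y z ≤ y c) × Q s z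
      continue (inj₁ refl) = z⁺ , z⋖z⁺ , rightmost , q
      continue (inj₂ s≪z) with r , ρ@(r⋖z@(r≪z , _) , _) ← rightmost-in s≪z =
        go (rs (proj₁ r≪z)) r⋖z (clear-step ρ) clear (step ρ z⋖z⁺ rightmost q)

-- Roles are exchanged: let `a′` be the highest point below `d` that is lower than `b` and not left
-- of `a`. By maximality, a cover `d′` of `a′` towards `d` is already higher than `b`, and then the
-- flatter pair `b ≪ c` crosses the segment from `a′` to `d′`.
NoCrossing-mirror : ∀ {m} (x y : Fin m → ℕ) (xi : ∀ {u v} → x u ≡ x v → u ≡ v)
    (yi : ∀ {u v} → y u ≡ y v → u ≡ v) →
  Points.NoCrossing x y xi yi → Points.NoCrossing y x yi xi
NoCrossing-mirror x y xi yi nc {a} {b} {c} {d} (b≪c , b⋖c) a<b c<d b<a a<d d<c = go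
  where
  open Points x y xi yi
  a≪d : a ≪ d
  a≪d = a<d , ℕ.<-trans a<b (ℕ.<-trans (proj₁ b≪c) c<d)
  go : ⊥
  go with a′ , (a≤a′ , a′≪d , a′<b) , max ← extremum
            (λ k → (x a ℕ.≤? x k) ×-dec ((k ≪? d) ×-dec (y k ℕ.<? y b)))
            (λ k l → y l ℕ.<? y k) (above-wellFounded y) (ℕ.≤-refl , a≪d , a<b)
     with d′ , a′⋖d′@((a′<d′ , a′<ᵧd′) , _) , d′⊑d ← upper-cover a′≪d =
    nc a′⋖d′ b<a′ (ℕ.≤-<-trans (⊑-x d′⊑d) d<c) a′<b (proj₁ b≪c) c<d′
    where
    b<a′ : x b < x a′
    b<a′ = ℕ.<-≤-trans b<a a≤a′
    b<d′ : y b < y d′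
    b<d′ = ℕ.≤∧≢⇒< (ℕ.≮⇒≥ (λ d′<b → below d′<b d′⊑d))
      (λ p → ℕ.<⇒≢ (ℕ.<-trans b<a′ a′<d′) (cong x (yi p)))
      where
      below : y d′ < y b → d′ ⊑ d → ⊥
      below d′<b (inj₁ refl) = ℕ.<-asym d′<b (ℕ.<-trans (proj₁ b≪c) c<d)
      below d′<b (inj₂ d′≪d) = max d′ (ℕ.≤-trans a≤a′ (ℕ.<⇒≤ a′<d′) , d′≪d , d′<b) a′<ᵧd′
    d′<c : x d′ < x c
    d′<c = ℕ.≤-<-trans (⊑-x d′⊑d) d<c
    c<d′ : y c < y d′
    c<d′ with ℕ.<-cmp (y c) (y d′)
    ... | tri< p _ _ = p
    ... | tri≈ _ p _ = ⊥-elim (ℕ.<⇒≢ d′<c (cong x (yi (sym p))))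
    ... | tri> _ _ p = ⊥-elim (b⋖c d′ ((b<d′ , ℕ.<-trans b<a′ a′<d′) , p , d′<c))

-- Rotations described by integer keys

module Successor {A D : Set} (origin : D → A) (key : D → ℕ) where

  Adjacent Around : D → D → (D → Set) → Set
  Adjacent d d′ C = key d < key d′ × (∀ c → C c → ¬ (key d < key c × key c < key d′))
  Around   d d′ C = ∀ c → C c → key c ≤ key d × key d′ ≤ key c

  -- Cyclic succession in terms of keys instead of lists, so that rotations of different origin can
  -- be compared. The second alternative is the return from the greatest key to the least.
  Succ : Rel D 0ℓ
  Succ d d′ = origin d′ ≡ origin d ×
    (Adjacent d d′ (λ c → origin c ≡ origin d) ⊎ Around d d′ (λ c → origin c ≡ origin d))

  Succ-functional : (∀ {d d′} → origin d ≡ origin d′ → key d ≡ key d′ → d ≡ d′) →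
    ∀ {d d′ d″} → Succ d d′ → Succ d d″ → d′ ≡ d″
  Succ-functional key-inj {d} {d′} {d″} (o , s) (o′ , s′) = key-inj (trans o (sym o′)) (go s s′)
    where
    go : _ → _ → key d′ ≡ key d″
    go (inj₁ (p , f)) (inj₁ (q , g)) with ℕ.<-cmp (key d′) (key d″)
    ... | tri< r _ _ = ⊥-elim (g d′ o (p , r))
    ... | tri≈ _ r _ = r
    ... | tri> _ _ r = ⊥-elim (f d″ o′ (q , r))
    go (inj₁ (p , f)) (inj₂ g) = ⊥-elim (ℕ.<⇒≱ p (proj₁ (g d′ o)))
    go (inj₂ f) (inj₁ (q , g)) = ⊥-elim (ℕ.<⇒≱ q (proj₁ (f d″ o′)))
    go (inj₂ f) (inj₂ g) = ℕ.≤-antisym (proj₂ (f d″ o′)) (proj₂ (g d′ o))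

module _ {A : Set} where

  AllPairs-refine : {P : A → Set} {R Q : Rel A 0ℓ} → (∀ {a b} → P a → P b → R a b → Q a b) →
    ∀ {xs} → All P xs → AllPairs R xs → AllPairs Q xs
  AllPairs-refine f [] [] = []
  AllPairs-refine f (p ∷ ps) (r ∷ rs) =
    All.zipWith (λ (q , r) → f p q r) (ps , r) ∷ AllPairs-refine f ps rs

  AllPairs-reverse : {R : Rel A 0ℓ} → ∀ {xs} → AllPairs R xs → AllPairs (λ a b → R b a) (reverse xs)
  AllPairs-reverse [] = []
  AllPairs-reverse {xs = x ∷ xs} (r ∷ rs) = subst (AllPairs _) (sym (List.unfold-reverse x xs))
    (AllPairs.++⁺ (AllPairs-reverse rs) ([] ∷ [])
      (All.tabulate λ p → All.lookup r (reverse⁻ p) ∷ []))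

  AllPairs-lookup : {R : Rel A 0ℓ} → ∀ {xs} → AllPairs R xs → ∀ {i j} → toℕ i < toℕ j →
    R (lookup xs i) (lookup xs j)
  AllPairs-lookup {xs = x ∷ xs} (r ∷ rs) {zero}  {suc j} _       = All.lookup r (∈.∈-lookup j)
  AllPairs-lookup {xs = x ∷ xs} (r ∷ rs) {suc i} {suc j} (s≤s p) = AllPairs-lookup rs p

  module _ (key : A → ℕ) where

    private
      Sorted : List A → Set
      Sorted = AllPairs (λ a b → key a < key b)

      split : ∀ as {d bs} → Sorted (as ++ d ∷ bs) →
        All (λ c → key c < key d) as × All (λ c → key d < key c) bs
      split []       (r ∷ _)  = [] , r
      split (a ∷ as) (r ∷ rs) with p , q ← split as rs =
          All.lookup r (∈.∈-++⁺ʳ as (here refl)) ∷ p , q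

    CyclicallyNext-sorted : ∀ {xs} → Sorted xs → ∀ {d d′} → CyclicallyNext d xs d′ →
      (key d < key d′ × ∀ {c} → c ∈ xs → ¬ (key d < key c × key c < key d′)) ⊎
      (∀ {c} → c ∈ xs → key c ≤ key d × key d′ ≤ key c)
    CyclicallyNext-sorted s {d} (inner as d′ bs) with p , q ∷ qs ← split as s
      with p′ , qs′ ← split (as ++ d ∷ [])
          (subst Sorted (sym (List.++-assoc as (d ∷ []) (d′ ∷ bs))) s) =
      inj₁ (q , λ c∈ → between (∈.∈-++⁻ as c∈))
      where
      between : ∀ {c} → c ∈ as ⊎ c ∈ d ∷ d′ ∷ bs → ¬ (key d < key c × key c < key d′)
      between (inj₁ r) (l , _)                     = ℕ.<-asym l (All.lookup p r)
      between (inj₂ (here refl)) (l , _)           = ℕ.<-irrefl refl l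
      between (inj₂ (there (here refl))) (_ , l)   = ℕ.<-irrefl refl l
      between (inj₂ (there (there r))) (_ , l)     = ℕ.<-asym l (All.lookup qs′ r)
    CyclicallyNext-sorted (r ∷ s) {d} (wrap x as) with p , _ ← split (x ∷ as) (r ∷ s) = inj₂ λ
      { (here refl) → ℕ.<⇒≤ (All.lookup r (∈.∈-++⁺ʳ as (here refl))) , ℕ.≤-refl
      ; (there c∈)  → below p (∈.∈-++⁻ as c∈) , ℕ.<⇒≤ (All.lookup r c∈) }
      where
      below : All (λ c → key c < key d) (x ∷ as) → ∀ {c} → c ∈ as ⊎ c ∈ d ∷ [] → key c ≤ key d
      below (_ ∷ p) (inj₁ q)           = ℕ.<⇒≤ (All.lookup p q)
      below _       (inj₂ (here refl)) = ℕ.≤-refl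
    CyclicallyNext-sorted _ alone = inj₂ λ { (here refl) → ℕ.≤-refl , ℕ.≤-refl }

cartesianProduct-sorted : {A B : Set} {R : Rel A 0ℓ} {T : Rel B 0ℓ} {xs : List A} {ys : List B} →
  AllPairs R xs → AllPairs T ys →
  AllPairs (λ (a , b) (a′ , b′) → R a a′ ⊎ (a ≡ a′ × T b b′)) (cartesianProduct xs ys)
cartesianProduct-sorted [] ts = []
cartesianProduct-sorted {xs = x ∷ xs} {ys} (r ∷ rs) ts = AllPairs.++⁺
  (AllPairs.map⁺ (AllPairs.map (λ t → inj₂ (refl , t)) ts))
  (cartesianProduct-sorted rs ts)
  (All.map⁺ (All.tabulate λ {b} _ → All.tabulate λ {(a′ , b′)} p →
    inj₁ (All.lookup r (proj₁ (∈.∈-cartesianProduct⁻ xs ys p)))))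

-- An interface to dominance diagrams in which the lexicographic list of covers is hidden; the
-- rotation enters through `next-Succ`.
record CoverDiagram (m : ℕ) : Set where
  field
    x y           : Fin m → ℕ
    x-injective   : ∀ {u v} → x u ≡ x v → u ≡ v
    y-injective   : ∀ {u v} → y u ≡ y v → u ≡ v
    x<m           : ∀ v → x v < m

  open Points x y x-injective y-injective public

  field
    segments      : ℕ
    lower upper   : Fin segments → Fin m

  Segment : Fin m → Fin m → Fin segments → Set
  Segment = λ u v e → lower e ≡ u × upper e ≡ v

  field
    segment-cover : ∀ e → Cover (lower e) (upper e)
    segment       : ∀ {u v} → Cover u v → ∃ (Segment u v)
    edge-unique   : ∀ {e e′} → lower e ≡ lower e′ → upper e ≡ upper e′ → e ≡ e′
    nextᵈ         : Dart segments → Dart segments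

  originᵈ : Dart segments → Fin m
  originᵈ = [_,_] lower upper

  -- Increasing clockwise: the outgoing darts from left to right, then the
  -- ingoing ones from right to left.
  keyᵈ : Dart segments → ℕ
  keyᵈ = [_,_] (λ e → x (upper e)) (λ e → m + (m ∸ x (lower e)))

  open Successor originᵈ keyᵈ public

  field
    next-Succ     : ∀ d → Succ d (nextᵈ d)

  out<into : ∀ e e′ → keyᵈ (out e) < keyᵈ (into e′)
  out<into e e′ = ℕ.<-≤-trans (x<m (upper e)) (ℕ.m≤m+n m _)

  into-mono : ∀ {e e′} → x (lower e) ≤ x (lower e′) → keyᵈ (into e′) ≤ keyᵈ (into e)
  into-mono p = ℕ.+-monoʳ-≤ m (ℕ.∸-monoʳ-≤ m p)

  into-cancel-< : ∀ {e e′} → keyᵈ (into e′) < keyᵈ (into e) → x (lower e) < x (lower e′)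
  into-cancel-< p = ℕ.≰⇒> λ q → ℕ.<⇒≱ p (into-mono q)

  into-strict : ∀ {e e′} → x (lower e) < x (lower e′) → keyᵈ (into e′) < keyᵈ (into e)
  into-strict {e} {e′} p = ℕ.+-monoʳ-< m (ℕ.∸-monoʳ-< p (ℕ.<⇒≤ (x<m (lower e′))))

  into-cancel-≤ : ∀ {e e′} → keyᵈ (into e′) ≤ keyᵈ (into e) → x (lower e) ≤ x (lower e′)
  into-cancel-≤ {e} {e′} p = ℕ.≮⇒≥ λ q → ℕ.<⇒≱ (into-strict {e′} {e} q) p

  key-injective : ∀ {d d′} → originᵈ d ≡ originᵈ d′ → keyᵈ d ≡ keyᵈ d′ → d ≡ d′
  key-injective {out e}  {out e′}  p q = cong out (edge-unique p (x-injective q))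
  key-injective {out e}  {into e′} p q = ⊥-elim (ℕ.<⇒≢ (out<into e e′) q)
  key-injective {into e} {out e′}  p q = ⊥-elim (ℕ.<⇒≢ (out<into e′ e) (sym q))
  key-injective {into e} {into e′} p q = cong into (edge-unique (x-injective
    (ℕ.≤-antisym (into-cancel-≤ {e} {e′} (ℕ.≤-reflexive (sym q)))
        (into-cancel-≤ {e′} {e} (ℕ.≤-reflexive q)))) p)

  next-determined : ∀ {d d′} → Succ d d′ → nextᵈ d ≡ d′
  next-determined {d} = Succ-functional key-injective {d} (next-Succ d)

module DominanceDarts {m : ℕ} (σ : Permutation′ m) where
  open Dominance σ

  x y : Fin m → ℕ
  x v = toℕ v
  y v = toℕ (σ ⟨$⟩ʳ v)

  x-injective : ∀ {u v} → x u ≡ x v → u ≡ v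
  x-injective = Fin.toℕ-injective

  y-injective : ∀ {u v} → y u ≡ y v → u ≡ v
  y-injective p = ⟨$⟩ʳ-injective σ (Fin.toℕ-injective p)

  open Points x y x-injective y-injective using (_≪_; Cover)

  ≺⇒≪ : ∀ {u v} → u ≺ v → u ≪ v
  ≺⇒≪ ((p , q) , ≢) = ℕ.≤∧≢⇒< p (≢ ∘ x-injective) , ℕ.≤∧≢⇒< q (≢ ∘ y-injective)

  ≪⇒≺ : ∀ {u v} → u ≪ v → u ≺ v
  ≪⇒≺ (p , q) = (ℕ.<⇒≤ p , ℕ.<⇒≤ q) , ℕ.<⇒≢ p ∘ cong x

  IsCoveredBy⇒Cover : ∀ {u v} → u IsCoveredBy v → Cover u v
  IsCoveredBy⇒Cover (p , f) = ≺⇒≪ p , λ k (q , r) → f k (≪⇒≺ q , ≪⇒≺ r)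

  Cover⇒IsCoveredBy : ∀ {u v} → Cover u v → u IsCoveredBy v
  Cover⇒IsCoveredBy (p , f) = ≪⇒≺ p , λ k (q , r) → f k (≺⇒≪ q , ≺⇒≪ r)

  originᵈ : Dart segments → Fin m
  originᵈ = [_,_] lower upper

  nextᵈ : Dart segments → Dart segments
  nextᵈ d = cyclicNext (clockwise (originᵈ d)) d

  edge-cover : ∀ e → lower e IsCoveredBy upper e
  edge-cover e = proj₂ (∈.∈-filter⁻ (λ (i , j) → i IsCoveredBy? j)
    {xs = cartesianProduct (allFin m) (allFin m)} (∈.∈-lookup e))

  cover-edge : ∀ {i j} → i IsCoveredBy j → ∃ λ e → lower e ≡ i × upper e ≡ j
  cover-edge {i} {j} c = index i,j∈ , cong proj₁ (sym (lookup-index i,j∈)) ,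
      cong proj₂ (sym (lookup-index i,j∈))
    where
    i,j∈ : (i , j) ∈ covers
    i,j∈ = ∈.∈-filter⁺ (λ (i , j) → i IsCoveredBy? j)
      (∈.∈-cartesianProduct⁺ (∈.∈-allFin i) (∈.∈-allFin j)) c

  private
    allFin-sorted : ∀ {k} → AllPairs (λ i j → toℕ i < toℕ j) (allFin k)
    allFin-sorted = AllPairs.tabulate⁺-< id

    sorted : ∀ {e e′} → toℕ e < toℕ e′ →
      toℕ (lower e) < toℕ (lower e′) ⊎ (lower e ≡ lower e′ × toℕ (upper e) < toℕ (upper e′))
    sorted = AllPairs-lookup (AllPairs.filter⁺ (λ (i , j) → i IsCoveredBy? j)
      (cartesianProduct-sorted {R = λ i j → toℕ i < toℕ j} {T = λ i j → toℕ i < toℕ j}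
          allFin-sorted allFin-sorted))

    edge-≮ : ∀ {e e′} → lower e ≡ lower e′ → upper e ≡ upper e′ → toℕ e ≮ toℕ e′
    edge-≮ p q l with sorted l
    ... | inj₁ r       = ℕ.<⇒≢ r (cong toℕ p)
    ... | inj₂ (_ , r) = ℕ.<⇒≢ r (cong toℕ q)

  edge-unique : ∀ {e e′} → lower e ≡ lower e′ → upper e ≡ upper e′ → e ≡ e′
  edge-unique p q = Fin.toℕ-injective
    (ℕ.≤-antisym (ℕ.≮⇒≥ (edge-≮ (sym p) (sym q))) (ℕ.≮⇒≥ (edge-≮ p q)))

  keyᵈ : Dart segments → ℕ
  keyᵈ = [_,_] (λ e → toℕ (upper e)) (λ e → m + (m ∸ toℕ (lower e)))

  clockwise-sorted : ∀ p → AllPairs (λ d d′ → keyᵈ d < keyᵈ d′) (clockwise p)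
  clockwise-sorted p = AllPairs.++⁺
    (AllPairs.map⁺ (AllPairs-refine outgoing-<
        (All.all-filter (λ e → lower e ≟ p) (allFin segments))
      (AllPairs.filter⁺ (λ e → lower e ≟ p) allFin-sorted)))
    (AllPairs.map⁺ (AllPairs-reverse
        (AllPairs-refine ingoing-< (All.all-filter (λ e → upper e ≟ p) (allFin segments))
      (AllPairs.filter⁺ (λ e → upper e ≟ p) allFin-sorted))))
    (All.map⁺ (All.tabulate λ {e} _ →
        All.map⁺ (All.tabulate λ _ → ℕ.<-≤-trans (Fin.toℕ<n (upper e)) (ℕ.m≤m+n m _))))
    where
    outgoing-< : ∀ {e e′} → lower e ≡ p → lower e′ ≡ p → toℕ e < toℕ e′ →
        toℕ (upper e) < toℕ (upper e′)
    outgoing-< q r l with sorted l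
    ... | inj₁ s       = ⊥-elim (ℕ.<⇒≢ s (cong toℕ (trans q (sym r))))
    ... | inj₂ (_ , s) = s
    ingoing-< : ∀ {e e′} → upper e ≡ p → upper e′ ≡ p → toℕ e < toℕ e′ →
      m + (m ∸ toℕ (lower e′)) < m + (m ∸ toℕ (lower e))
    ingoing-< {e} {e′} q r l with sorted l
    ... | inj₁ s       = ℕ.+-monoʳ-< m (ℕ.∸-monoʳ-< s (ℕ.<⇒≤ (Fin.toℕ<n (lower e′))))
    ... | inj₂ (_ , s) = ⊥-elim (ℕ.<⇒≢ s (cong toℕ (trans q (sym r))))

  open Successor originᵈ keyᵈ public

  next-Succ : ∀ d → Succ d (nextᵈ d)
  next-Succ d = subst (Succ d)
    (sym (cyclicNext-CyclicallyNext (clockwise-unique (originᵈ d)) (proj₂ c)))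
    (Equivalence.to (clockwise-complete (originᵈ d) _) (CyclicallyNext-∈ (proj₂ c)) ,
     Sum.map (λ (p , f) → p , λ c q → f (at c q)) (λ f c q → f (at c q))
       (CyclicallyNext-sorted keyᵈ (clockwise-sorted (originᵈ d)) (proj₂ c)))
    where
    at : ∀ c → originᵈ c ≡ originᵈ d → c ∈ clockwise (originᵈ d)
    at c = Equivalence.from (clockwise-complete (originᵈ d) c)
    c : ∃ (CyclicallyNext d (clockwise (originᵈ d)))
    c = cyclicallyNext (at d refl)

  diagram : CoverDiagram m
  diagram = record
    { x = x ; y = y ; x-injective = x-injective ; y-injective = y-injective ; x<m = Fin.toℕ<n
    ; segments = segments ; lower = lower ; upper = upper
    ; segment-cover = λ e → IsCoveredBy⇒Cover (edge-cover e)
    ; segment = λ c → cover-edge (Cover⇒IsCoveredBy c)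
    ; edge-unique = edge-unique ; nextᵈ = nextᵈ ; next-Succ = next-Succ
    }

lookup-∈-filter⁺ : {A : Set} {P : A → Set} (P? : ∀ a → Dec (P a)) {x : A} {xs : List A}
    (p : x ∈ xs) (q : P x) →
  lookup (filter P? xs) (index (∈.∈-filter⁺ P? p q)) ≡ x
lookup-∈-filter⁺ P? p q = sym (lookup-index (∈.∈-filter⁺ P? p q))

module _ {n : ℕ} (π : Permutation′ n) where
  open Dominance (completion π)

  root-segment : ∃ λ r → OrientedMap.root (dominanceMap π) ≡ out r × lookup covers r ≡
      (zero , suc zero)
  root-segment = _ , refl , lookup-∈-filter⁺ (λ (i , j) → i IsCoveredBy? j)
    (∈.∈-cartesianProduct⁺ (∈.∈-allFin zero) (∈.∈-allFin (suc zero))) _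

-- Labelled bipolar posets are dominance diagrams

module Isomorphism {m E : ℕ} (B : Bipolar m E) (D : CoverDiagram m) (X : Permutation′ m)
  (labels : Labels B (CoverDiagram.x D ∘ (X ⟨$⟩ʳ_)) (CoverDiagram.y D ∘ (X ⟨$⟩ʳ_))) where

  open Bipolar B
  open Chains B
  open Labels labels
  open CoverDiagram D renaming (x to xᵈ; y to yᵈ; x-injective to xᵈ-injective; y-injective to
      yᵈ-injective)

  private
    x y : Fin m → ℕ
    x v = xᵈ (X ⟨$⟩ʳ v)
    y v = yᵈ (X ⟨$⟩ʳ v)

    InAdj-x : ∀ {e e′} → InAdj e e′ → x (src e) < x (src e′)
    InAdj-x a = labels-x B (times B) labels (Order.InAdj-time B a)

    first-edge : ∀ {u v} → u ⊴ v → u ≢ v → ∃ λ e → src e ≡ u × tgt e ⊴ v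
    first-edge ε u≢v = ⊥-elim (u≢v refl)
    first-edge ((e , p , refl) ◅ s) _ = e , p , s

    at-vertex : ∀ {P : Fin m → Set} k → (∀ v → P (X ⟨$⟩ʳ v)) → P k
    at-vertex {P} k f = subst P (Perm.inverseʳ X) (f (X ⟨$⟩ˡ k))

    -- A point strictly between the ends would, by `above`, lie on a path from `src e` to `tgt e`
    -- that starts with another edge, so that `e` would be transitive.
    edge⇒cover : ∀ e → Cover (X ⟨$⟩ʳ src e) (X ⟨$⟩ʳ tgt e)
    edge⇒cover e = (edge-x e , edge-y e) , λ k → at-vertex k between
      where
      between : ∀ w → ¬ ((X ⟨$⟩ʳ src e) ≪ (X ⟨$⟩ʳ w) × (X ⟨$⟩ʳ w) ≪ (X ⟨$⟩ʳ tgt e))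
      between w ((p₁ , p₂) , (q₁ , q₂))
        with e′ , r , s ← first-edge (above p₁ p₂) (ℕ.<⇒≢ p₁ ∘ cong x) with e ≟ e′
      ... | yes refl = ℕ.<⇒≱ q₁ (⊴-x s)
      ... | no e≢e′  = not-transitive (sym r) e≢e′ (s ◅◅ above q₁ q₂)

    cover⇒edge : ∀ {u v} → Cover (X ⟨$⟩ʳ u) (X ⟨$⟩ʳ v) → ∃ λ e → src e ≡ u × tgt e ≡ v
    cover⇒edge {u} {v} ((p₁ , p₂) , between)
      with e , refl , s ← first-edge (above p₁ p₂) (ℕ.<⇒≢ p₁ ∘ cong x) =
      e , refl , decidable-stable (tgt e ≟ v) λ e≢v → between _
        ( (edge-x e , edge-y e)
        , (ℕ.≤∧≢⇒< (⊴-x s) (e≢v ∘ x-injective) , ℕ.≤∧≢⇒< (⊴-y s) (e≢v ∘ y-injective)))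

    endpoints-unique : ∀ {e e′} → src e ≡ src e′ → tgt e ≡ tgt e′ → e ≡ e′
    endpoints-unique {e} {e′} p q = decidable-stable (e ≟ e′) λ e≢e′ →
      not-transitive p e≢e′ (subst (tgt e′ ⊴_) (sym q) ε)

    to : ∀ e → ∃ λ s → lower s ≡ X ⟨$⟩ʳ src e × upper s ≡ X ⟨$⟩ʳ tgt e
    to e = segment (edge⇒cover e)

    from : ∀ s → ∃ λ e → src e ≡ X ⟨$⟩ˡ lower s × tgt e ≡ X ⟨$⟩ˡ upper s
    from s = cover⇒edge (subst₂ Cover (sym (Perm.inverseʳ X)) (sym (Perm.inverseʳ X))
        (segment-cover s))

  onEdges : Permutation E segments
  onEdges = Perm.permutation (proj₁ ∘ to) (proj₁ ∘ from)
    (λ s → let e , p , q = from s ; t , p′ , q′ = to e in edge-unique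
      (trans p′ (trans (cong (X ⟨$⟩ʳ_) p) (Perm.inverseʳ X)))
      (trans q′ (trans (cong (X ⟨$⟩ʳ_) q) (Perm.inverseʳ X))))
    (λ e → let s , p , q = to e ; e′ , p′ , q′ = from s in endpoints-unique
      (trans p′ (trans (cong (X ⟨$⟩ˡ_) p) (Perm.inverseˡ X)))
      (trans q′ (trans (cong (X ⟨$⟩ˡ_) q) (Perm.inverseˡ X))))

  src-comm : ∀ e → lower (onEdges ⟨$⟩ʳ e) ≡ X ⟨$⟩ʳ src e
  src-comm e = proj₁ (proj₂ (to e))

  tgt-comm : ∀ e → upper (onEdges ⟨$⟩ʳ e) ≡ X ⟨$⟩ʳ tgt e
  tgt-comm e = proj₂ (proj₂ (to e))

  onDarts : Dart E → Dart segments
  onDarts = Sum.map (onEdges ⟨$⟩ʳ_) (onEdges ⟨$⟩ʳ_)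

  origin-comm : ∀ d → originᵈ (onDarts d) ≡ X ⟨$⟩ʳ origin d
  origin-comm (out e)  = src-comm e
  origin-comm (into e) = tgt-comm e

  private
    key : Dart E → ℕ
    key d = keyᵈ (onDarts d)

    key-out : ∀ e → key (out e) ≡ x (tgt e)
    key-out e = cong xᵈ (tgt-comm e)

    key-into : ∀ e → key (into e) ≡ m + (m ∸ x (src e))
    key-into e = cong (λ v → m + (m ∸ xᵈ v)) (src-comm e)

    key-Next : ∀ {d d′} → Next d d′ → key d < key d′
    key-Next {out h} {out g} (p , ¬l) =
      subst₂ _<_ (sym (key-out h)) (sym (key-out g)) (OutAdj-x (p , λ q → ¬l (trans p q)))
    key-Next {out h} {into e} _ = out<into (onEdges ⟨$⟩ʳ h) (onEdges ⟨$⟩ʳ e)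
    key-Next {into e} {out g} (p , ¬l) = ⊥-elim (¬l (inj₁ (cong isOut p)))
    key-Next {into e′} {into e} (p , ¬l) = subst₂ _<_ (sym (key-into e′)) (sym (key-into e))
      (ℕ.+-monoʳ-< m (ℕ.∸-monoʳ-< (InAdj-x (p , λ q → ¬l (inj₂ q))) (ℕ.<⇒≤ (x<m (X ⟨$⟩ʳ src e′)))))

    key-Nexts : ∀ {d d′} → Star Next d d′ → key d ≤ key d′
    key-Nexts ε       = ℕ.≤-refl
    key-Nexts (p ◅ s) = ℕ.≤-trans (ℕ.<⇒≤ (key-Next p)) (key-Nexts s)

    onDarts-surjective : ∀ c → ∃ λ d → onDarts d ≡ c
    onDarts-surjective (out s)  = out (onEdges ⟨$⟩ˡ s) , cong out (Perm.inverseʳ onEdges)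
    onDarts-surjective (into s) = into (onEdges ⟨$⟩ˡ s) , cong into (Perm.inverseʳ onEdges)

    same-origin : ∀ {c d} → originᵈ (onDarts c) ≡ originᵈ (onDarts d) → origin c ≡ origin d
    same-origin {c} {d} p = ⟨$⟩ʳ-injective X (trans (sym (origin-comm c)) (trans p (origin-comm d)))

    -- Keys increase along the chain at a vertex. Away from its end, consecutive darts have adjacent
    -- keys; at its end, the passage from the last to the first dart is the passage from the
    -- greatest to the least key.
    Succ-onDarts : ∀ d → Succ (onDarts d) (onDarts (next d))
    Succ-onDarts d = trans (origin-comm (next d))
        (trans (cong (X ⟨$⟩ʳ_) (next-origin d)) (sym (origin-comm d))) ,
      adjacent (Last? d)
      where
      At : Dart segments → Set
      At c = originᵈ c ≡ originᵈ (onDarts d)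
      via : {P : Dart segments → Set} → (∀ c → origin c ≡ origin d → P (onDarts c)) → ∀ c →
          At c → P c
      via f c q with c , refl ← onDarts-surjective c = f c (same-origin {c} {d} q)
      adjacent : Dec (Last d) → Adjacent (onDarts d) (onDarts (next d)) At ⊎ Around (onDarts d)
          (onDarts (next d)) At
      adjacent (no ¬l) = inj₁ (key-Next {d} (refl , ¬l) , via between)
        where
        between : ∀ c → origin c ≡ origin d → ¬ (key d < key c × key c < key (next d))
        between c o (p , q) with Next-linear {c} {d} o
        ... | inj₁ s = ℕ.<⇒≱ p (key-Nexts s)
        ... | inj₂ ε = ℕ.<-irrefl refl p
        ... | inj₂ ((refl , _) ◅ s) = ℕ.<⇒≱ q (key-Nexts s)
      adjacent (yes l) = inj₂ (via λ c o →
        key-Nexts (subst (Star Next c) (sym (Last⇒≡last l (sym o))) (to-last c)) ,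
        key-Nexts (subst (λ d → Star Next d c) (sym (first-Last l (sym o))) (from-first c)))

  next-comm : ∀ d → nextᵈ (onDarts d) ≡ onDarts (next d)
  next-comm d = next-determined (Succ-onDarts d)

  root-comm : ∀ r → xᵈ (lower r) ≡ 0 → xᵈ (upper r) ≡ 1 → x S ≡ 0 → out r ≡ onDarts root
  root-comm r r₀ r₁ S₀ = key-injective
    (xᵈ-injective (trans r₀ (sym (trans
        (cong xᵈ (trans (origin-comm root) (cong (X ⟨$⟩ʳ_) root-origin))) S₀))))
    -- The key of `out r` is 1, and the root, being outgoing, has a key of at least 1. Conversely
    -- the root is first in the chain at `S` and so has the least key there.
    (ℕ.≤-antisym (ℕ.≤-trans (ℕ.≤-reflexive r₁) key-root) root-key)
    where
    key-root : 1 ≤ key root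
    key-root with g , p ← isOut-true root root-out =
      subst (λ d → 1 ≤ key d) (sym p) (subst (1 ≤_) (sym (key-out g)) (ℕ.≤-<-trans z≤n (edge-x g)))
    root-key : key root ≤ keyᵈ (out r)
    root-key = let e , p = onDarts-surjective (out r) in
      subst (λ d → key root ≤ keyᵈ d) p
          (key-Nexts (subst (λ d → Star Next d e) (first-e e p) (from-first e)))
      where
      first-e : ∀ e → onDarts e ≡ out r → first (origin e) ≡ root
      first-e e p = trans (cong first (⟨$⟩ʳ-injective X (xᵈ-injective (trans
        (cong xᵈ (trans (sym (origin-comm e)) (cong originᵈ p))) (trans r₀ (sym S₀)))))) first-S

-- Faces of a diagram without crossings

module Faces {m : ℕ} (D : CoverDiagram m) where
  open CoverDiagram D

  module Mirror = Points y x y-injective x-injective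

  Segment-unique : ∀ {u v e e′} → Segment u v e → Segment u v e′ → e ≡ e′
  Segment-unique (p , q) (p′ , q′) = edge-unique (trans p (sym p′)) (trans q (sym q′))

  mirror-cover : ∀ {u v} → Cover u v → Mirror.Cover u v
  mirror-cover ((p , q) , f) = (q , p) , λ k ((a , b) , (c , d)) → f k ((b , a) , (d , c))

  unmirror-cover : ∀ {u v} → Mirror.Cover u v → Cover u v
  unmirror-cover ((p , q) , f) = (q , p) , λ k ((a , b) , (c , d)) → f k ((b , a) , (d , c))

  covers-antitone : ∀ {u v w} → Cover u w → Cover v w → x u ≤ x v → y v ≤ y u
  covers-antitone {u} {v} (p , f) (q , g) r with ℕ.m≤n⇒m<n∨m≡n r
  ... | inj₁ u<v = ℕ.≮⇒≥ λ l → f v ((u<v , l) , q)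
  ... | inj₂ u≡v with refl ← x-injective u≡v = ℕ.≤-refl

  covered-antitone : ∀ {u v w} → Cover w u → Cover w v → y u ≤ y v → x v ≤ x u
  covered-antitone {u} {v} (p , f) (q , g) r with ℕ.m≤n⇒m<n∨m≡n r
  ... | inj₁ u<v = ℕ.≮⇒≥ λ l → g u (p , l , u<v)
  ... | inj₂ u≡v with refl ← y-injective u≡v = ℕ.≤-refl

  below-lower : ∀ {z} e → upper e ≡ z → lower e ≪ z
  below-lower e refl = proj₁ (segment-cover e)

  above-upper : ∀ {z} e → lower e ≡ z → z ≪ upper e
  above-upper e refl = proj₁ (segment-cover e)

  next-RTurn : ∀ {r z z⁺ e p} → Segment z z⁺ e → Segment r z p → (∀ c → z ≪ c → y z⁺ ≤ y c) →
    RightmostIn r z → nextᵈ (out e) ≡ into p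
  next-RTurn {e = e} {p} (refl , refl) (refl , q) min (_ , max) =
    next-determined (q , inj₁ (out<into e p , between))
    where
    between : ∀ c → originᵈ c ≡ lower e → ¬ (keyᵈ (out e) < keyᵈ c × keyᵈ c < keyᵈ (into p))
    between (out g)  o (l , _) =
      ℕ.<⇒≱ l (covered-antitone (segment-cover e)
          (subst (λ v → Cover v (upper g)) o (segment-cover g))
        (min (upper g) (above-upper g o)))
    between (into g) o (_ , l) = ℕ.<⇒≱ (into-cancel-< {p} {g} l) (max (lower g) (below-lower g o))

  next-LTurn : ∀ {l z z⁺ e p} → Segment z z⁺ e → Segment l z p → (∀ c → z ≪ c → x z⁺ ≤ x c) →
    (∀ c → c ≪ z → y c ≤ y l) → nextᵈ (into p) ≡ out e
  next-LTurn {e = e} {p} (refl , refl) (refl , q) min max = next-determined (sym q , inj₂ around)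
    where
    around : ∀ c → originᵈ c ≡ upper p → keyᵈ c ≤ keyᵈ (into p) × keyᵈ (out e) ≤ keyᵈ c
    around (out g)  o = ℕ.<⇒≤ (out<into g p) , min (upper g) (above-upper g (trans o q))
    around (into g) o = into-mono {p} {g}
      (ℕ.≮⇒≥ λ l → ℕ.<⇒≱ (covers-strict l) (max (lower g) (below-lower g (trans o q)))) ,
      ℕ.<⇒≤ (out<into e g)
      where
      covers-strict : x (lower g) < x (lower p) → y (lower p) < y (lower g)
      covers-strict l = ℕ.≤∧≢⇒< (covers-antitone (segment-cover g)
        (subst (Cover (lower p)) (sym o) (segment-cover p)) (ℕ.<⇒≤ l))
        (λ eq → ℕ.<⇒≢ l (cong x (sym (y-injective eq))))

  next-out : ∀ {z u v e g} → Segment z u e → Segment z v g → x u < x v →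
    (∀ c → Cover z c → x u < x c → x c < x v → ⊥) → nextᵈ (out e) ≡ out g
  next-out {e = e} {g} (refl , refl) (q , refl) u<v none =
      next-determined (q , inj₁ (u<v , between))
    where
    between : ∀ c → originᵈ c ≡ lower e → ¬ (keyᵈ (out e) < keyᵈ c × keyᵈ c < keyᵈ (out g))
    between (out k)  o (l , l′) = none (upper k)
        (subst (λ v → Cover v (upper k)) o (segment-cover k)) l l′
    between (into k) o (_ , l)  = ℕ.<-asym l (out<into g k)

  next-around : ∀ {s u v e g} → (∀ w → s ⊑ w) → Segment s u e → Segment s v g →
    (∀ c → s ≪ c → y u ≤ y c) → (∀ c → s ≪ c → x v ≤ x c) → nextᵈ (out e) ≡ out g
  next-around {e = e} {g} s⊑ (refl , refl) (q , refl) maxₓ minₓ = next-determined (q , inj₂ around)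
    where
    around : ∀ c → originᵈ c ≡ lower e → keyᵈ c ≤ keyᵈ (out e) × keyᵈ (out g) ≤ keyᵈ c
    around (out k)  o = covered-antitone (segment-cover e)
        (subst (λ v → Cover v (upper k)) o (segment-cover k))
      (maxₓ (upper k) (above-upper k o)) , minₓ (upper k) (above-upper k o)
    around (into k) o = ⊥-elim (ℕ.<⇒≱ (proj₁ (below-lower k o)) (⊑-x (s⊑ (lower k))))

  Top : Fin segments → Set
  Top e = isOut (nextᵈ (into e)) ≡ false

  faceNextᵈ : Dart segments → Dart segments
  faceNextᵈ d = nextᵈ (swap d)

  -- The face of a dart is labelled by the top edge of its right boundary.
  data Label : Dart segments → Fin segments → Set where
    peak : ∀ {e} → Top e → Label (out e) e
    up   : ∀ {e k} → isOut (nextᵈ (into e)) ≡ true → Label (nextᵈ (into e)) k → Label (out e) k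
    down : ∀ {e k} → Label (nextᵈ (out e)) k → Label (into e) k

  Label-functional : ∀ {d k k′} → Label d k → Label d k′ → k ≡ k′
  Label-functional (peak _) (peak _)    = refl
  Label-functional (peak p)  (up q _)   = case trans (sym p) q of λ ()
  Label-functional (up p _) (peak q)    = case trans (sym p) q of λ ()
  Label-functional (up _ l) (up _ l′)  = Label-functional l l′
  Label-functional (down l) (down l′)  = Label-functional l l′

  Label-path : ∀ {d k} → Label d k → Star (Step faceNextᵈ) d (out k)
  Label-path (peak _)  = ε
  Label-path (up _ l) = refl ◅ Label-path l
  Label-path (down l) = refl ◅ Label-path l

  module _ (nc : NoCrossing) {s t : Fin m} (s⊑ : ∀ v → s ⊑ v) (⊑t : ∀ v → v ⊑ t) where

    private
      nc′ : Mirror.NoCrossing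
      nc′ = NoCrossing-mirror x y x-injective y-injective nc

      mirror-⊑ : ∀ {u v} → u ⊑ v → Mirror._⊑_ u v
      mirror-⊑ (inj₁ p)       = inj₁ p
      mirror-⊑ (inj₂ (p , q)) = inj₂ (q , p)

      flip-≪ : ∀ {u v} → u ≪ v → Mirror._≪_ u v
      flip-≪ (p , q) = q , p

      LabelOut LabelInto : Fin segments → Rel (Fin m) 0ℓ
      LabelOut  k u v = ∀ e → Segment u v e → Label (out e) k
      LabelInto k u v = (∀ e → Segment u v e → Label (into e) k)

      up-LTurn : ∀ {k l z z⁺} → Mirror.RightmostIn l z → Mirror.Cover z z⁺ →
        (∀ c → Mirror._≪_ z c → x z⁺ ≤ x c) → LabelOut k z z⁺ → LabelOut k l z
      up-LTurn {k} (_ , max) z⋖z⁺ min label p P with e , E ← segment (unmirror-cover z⋖z⁺) =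
        up (cong isOut turn) (subst (λ d → Label d k) (sym turn) (label e E))
        where turn = next-LTurn E P (λ c → min c ∘ flip-≪) (λ c → max c ∘ flip-≪)

      down-RTurn : ∀ {k r z z⁺} → RightmostIn r z → Cover z z⁺ → (∀ c → z ≪ c → y z⁺ ≤ y c) →
        LabelInto k r z → LabelInto k z z⁺
      down-RTurn {k} ρ z⋖z⁺ min label e E with p , P ← segment (proj₁ ρ) =
        down (subst (λ d → Label d k) (sym (next-RTurn E P min ρ)) (label p P))

      module Inner {e e′ : Fin segments} (e-e′ : upper e ≡ upper e′)
          (a<b : x (lower e) < x (lower e′))
        (neighbours : ∀ {c} → Cover c (upper e′) → x (lower e) < x c → x c < x (lower e′) → ⊥)
        (e′-top : Top e′) where

        v = upper e′
        a = lower e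
        b = lower e′

        a⋖v : Cover a v
        a⋖v = subst (Cover a) e-e′ (segment-cover e)

        b⋖v : Cover b v
        b⋖v = segment-cover e′

        b<ᵧa : y b < y a
        b<ᵧa = ℕ.≤∧≢⇒< (covers-antitone a⋖v b⋖v (ℕ.<⇒≤ a<b))
          (λ p → ℕ.<⇒≢ a<b (cong x (y-injective (sym p))))

        neighbours′ : ∀ {c} → Mirror.Cover c v → y b < y c → y c < y a → ⊥
        neighbours′ {c} c⋖v b<c c<a = neighbours (unmirror-cover c⋖v)
          (ℕ.≰⇒> λ p → ℕ.<⇒≱ c<a (covers-antitone (unmirror-cover c⋖v) a⋖v p))
          (ℕ.≰⇒> λ p → ℕ.<⇒≱ b<c (covers-antitone b⋖v (unmirror-cover c⋖v) p))

        module L = LeftPath nc a⋖v b⋖v a<b neighbours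
        module R = Mirror.LeftPath nc′ (mirror-cover b⋖v) (mirror-cover a⋖v) b<ᵧa neighbours′

        module _ {z z⁺ w w⁺} (β : L.Bottom z z⁺) (γ : R.Bottom w w⁺) where
          private
            module β = L.Bottom β
            module γ = R.Bottom γ

          w≪b : w ≪ b
          w≪b = ℕ.<-≤-trans (proj₂ (proj₁ γ.cover)) (Mirror.⊑-y γ.below-a) ,
                ℕ.<-≤-trans (proj₁ (proj₁ γ.cover)) (Mirror.⊑-x γ.below-a)

          z≪a : z ≪ a
          z≪a = ≪-⊑ (proj₁ β.cover) β.below-a

          -- Among the common lower bounds of `a` and `b`, `z` is rightmost and `w` is highest. If
          -- they were distinct, the pair `w ≪ b` would cross the segment from `z` to `z⁺`.
          meet : z ≡ w
          meet with ℕ.m≤n⇒m<n∨m≡n (L.bottom-x≤ β (proj₂ γ.below-b , proj₁ γ.below-b) w≪b)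
                  | ℕ.m≤n⇒m<n∨m≡n (R.bottom-x≤ γ (flip-≪ β.below-b) (flip-≪ z≪a))
          ... | inj₂ p | _      = x-injective (sym p)
          ... | inj₁ _ | inj₂ q = y-injective q
          ... | inj₁ p | inj₁ q = ⊥-elim
            (nc β.cover p (ℕ.≤-<-trans (⊑-x β.below-a) a<b) q (proj₂ w≪b) β.not-below-b)

          bottom-order : x z⁺ < x w⁺
          bottom-order = ℕ.≤-<-trans (⊑-x β.below-a) γ.not-below-b

          bottom-neighbours : ∀ c → Cover z c → x z⁺ < x c → x c < x w⁺ → ⊥
          bottom-neighbours c z⋖c z⁺<c c<w⁺ = L.gap
            ( ℕ.<-trans c<w⁺ (ℕ.≤-<-trans (Mirror.⊑-y γ.below-a) (proj₁ (proj₁ b⋖v)))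
            , ℕ.<-trans c<ᵧz⁺ (ℕ.≤-<-trans (⊑-y β.below-a) (proj₂ (proj₁ a⋖v))))
            (β.clear⁺ c c<ᵧz⁺ z⁺<c) (γ.clear⁺ c c<w⁺ w⁺<ᵧc)
            where
            c<ᵧz⁺ : y c < y z⁺
            c<ᵧz⁺ = ℕ.≰⇒> λ p → ℕ.<⇒≱ z⁺<c (covered-antitone β.cover z⋖c p)
            w⁺<ᵧc : y w⁺ < y c
            w⁺<ᵧc = ℕ.≰⇒> λ p → ℕ.<⇒≱ c<w⁺
              (covered-antitone z⋖c (subst (λ w → Cover w w⁺) (sym meet)
                  (unmirror-cover γ.cover)) p)

        -- On the right side the label is handed down from the top edge `e′`. On the left side it
        -- has to rise from the bottom to `e`, against the direction of the descent, which therefore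
        -- carries an implication and is completed once the two bottoms have met.
        inner-closing : Label (into e) e′
        inner-closing = finish
          (L.descent s s⊑ (λ z z⁺ → LabelInto e′ z z⁺ → Label (into e) e′) (λ f → f e (refl , e-e′))
            (λ ρ z⋖z⁺ min q label → q (down-RTurn ρ z⋖z⁺ min label)))
          (R.descent s (mirror-⊑ ∘ s⊑) (LabelOut e′)
            (λ p P → subst (λ p → Label (out p) e′) (Segment-unique (refl , refl) P)
                (peak e′-top)) up-LTurn)
          where
          finish : (∃ λ z → ∃ λ z⁺ → L.Bottom z z⁺ × (LabelInto e′ z z⁺ → Label (into e) e′)) →
            (∃ λ w → ∃ λ w⁺ → R.Bottom w w⁺ × LabelOut e′ w w⁺) → Label (into e) e′
          finish (z , z⁺ , β , f) (w , w⁺ , γ , label) with g ,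
              G ← segment (unmirror-cover (R.Bottom.cover γ)) =
            f λ p P → down (subst (λ d → Label d e′)
              (sym (next-out P (trans (proj₁ G) (sym (meet β γ)) , proj₂ G) (bottom-order β γ)
                  (bottom-neighbours β γ)))
              (label g G))

      top-sink : ∀ {g} → lower g ≢ t
      top-sink {g} refl = ℕ.<⇒≱ (proj₁ (proj₁ (segment-cover g))) (⊑-x (⊑t (upper g)))

      outer-right : ∀ {e′} → upper e′ ≡ t → (∀ c → c ≪ t → y c ≤ y (lower e′)) → Top e′ →
        ∃ λ w → Cover s w × (∀ c → s ≪ c → x w ≤ x c) × LabelOut e′ s w
      outer-right {e′} refl max e′-top
        with w , s⋖w , min , label ← Mirror.outer-descent (mirror-⊑ ∘ s⊑) (mirror-⊑ ∘ ⊑t)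
          (mirror-cover (segment-cover e′) , λ c → max c ∘ λ (p , q) → q , p) (LabelOut e′)
          (λ p P → subst (λ p → Label (out p) e′) (Segment-unique (refl , refl) P) (peak e′-top))
              up-LTurn =
        w , unmirror-cover s⋖w , (λ c → min c ∘ flip-≪) , label

      outer-closing : ∀ {e e′} → upper e ≡ t → upper e′ ≡ t → (∀ c → c ≪ t → x c ≤ x (lower e)) →
        (∀ c → c ≪ t → y c ≤ y (lower e′)) → Top e′ → Label (into e) e′
      outer-closing {e} {e′} refl e′-t maxₓ maxᵧ e′-top
        with w , s⋖w , min , label ← outer-right e′-t maxᵧ e′-top
        with g , G ← segment s⋖w
        with z , s⋖z , minᵧ , f ← outer-descent s⊑ ⊑t (segment-cover e , maxₓ)
          (λ z z⁺ → LabelInto e′ z z⁺ → Label (into e) e′) (λ f → f e (refl , refl))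
          (λ ρ z⋖z⁺ min q label → q (down-RTurn ρ z⋖z⁺ min label)) =
        f λ p P → down (subst (λ d → Label d e′) (sym (next-around s⊑ P G minᵧ min)) (label g G))

    -- Passing the top corner is the only step around a face that does not keep the label by
    -- definition. Adjacent keys give an inner face; a return from the greatest key to the least
    -- happens at a vertex without outgoing darts, which is `t`, and gives the outer face.
    closing : ∀ {e e′} → nextᵈ (into e′) ≡ into e → Label (into e) e′
    closing {e} {e′} p = go (subst (Succ (into e′)) p (next-Succ (into e′)))
      where
      e′-top : Top e′
      e′-top = cong isOut p
      go : Succ (into e′) (into e) → Label (into e) e′
      go (o , inj₁ (l , between)) = Inner.inner-closing o (into-cancel-< {e} {e′} l)
        (λ {c} c⋖v a<c c<b → case segment c⋖v of λ
          { (g , refl , q) → between (into g) q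
              (into-strict {g} {e′} c<b , into-strict {e} {g} a<c) })
        e′-top
      go (o , inj₂ around) = outer-closing (trans o e′-t) e′-t maxₓ maxᵧ e′-top
        where
        e′-t : upper e′ ≡ t
        e′-t with ⊑t (upper e′)
        ... | inj₁ q = q
        ... | inj₂ q with k , v⋖k , _ ← upper-cover q with g , G , _ ← segment v⋖k =
          ⊥-elim (ℕ.<⇒≱ (out<into g e) (proj₂ (around (out g) G)))
        maxₓ : ∀ c → c ≪ t → x c ≤ x (lower e)
        maxₓ c c≪t with k , k⋖t , c⊑k ← lower-cover c≪t with g , refl , G ← segment k⋖t =
          ℕ.≤-trans (⊑-x c⊑k) (into-cancel-≤ {g} {e} (proj₂ (around (into g) (trans G (sym e′-t)))))
        maxᵧ : ∀ c → c ≪ t → y c ≤ y (lower e′)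
        maxᵧ c c≪t with k , k⋖t , c⊑k ← lower-cover c≪t with g , refl , G ← segment k⋖t =
          ℕ.≤-trans (⊑-y c⊑k) (covers-antitone (subst (Cover (lower e′)) e′-t (segment-cover e′))
              k⋖t
            (into-cancel-≤ {e′} {g} (proj₁ (around (into g) (trans G (sym e′-t))))))

    label : ∀ d → ∃ (Label d)
    label = go
      where
      rise : ∀ e → Acc (λ v u → x u < x v) (upper e) → ∃ (Label (out e))
      rise e (acc rs) with nextᵈ (into e) in eq
      ... | into _ = e , peak (cong isOut eq)
      ... | out g  = k , up (cong isOut eq) (subst (λ d → Label d k) (sym eq) (proj₂ above))
        where
        g-src : lower g ≡ upper e
        g-src = trans (sym (cong originᵈ eq)) (proj₁ (next-Succ (into e)))
        above : ∃ (Label (out g))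
        above = rise g (rs (subst (λ v → x v < x (upper g)) g-src
            (proj₁ (proj₁ (segment-cover g)))))
        k = proj₁ above
      fall : ∀ e → Acc (λ u v → x u < x v) (lower e) → ∃ (Label (into e))
      fall e (acc rs) with nextᵈ (out e) in eq
      ... | out g  = let k , l = rise g (above-wellFounded x _) in
        k , down (subst (λ d → Label d k) (sym eq) l)
      ... | into p = k , down (subst (λ d → Label d k) (sym eq) (proj₂ below))
        where
        p-tgt : upper p ≡ lower e
        p-tgt = trans (sym (cong originᵈ eq)) (proj₁ (next-Succ (out e)))
        below : ∃ (Label (into p))
        below = fall p (rs (subst (λ v → x (lower p) < x v) p-tgt
            (proj₁ (proj₁ (segment-cover p)))))
        k = proj₁ below
      go : ∀ d → ∃ (Label d)
      go (out e)  = rise e (above-wellFounded x _)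
      go (into e) = fall e (below-wellFounded x _)

    Label-faceNext : ∀ {d k} → Label d k → Label (faceNextᵈ d) k
    Label-faceNext (up _ l) = l
    Label-faceNext (down l) = l
    Label-faceNext (peak {e} p) with e′ , q ← isOut-false _ p =
      subst (λ d → Label d e) (sym q) (closing q)

    Label-SameFace : ∀ {d d′ k} → Star (Step faceNextᵈ) d d′ → Label d k → Label d′ k
    Label-SameFace ε          l = l
    Label-SameFace (refl ◅ s) l = Label-SameFace s (Label-faceNext l)

    root-label : ∀ {r} → lower r ≡ s → (∀ c → s ≪ c → x (upper r) ≤ x c) → s ≪ t →
      ∃ λ k → ∃ λ e → upper k ≡ t × nextᵈ (into k) ≡ into e × Label (out r) k
    root-label {r} refl min s≪t
      with b , b⋖t , max ← Mirror.rightmost-in (flip-≪ s≪t)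
      with k , refl , refl ← segment (unmirror-cover b⋖t)
      with nextᵈ (into k) in eq
    ... | out g = ⊥-elim (top-sink (trans (sym (cong originᵈ eq)) (proj₁ (next-Succ (into k)))))
    ... | into e with w , s⋖w , min′ ,
        label ← outer-right {k} refl (λ c → max c ∘ flip-≪) (cong isOut eq) =
      k , e , refl , eq , label r (refl , x-injective
        (ℕ.≤-antisym (min w (proj₁ s⋖w)) (min′ (upper r) (above-upper r refl))))

-- Planarity of the dominance diagram

-- Each letter of an occurrence has another one to its left or below it, and another one to its
-- right or above it. So none of the four is an added point.
completion-plane : ∀ {n} (π : Permutation′ n) → Plane π → Plane (completion π)
completion-plane {n} π plane (i , j , j⁺ , k , i<j , j⁺≡1+j , j⁺<k , j<ᵧi , i<ᵧk , k<ᵧj⁺) =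
  go (position-view i) (position-view j) (position-view j⁺) (position-view k) refl refl refl refl
  where
  σ = completion π
  not-top : ∀ {u v : Fin (2 + n)} → toℕ u < toℕ v → u ≢ top
  not-top {v = v} p refl = ℕ.<⇒≱ p (subst (toℕ v ≤_) (sym toℕ-top) (ℕ.≤-pred (Fin.toℕ<n v)))
  not-zero : ∀ {u v : Fin (2 + n)} → toℕ u < toℕ v → v ≢ zero
  not-zero p refl with () ← p
  σ-zero : ∀ {u v} → toℕ (σ ⟨$⟩ʳ u) < toℕ (σ ⟨$⟩ʳ v) → v ≢ zero
  σ-zero p refl = not-zero p (completion-zero π)
  σ-top : ∀ {u v} → toℕ (σ ⟨$⟩ʳ u) < toℕ (σ ⟨$⟩ʳ v) → u ≢ top
  σ-top p refl = not-top p (completion-top π)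
  x-cancel : ∀ {a b} → toℕ (interior a) < toℕ (interior b) → toℕ a < toℕ b
  x-cancel {a} {b} p = ℕ.≤-pred (subst₂ _<_ (toℕ-interior a) (toℕ-interior b) p)
  y-cancel : ∀ {a b} → toℕ (σ ⟨$⟩ʳ interior a) < toℕ (σ ⟨$⟩ʳ interior b) →
    toℕ (π ⟨$⟩ʳ a) < toℕ (π ⟨$⟩ʳ b)
  y-cancel {a} {b} p = x-cancel (subst₂ _<_ (cong toℕ (completion-interior π a))
      (cong toℕ (completion-interior π b)) p)
  go : ∀ {i′ j′ j⁺′ k′} → Position i′ → Position j′ → Position j⁺′ → Position k′ →
    i ≡ i′ → j ≡ j′ → j⁺ ≡ j⁺′ → k ≡ k′ → ⊥
  go (isInterior a) (isInterior b) (isInterior c) (isInterior d) refl refl refl refl =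
    plane (a , b , c , d , x-cancel i<j ,
      ℕ.suc-injective (trans (sym (toℕ-interior c)) (trans j⁺≡1+j (cong suc (toℕ-interior b)))) ,
      x-cancel j⁺<k , y-cancel j<ᵧi , y-cancel i<ᵧk , y-cancel k<ᵧj⁺)
  go isZero _ _ _ p _ _ _ = σ-zero {j} {i} j<ᵧi p
  go isTop  _ _ _ p _ _ _ = not-top i<j p
  go _ isZero _ _ _ p _ _ = not-zero i<j p
  go _ isTop  _ _ _ p _ _ = not-top (ℕ.≤-reflexive (sym j⁺≡1+j)) p
  go _ _ isZero _ _ _ p _ = σ-zero {k} {j⁺} k<ᵧj⁺ p
  go _ _ isTop  _ _ _ p _ = not-top j⁺<k p
  go _ _ _ isZero _ _ _ p = not-zero j⁺<k p
  go _ _ _ isTop  _ _ _ p = σ-top {k} {j⁺} k<ᵧj⁺ p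

module _ {m : ℕ} (σ : Permutation′ m) where
  open CoverDiagram (DominanceDarts.diagram σ)

  -- Along the points from b to c, the ordinate jumps at some step from below
  -- that of a to above that of d.
  plane⇒noCrossing : Plane σ → NoCrossing
  plane⇒noCrossing plane {a} {b} {c} {d} (b≪c , b⋖c) a<b c<d b<a a<d d<c =
    go (toℕ c ∸ toℕ b) b (ℕ.m+[n∸m]≡n (ℕ.<⇒≤ (proj₁ b≪c))) ℕ.≤-refl ℕ.≤-refl
    where
    go : ∀ k p → toℕ p + k ≡ toℕ c → x b ≤ x p → y p ≤ y b → ⊥
    go zero p eq _ p≤b with refl ← x-injective {p} {c} (trans (sym (ℕ.+-identityʳ _)) eq) =
      ℕ.<⇒≱ (proj₂ b≪c) p≤b
    go (suc k) p eq b≤p p≤b = step (ℕ.≤-<-connex (y q) (y b))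
      where
      1+p≤c : suc (toℕ p) ≤ toℕ c
      1+p≤c = subst (suc (toℕ p) ≤_) (trans (sym (ℕ.+-suc (toℕ p) k)) eq) (ℕ.m≤m+n (suc (toℕ p)) k)
      q : Fin m
      q = fromℕ< (ℕ.≤-<-trans 1+p≤c (Fin.toℕ<n c))
      q≡1+p : toℕ q ≡ suc (toℕ p)
      q≡1+p = Fin.toℕ-fromℕ< _
      q≤c : toℕ q ≤ toℕ c
      q≤c = subst (_≤ toℕ c) (sym q≡1+p) 1+p≤c
      b<q : toℕ b < toℕ q
      b<q = subst (toℕ b <_) (sym q≡1+p) (s≤s b≤p)
      step : y q ≤ y b ⊎ y b < y q → ⊥
      step (inj₁ q≤b) = go k q (trans (cong (_+ k) q≡1+p) (trans (sym (ℕ.+-suc (toℕ p) k)) eq))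
          (ℕ.<⇒≤ b<q) q≤b
      step (inj₂ b<ᵧq) = plane (a , p , q , d , ℕ.<-≤-trans a<b b≤p , q≡1+p , ℕ.≤-<-trans q≤c c<d ,
        ℕ.≤-<-trans p≤b b<a , a<d , ℕ.<-≤-trans d<c c≤q)
        where
        -- As `q` is to the upper right of `b` and not right of `c`, it would otherwise separate `b`
        -- from its cover `c`.
        c≤q : y c ≤ y q
        c≤q with ℕ.m≤n⇒m<n∨m≡n q≤c
        ... | inj₁ q<c = ℕ.≮⇒≥ λ q<ᵧc → b⋖c q ((b<q , b<ᵧq) , q<c , q<ᵧc)
        ... | inj₂ q≡c = ℕ.≤-reflexive (cong y (x-injective (sym q≡c)))

relation-≤ : ∀ {a b c d} (R : Fin a ⊎ Fin b → Fin c ⊎ Fin d → Set) →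
  (∀ i → ∃ (R i)) → (∀ {i j y} → R i y → R j y → i ≡ j) → a + b ≤ c + d
relation-≤ {a} {b} {c} {d} R total inj = Fin.injective⇒≤ {f = f} f-inj
  where
  f : Fin (a + b) → Fin (c + d)
  f i = join c d (proj₁ (total (splitAt a i)))
  f-inj : ∀ {i j} → f i ≡ f j → i ≡ j
  f-inj {i} {j} p = trans (sym (Fin.join-splitAt a b i))
      (trans (cong (join a b) same) (Fin.join-splitAt a b j))
    where
    images : proj₁ (total (splitAt a i)) ≡ proj₁ (total (splitAt a j))
    images = trans (sym (Fin.splitAt-join c d _))
        (trans (cong (splitAt c) p) (Fin.splitAt-join c d _))
    same : splitAt a i ≡ splitAt a j
    same = inj (proj₂ (total (splitAt a i)))
        (subst (R (splitAt a j)) (sym images) (proj₂ (total (splitAt a j))))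

module DiagramPlanarity {m : ℕ} (D : CoverDiagram m) (nc : CoverDiagram.NoCrossing D) {s t : Fin m}
  (s⊑ : ∀ v → CoverDiagram._⊑_ D s v) (⊑t : ∀ v → CoverDiagram._⊑_ D v t) (s≢t : s ≢ t) where
  open CoverDiagram D
  open Faces D

  Top? : ∀ e → Dec (Top e)
  Top? e = isOut (nextᵈ (into e)) Bool.≟ false

  tops : List (Fin segments)
  tops = filter Top? (allFin segments)

  faces : ℕ
  faces = length tops

  private
    lab : Dart segments → Fin segments
    lab d = proj₁ (label nc s⊑ ⊑t d)

    lab-Label : ∀ d → Label d (lab d)
    lab-Label d = proj₂ (label nc s⊑ ⊑t d)

    Label-Top : ∀ {d k} → Label d k → Top k
    Label-Top (peak p) = p
    Label-Top (up _ l) = Label-Top l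
    Label-Top (down l) = Label-Top l

    lab∈ : ∀ d → lab d ∈ tops
    lab∈ d = ∈.∈-filter⁺ Top? (∈.∈-allFin (lab d)) (Label-Top (lab-Label d))

    lookup-injective : ∀ {i j} → lookup tops i ≡ lookup tops j → i ≡ j
    lookup-injective {i} {j} p with ℕ.<-cmp (toℕ i) (toℕ j)
    ... | tri< q _ _ = ⊥-elim (AllPairs-lookup (Unique.filter⁺ Top? (Unique.allFin⁺ segments)) q p)
    ... | tri≈ _ q _ = Fin.toℕ-injective q
    ... | tri> _ _ q = ⊥-elim (AllPairs-lookup (Unique.filter⁺ Top? (Unique.allFin⁺ segments)) q
        (sym p))

    lookup-Top : ∀ f → Top (lookup tops f)
    lookup-Top f = proj₂ (∈.∈-filter⁻ Top? {xs = allFin segments} (∈.∈-lookup f))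

  face : Dart segments → Fin faces
  face d = index (lab∈ d)

  private
    lookup-face : ∀ d → lookup tops (face d) ≡ lab d
    lookup-face d = sym (lookup-index (lab∈ d))

    face-Label : ∀ {d f} → Label d (lookup tops f) → face d ≡ f
    face-Label {d} l = lookup-injective (trans (lookup-face d) (Label-functional (lab-Label d) l))

  face-surjective : ∀ f → ∃ λ d → ∀ {d′} → d′ ≡ d → face d′ ≡ f
  face-surjective f = out (lookup tops f) , λ { refl → face-Label (peak (lookup-Top f)) }

  SameFace⇒face : ∀ {d d′} → Star (Step faceNextᵈ) d d′ → face d ≡ face d′
  SameFace⇒face {d} {d′} s = sym (face-Label (subst (Label d′) (sym (lookup-face d))
    (Label-SameFace nc s⊑ ⊑t s (lab-Label d))))

  face⇒SameFace : (∀ {d d′} → nextᵈ d ≡ nextᵈ d′ → d ≡ d′) →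
    ∀ {d d′} → face d ≡ face d′ → Star (Step faceNextᵈ) d d′
  face⇒SameFace next-inj {d} {d′} p = Label-path (lab-Label d) ◅◅
    subst (λ k → Star (Step faceNextᵈ) (out k) d′) (sym labels)
      (Star-symmetric (join segments segments) join-injective faceNextᵈ
        (λ q → swap-injective (next-inj q)) (Label-path (lab-Label d′)))
    where
    labels : lab d ≡ lab d′
    labels = trans (sym (lookup-face d)) (trans (cong (lookup tops) p) (lookup-face d′))
    swap-injective : ∀ {d d′ : Dart segments} → swap d ≡ swap d′ → d ≡ d′
    swap-injective {out _}  {out _}  refl = refl
    swap-injective {into _} {into _} refl = refl
    join-injective : ∀ {a b : Dart segments} →
        join segments segments a ≡ join segments segments b → a ≡ b
    join-injective {a} {b} q = trans (sym (Fin.splitAt-join segments segments a))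
      (trans (cong (splitAt segments) q) (Fin.splitAt-join segments segments b))

  ⊑⇒≪ : ∀ {u v} → u ⊑ v → u ≢ v → u ≪ v
  ⊑⇒≪ (inj₁ p) u≢v = ⊥-elim (u≢v p)
  ⊑⇒≪ (inj₂ p) _   = p

  s-source : ∀ e → upper e ≢ s
  s-source e refl = ℕ.<⇒≱ (proj₁ (proj₁ (segment-cover e))) (⊑-x (s⊑ (lower e)))

  t-sink : ∀ e → lower e ≢ t
  t-sink e refl = ℕ.<⇒≱ (proj₁ (proj₁ (segment-cover e))) (⊑-x (⊑t (upper e)))

  ingoing : ∀ {v} → v ≢ s → ∃ λ e → upper e ≡ v
  ingoing v≢s with r , ρ ← rightmost-in (⊑⇒≪ (s⊑ _) (v≢s ∘ sym)) with e , _ ,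
      p ← segment (proj₁ ρ) = e , p

  outgoing : ∀ {v} → v ≢ t → ∃ λ e → lower e ≡ v
  outgoing v≢t with k , v⋖k , _ ← upper-cover (⊑⇒≪ (⊑t _) v≢t) with e , p , _ ← segment v⋖k = e , p

  private
    Lateral : Fin segments → Set
    Lateral e = isOut (nextᵈ (into e)) ≡ true

    lateral-next : ∀ {e} → Lateral e → ∃ λ g → nextᵈ (into e) ≡ out g
    lateral-next p = isOut-true _ p

    lateral-max : ∀ {e} → Lateral e → ∀ c → originᵈ c ≡ upper e → keyᵈ c ≤ keyᵈ (into e)
    lateral-max {e} p with g , q ← lateral-next p with subst (Succ (into e)) q (next-Succ (into e))
    ... | _ , inj₁ (l , _) = ⊥-elim (ℕ.<-asym l (out<into g e))
    ... | _ , inj₂ around  = λ c o → proj₁ (around c o)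

    lateral-unique : ∀ {e e′} → Lateral e → Lateral e′ → upper e ≡ upper e′ → e ≡ e′
    lateral-unique {e} {e′} p p′ q = inj₂-injective (key-injective {into e} {into e′} q
      (ℕ.≤-antisym (lateral-max p′ (into e) q) (lateral-max p (into e′) (sym q))))

    swap-≪ : ∀ {u v} → u ≪ v → Mirror._≪_ u v
    swap-≪ (p , q) = q , p

    lateral-exists : ∀ {v} → v ≢ s → v ≢ t → ∃ λ e → Lateral e × upper e ≡ v
    lateral-exists {v} v≢s v≢t
      with l , l⋖v , max ← Mirror.rightmost-in (swap-≪ (⊑⇒≪ (s⊑ v) (v≢s ∘ sym)))
      with k , v≪k , min ← extremum (v ≪?_) (λ k l → x k ℕ.<? x l) (below-wellFounded x)
          (⊑⇒≪ (⊑t v) v≢t)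
      with p , P@(_ , p-v) ← segment (unmirror-cover l⋖v)
      with e , E ← segment (v≪k , λ c (a , b) → min c a (proj₁ b)) =
      p , cong isOut (next-LTurn E P (λ c v≪c → ℕ.≮⇒≥ (min c v≪c))
          (λ c c≪v → max c (swap-≪ c≪v))) , p-v

    lateral-t : ∀ {e} → Lateral e → upper e ≢ t
    lateral-t {e} p q with g , r ← lateral-next p =
      t-sink g (trans (sym (cong originᵈ r)) (trans (proj₁ (next-Succ (into e))) q))

    -- Every edge is the leftmost ingoing edge of a vertex other than s, t or
    -- the top edge of the right boundary of a face, and not both.
    Corner : Fin m ⊎ Fin faces → Fin segments ⊎ Fin 2 → Set
    Corner (inj₁ v) (inj₁ e)          = Lateral e × upper e ≡ v
    Corner (inj₁ v) (inj₂ zero)       = v ≡ s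
    Corner (inj₁ v) (inj₂ (suc zero)) = v ≡ t
    Corner (inj₂ f) (inj₁ e)          = lookup tops f ≡ e
    Corner (inj₂ f) (inj₂ _)          = ⊥

    Corner-total : ∀ i → ∃ (Corner i)
    Corner-total (inj₁ v) with v ≟ s | v ≟ t
    ... | yes p | _     = inj₂ zero , p
    ... | no _  | yes p = inj₂ (suc zero) , p
    ... | no p  | no q  = inj₁ (proj₁ (lateral-exists p q)) , proj₂ (lateral-exists p q)
    Corner-total (inj₂ f) = inj₁ (lookup tops f) , refl

    Corner-onto : ∀ y → ∃ λ i → Corner i y
    Corner-onto (inj₁ e) with Top? e
    ... | yes p = inj₂ (index e∈) , sym (lookup-index e∈)
      where
      e∈ : e ∈ tops
      e∈ = ∈.∈-filter⁺ Top? (∈.∈-allFin e) p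
    ... | no ¬p = inj₁ (upper e) , Sum.fromInj₂ (⊥-elim ∘ ¬p)
        (bool-cases (isOut (nextᵈ (into e))) false) , refl
    Corner-onto (inj₂ zero)       = inj₁ s , refl
    Corner-onto (inj₂ (suc zero)) = inj₁ t , refl

    Corner-disjoint : ∀ {i j y} → Corner i y → Corner j y → i ≡ j
    Corner-disjoint {inj₁ _} {inj₁ _} {inj₁ _} (_ , p) (_ , q) = cong inj₁ (trans (sym p) q)
    Corner-disjoint {inj₁ _} {inj₁ _} {inj₂ zero} p q = cong inj₁ (trans p (sym q))
    Corner-disjoint {inj₁ _} {inj₁ _} {inj₂ (suc zero)} p q = cong inj₁ (trans p (sym q))
    Corner-disjoint {inj₁ _} {inj₂ f} {inj₁ _} (p , _) refl =
        case trans (sym p) (lookup-Top f) of λ ()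
    Corner-disjoint {inj₂ f} {inj₁ _} {inj₁ _} refl (p , _) =
        case trans (sym p) (lookup-Top f) of λ ()
    Corner-disjoint {inj₂ _} {inj₂ _} {inj₁ _} p q = cong inj₂ (lookup-injective (trans p (sym q)))

    Corner-functional : ∀ {y y′ i} → Corner i y → Corner i y′ → y ≡ y′
    Corner-functional {inj₁ _} {inj₁ _} {inj₁ _} (p , q) (p′ , q′) =
        cong inj₁ (lateral-unique p p′ (trans q (sym q′)))
    Corner-functional {inj₁ e} {inj₂ zero} {inj₁ _} (p , q) r = ⊥-elim (s-source e (trans q r))
    Corner-functional {inj₁ e} {inj₂ (suc zero)} {inj₁ _} (p , q) r =
        ⊥-elim (lateral-t p (trans q r))
    Corner-functional {inj₂ zero} {inj₁ e} {inj₁ _} r (p , q) = ⊥-elim (s-source e (trans q r))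
    Corner-functional {inj₂ (suc zero)} {inj₁ e} {inj₁ _} r (p , q) =
        ⊥-elim (lateral-t p (trans q r))
    Corner-functional {inj₂ zero} {inj₂ zero} {inj₁ _} _ _ = refl
    Corner-functional {inj₂ zero} {inj₂ (suc zero)} {inj₁ _} p q = ⊥-elim (s≢t (trans (sym p) q))
    Corner-functional {inj₂ (suc zero)} {inj₂ zero} {inj₁ _} p q = ⊥-elim (s≢t (trans (sym q) p))
    Corner-functional {inj₂ (suc zero)} {inj₂ (suc zero)} {inj₁ _} _ _ = refl
    Corner-functional {inj₁ _} {inj₁ _} {inj₂ _} p q = cong inj₁ (trans (sym p) q)

  -- `Corner` and its converse are both total and never share a value, which gives the two
  -- inequalities. The 2 accounts for `s` and `t`.
  euler : m + faces ≡ segments + 2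
  euler = ℕ.≤-antisym
    (relation-≤ Corner Corner-total λ {i} {j} {y} → Corner-disjoint {i} {j} {y})
    (relation-≤ (λ y i → Corner i y) Corner-onto λ {y} {y′} {i} → Corner-functional {y} {y′} {i})

  _⟶ᵈ_ : Rel (Fin m) 0ℓ
  _⟶ᵈ_ = λ u v → ∃ λ e → lower e ≡ u × upper e ≡ v

  ⟶ᵈ⇒≪ : ∀ {u v} → u ⟶ᵈ v → u ≪ v
  ⟶ᵈ⇒≪ (e , refl , refl) = proj₁ (segment-cover e)

  ≪⇒path : ∀ {u v} → u ≪ v → Star _⟶ᵈ_ u v
  ≪⇒path {u} {v} = go (above-wellFounded x u)
    where
    go : ∀ {u} → Acc (λ v u → x u < x v) u → u ≪ v → Star _⟶ᵈ_ u v
    go (acc rs) p with k , u⋖k , k⊑v ← upper-cover p with segment u⋖k | k⊑v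
    ... | e , E | inj₁ refl = (e , E) ◅ ε
    ... | e , E | inj₂ q    = (e , E) ◅ go (rs (proj₁ (proj₁ u⋖k))) q

  connected : ∀ u v → EqClosure _⟶ᵈ_ u v
  connected u v = EqClosure.symmetric _⟶ᵈ_ (from-s u) ◅◅ from-s v
    where
    from-s : ∀ v → EqClosure _⟶ᵈ_ s v
    from-s v with s⊑ v
    ... | inj₁ refl = ε
    ... | inj₂ p    = Star.map fwd (≪⇒path p)

  acyclic : ∀ v → ¬ TransClosure _⟶ᵈ_ v v
  acyclic v p = ℕ.<-irrefl refl (proj₁ (closed p))
    where
    closed : ∀ {u v} → TransClosure _⟶ᵈ_ u v → u ≪ v
    closed (Trans.[_] p) = ⟶ᵈ⇒≪ p
    closed (p ∷ q)       = ≪-trans (⟶ᵈ⇒≪ p) (closed q)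

  not-transitive : ∀ e → ¬ Star (λ u v → ∃ λ e′ → e′ ≢ e × lower e′ ≡ u × upper e′ ≡ v) (lower e)
      (upper e)
  not-transitive e = split refl
    where
    forget : ∀ {u v} → Star (λ u v → ∃ λ e′ → e′ ≢ e × lower e′ ≡ u × upper e′ ≡ v) u v → u ⊑ v
    forget ε = inj₁ refl
    forget ((_ , _ , p) ◅ s) = inj₂ (≪-⊑ (⟶ᵈ⇒≪ (_ , p)) (forget s))
    split : ∀ {u} → u ≡ lower e → ¬ Star (λ u v → ∃ λ e′ → e′ ≢ e × lower e′ ≡ u × upper e′ ≡ v)
        u (upper e)
    split p ε = ℕ.<⇒≢ (proj₁ (proj₁ (segment-cover e))) (cong x (sym p))
    split p ((e′ , e′≢e , refl , refl) ◅ s) with forget s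
    ... | inj₁ q = e′≢e (edge-unique p q)
    ... | inj₂ q = proj₂ (segment-cover e) (upper e′)
      (subst (_≪ upper e′) p (proj₁ (segment-cover e′)) , q)

  module _ {r : Fin segments} (r-s : lower r ≡ s) (r-first : ∀ c → s ≪ c → x (upper r) ≤ x c) where

    sink-outer : ∃ λ d → Star (Step faceNextᵈ) (out r) d × originᵈ d ≡ t
    sink-outer with k , e , k-t , p , l ← root-label nc s⊑ ⊑t r-s r-first (⊑⇒≪ (s⊑ t) s≢t) =
      into e , Label-path l ◅◅ (p ◅ ε) ,
      trans (sym (cong originᵈ p)) (trans (proj₁ (next-Succ (into k))) k-t)

    -- The key fails to increase only where the rotation returns to its least key directly from an
    -- outgoing dart. Such a vertex has no ingoing darts, so it is `s`, and `out g` is then the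
    -- root.
    next-out-x : ∀ {h g} → nextᵈ (out h) ≡ out g → out g ≢ out r → x (upper h) < x (upper g)
    next-out-x {h} {g} p g≢r with subst (Succ (out h)) p (next-Succ (out h))
    ... | _ , inj₁ (l , _)     = l
    ... | g-h , inj₂ around = ⊥-elim (g≢r (key-injective {out g} {out r} (trans g-s (sym r-s))
      (ℕ.≤-antisym (proj₂ (around (out r) (trans r-s (sym h-s))))
        (r-first (upper g) (subst (_≪ upper g) g-s (proj₁ (segment-cover g)))))))
      where
      h-s : lower h ≡ s
      h-s with lower h ≟ s
      ... | yes q = q
      ... | no q with e , e-h ← ingoing q =
        ⊥-elim (ℕ.<⇒≱ (out<into h e) (proj₁ (around (into e) e-h)))
      g-s : lower g ≡ s
      g-s = trans g-h h-s

module _ {n : ℕ} (π : PlanePermutation n) where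

  private
    σ : Permutation′ (2 + n)
    σ = completion (perm π)

    D : CoverDiagram (2 + n)
    D = DominanceDarts.diagram σ

    module D = CoverDiagram D

    nc : D.NoCrossing
    nc = plane⇒noCrossing σ (completion-plane (perm π) (PlanePermutation.plane π))

    ≢zero⇒> : ∀ {v : Fin (2 + n)} → v ≢ zero → 0 < toℕ v
    ≢zero⇒> p = ℕ.n≢0⇒n>0 (p ∘ Fin.toℕ-injective)

    ≢top⇒< : ∀ {v : Fin (2 + n)} → v ≢ top → toℕ v < toℕ (top {n})
    ≢top⇒< {v} p = ℕ.≤∧≢⇒< (subst (toℕ v ≤_) (sym toℕ-top) (ℕ.≤-pred (Fin.toℕ<n v)))
        (p ∘ Fin.toℕ-injective)

    σ-≢ : ∀ {u v w} → σ ⟨$⟩ʳ w ≡ u → v ≢ w → σ ⟨$⟩ʳ v ≢ u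
    σ-≢ p q r = q (⟨$⟩ʳ-injective σ (trans r (sym p)))

  zero⊑ : ∀ v → D._⊑_ zero v
  zero⊑ v with v ≟ zero
  ... | yes p = inj₁ (sym p)
  ... | no p  = inj₂ (≢zero⇒> p ,
      subst (_< toℕ (σ ⟨$⟩ʳ v)) (cong toℕ (sym (completion-zero (perm π))))
    (≢zero⇒> (σ-≢ (completion-zero (perm π)) p)))

  ⊑top : ∀ v → D._⊑_ v top
  ⊑top v with v ≟ top
  ... | yes p = inj₁ p
  ... | no p  = inj₂ (≢top⇒< p , subst (toℕ (σ ⟨$⟩ʳ v) <_)
      (cong toℕ (sym (completion-top (perm π))))
    (≢top⇒< (σ-≢ (completion-top (perm π)) p)))

  open DiagramPlanarity D nc zero⊑ ⊑top (λ ())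

  private
    M : OrientedMap (2 + n)
    M = Φ π

    module M = OrientedMap M

    r : Fin M.edges
    r = proj₁ (root-segment (perm π))

    root-r : M.root ≡ out r
    root-r = proj₁ (proj₂ (root-segment (perm π)))

    r-lower : M.src r ≡ zero
    r-lower = cong proj₁ (proj₂ (proj₂ (root-segment (perm π))))

    r-upper : M.tgt r ≡ suc zero
    r-upper = cong proj₂ (proj₂ (proj₂ (root-segment (perm π))))

    r-first : ∀ c → D._≪_ zero c → D.x (M.tgt r) ≤ D.x c
    r-first c (p , _) = subst (λ v → toℕ v ≤ toℕ c) (sym r-upper) p

    root-zero : M.origin M.root ≡ zero
    root-zero = trans (cong M.origin root-r) r-lower

  Φ-planar : IsPlanar M
  Φ-planar = record
    { connected       = connected
    ; faces           = faces
    ; face            = face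
    ; face-surjective = face-surjective
    ; face-orbits     = λ d d′ → mk⇔ (face⇒SameFace next-injective) SameFace⇒face
    ; euler           = euler
    }
    where
    next-injective : ∀ {d d′} → M.next d ≡ M.next d′ → d ≡ d′
    next-injective {d} {d′} p =
      trans (sym (Rotation.prev-next M d)) (trans (cong M.prev p) (Rotation.prev-next M d′))

  Φ-isPlaneBipolarPoset : IsPlaneBipolarPoset M
  Φ-isPlaneBipolarPoset = record
    { planar         = Φ-planar
    ; acyclic        = acyclic
    ; S-source       = λ e p → s-source e (trans p root-zero)
    ; S-unique       = λ v source → trans (S-unique v source) (sym root-zero)
    ; N              = top
    ; N-sink         = t-sink
    ; N-unique       = N-unique
    ; N-outer        = subst (λ d → ∃ λ d′ → M.SameFace d d′ × M.origin d′ ≡ top) (sym root-r)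
                         (sink-outer r-lower r-first)
    ; not-transitive = not-transitive
    }
    where
    S-unique : ∀ v → M.IsSource v → v ≡ zero
    S-unique v source = decidable-stable (v ≟ zero) λ v≢0 →
      let e , p = ingoing v≢0 in source e p
    N-unique : ∀ v → M.IsSink v → v ≡ top
    N-unique v sink = decidable-stable (v ≟ top) λ v≢t →
      let e , p = outgoing v≢t in sink e p

  encode : PlaneBipolarPoset n
  encode = planeBipolarPoset M Φ-isPlaneBipolarPoset

  encode-labels : Labels (toBipolar encode) toℕ (λ v → toℕ (σ ⟨$⟩ʳ v))
  encode-labels = record
    { x-injective = D.x-injective
    ; y-injective = D.y-injective
    ; edge-x      = λ e → proj₁ (proj₁ (D.segment-cover e))
    ; edge-y      = λ e → proj₂ (proj₁ (D.segment-cover e))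
    ; above       = λ p q → ≪⇒path (p , q)
    ; OutAdj-x    = λ { (p , q) → next-out-x r-lower r-first p (λ eq → q (trans eq (sym root-r))) }
    }

  encode-S : Bipolar.S (toBipolar encode) ≡ zero
  encode-S = root-zero

-- The bijection

monotone-≤ : ∀ {m} (f : Fin m → Fin m) → (∀ {i j} → toℕ i < toℕ j → toℕ (f i) < toℕ (f j)) →
  ∀ i → toℕ i ≤ toℕ (f i)
monotone-≤ f mono i = go (toℕ i) i refl
  where
  go : ∀ k i → toℕ i ≡ k → k ≤ toℕ (f i)
  go zero    i p = z≤n
  go (suc k) i p = ℕ.≤-<-trans (go k i′ i′≡k) (mono (subst₂ _<_ (sym i′≡k) (sym p) ℕ.≤-refl))
    where
    k<m = ℕ.<-trans (subst (k <_) (sym p) ℕ.≤-refl) (Fin.toℕ<n i)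
    i′ = fromℕ< k<m
    i′≡k = Fin.toℕ-fromℕ< k<m

monotone-unique : ∀ {m} (X X′ : Permutation′ m) →
  (∀ {u v} → toℕ (X ⟨$⟩ʳ u) < toℕ (X ⟨$⟩ʳ v) → toℕ (X′ ⟨$⟩ʳ u) < toℕ (X′ ⟨$⟩ʳ v)) →
  ∀ v → toℕ (X ⟨$⟩ʳ v) ≤ toℕ (X′ ⟨$⟩ʳ v)
monotone-unique X X′ mono v = subst (λ u → toℕ (X ⟨$⟩ʳ v) ≤ toℕ (X′ ⟨$⟩ʳ u)) (Perm.inverseˡ X)
  (monotone-≤ (λ i → X′ ⟨$⟩ʳ (X ⟨$⟩ˡ i))
    (λ {i} {j} p → mono (subst₂ (λ i j → toℕ i < toℕ j) (sym (Perm.inverseʳ X))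
        (sym (Perm.inverseʳ X)) p))
    (X ⟨$⟩ʳ v))

module _ {n E : ℕ} (B : Bipolar (2 + n) E) where
  open Code B

  -- Both `code` and `π′` turn abscissas into ordinates. All labellings of `B` order the vertices
  -- alike, and a numbering by a permutation is determined by the order that it induces; so
  -- abscissas and ordinates agree.
  code-unique : (X′ : Permutation′ (2 + n)) (π′ : Permutation′ n) →
    Labels B (λ v → toℕ (X′ ⟨$⟩ʳ v)) (λ v → toℕ (completion π′ ⟨$⟩ʳ (X′ ⟨$⟩ʳ v))) → code Perm.≈ π′
  code-unique X′ π′ l i = interior-injective (trans (sym (completion-interior code i))
    (trans (agree (interior i)) (completion-interior π′ i)))
    where
    Y′ : Permutation′ (2 + n)
    Y′ = X′ Perm.∘ₚ completion π′
    same-x : ∀ v → X.coordinate ⟨$⟩ʳ v ≡ X′ ⟨$⟩ʳ v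
    same-x v = Fin.toℕ-injective (ℕ.≤-antisym
      (monotone-unique X.coordinate X′ (labels-x B labels l) v)
      (monotone-unique X′ X.coordinate (labels-x B l labels) v))
    same-y : ∀ v → Y.coordinate ⟨$⟩ʳ v ≡ Y′ ⟨$⟩ʳ v
    same-y v = Fin.toℕ-injective (ℕ.≤-antisym
      (monotone-unique Y.coordinate Y′ (labels-y B labels l) v)
      (monotone-unique Y′ Y.coordinate (labels-y B l labels) v))
    agree : ∀ j → completion code ⟨$⟩ʳ j ≡ completion π′ ⟨$⟩ʳ j
    agree j = subst (λ j → completion code ⟨$⟩ʳ j ≡ completion π′ ⟨$⟩ʳ j) (Perm.inverseʳ X′)
      (trans (cong (completion code ⟨$⟩ʳ_) (sym (same-x v))) (trans (code-coordinate v) (same-y v)))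
      where v = X′ ⟨$⟩ˡ j

  code-labels : Labels B X.coord (λ v → toℕ (completion code ⟨$⟩ʳ (X.coordinate ⟨$⟩ʳ v)))
  code-labels = relabel B labels id
    (λ {u} {v} → subst₂ (λ i j → toℕ i < toℕ j) (sym (code-coordinate u)) (sym (code-coordinate v)))

module _ {n : ℕ} {B B′ : PlaneBipolarPoset n} (f : orientedMap B ≅ orientedMap B′) where
  open _≅_ f
  private
    module M  = OrientedMap (orientedMap B)
    module M′ = OrientedMap (orientedMap B′)

    onDarts-injective : ∀ {d d′} → onDarts d ≡ onDarts d′ → d ≡ d′
    onDarts-injective {out _}  {out _}  p = cong out (⟨$⟩ʳ-injective onEdges (inj₁-injective p))
    onDarts-injective {into _} {into _} p = cong into (⟨$⟩ʳ-injective onEdges (inj₂-injective p))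

    path : ∀ {u v} → Star M′._⟶_ u v → ∀ {u₀ v₀} → u ≡ onVertices ⟨$⟩ʳ u₀ →
        v ≡ onVertices ⟨$⟩ʳ v₀ → Star M._⟶_ u₀ v₀
    path ε p q = subst (Star M._⟶_ _) (⟨$⟩ʳ-injective onVertices (trans (sym p) q)) ε
    path ((e′ , r , refl) ◅ s) p q = (e , src-e , refl) ◅ path s tgt-e q
      where
      e = onEdges ⟨$⟩ˡ e′
      src-e : M.src e ≡ _
      src-e = ⟨$⟩ʳ-injective onVertices
        (trans (sym (src-comm e)) (trans (cong M′.src (Perm.inverseʳ onEdges)) (trans r p)))
      tgt-e : M′.tgt e′ ≡ onVertices ⟨$⟩ʳ M.tgt e
      tgt-e = trans (cong M′.tgt (sym (Perm.inverseʳ onEdges))) (tgt-comm e)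

  transport : ∀ {x y} → Labels (toBipolar B′) x y →
    Labels (toBipolar B) (x ∘ (onVertices ⟨$⟩ʳ_)) (y ∘ (onVertices ⟨$⟩ʳ_))
  transport {x} {y} l = record
    { x-injective = λ p → ⟨$⟩ʳ-injective onVertices (l.x-injective p)
    ; y-injective = λ p → ⟨$⟩ʳ-injective onVertices (l.y-injective p)
    ; edge-x      = λ e → subst₂ (λ u v → x u < x v) (src-comm e) (tgt-comm e)
        (l.edge-x (onEdges ⟨$⟩ʳ e))
    ; edge-y      = λ e → subst₂ (λ u v → y u < y v) (src-comm e) (tgt-comm e)
        (l.edge-y (onEdges ⟨$⟩ʳ e))
    ; above       = λ p q → path (l.above p q) refl refl
    ; OutAdj-x    = λ {h} {g} (p , q) → subst₂ (λ u v → x u < x v) (tgt-comm h) (tgt-comm g)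
        (l.OutAdj-x {onEdges ⟨$⟩ʳ h} {onEdges ⟨$⟩ʳ g}
          (trans (next-comm (out h)) (cong onDarts p) , λ r →
              q (onDarts-injective {out g} (trans r root-comm))))
    }
    where module l = Labels l

  decode-cong : perm (decode B) Perm.≈ perm (decode B′)
  decode-cong = code-unique (toBipolar B) (onVertices Perm.∘ₚ Code.X.coordinate (toBipolar B′))
    (perm (decode B′)) (transport (code-labels (toBipolar B′)))

module _ {n : ℕ} (B : PlaneBipolarPoset n) (π : Permutation′ n) (X : Permutation′ (2 + n))
  (labels : Labels (toBipolar B) (toℕ ∘ (X ⟨$⟩ʳ_)) (toℕ ∘ (completion π ⟨$⟩ʳ_) ∘ (X ⟨$⟩ʳ_)))
  (X-S : X ⟨$⟩ʳ Bipolar.S (toBipolar B) ≡ zero) where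

  private
    module I = Isomorphism (toBipolar B) (DominanceDarts.diagram (completion π)) X labels

  labels⇒≅ : orientedMap B ≅ dominanceMap π
  labels⇒≅ = record
    { onVertices = X
    ; onEdges    = I.onEdges
    ; src-comm   = I.src-comm
    ; tgt-comm   = I.tgt-comm
    ; next-comm  = I.next-comm
    ; root-comm  = let r , p , q = root-segment π in
        trans p (I.root-comm r (cong (toℕ ∘ proj₁) q) (cong (toℕ ∘ proj₂) q) (cong toℕ X-S))
    }

decode-≅ : ∀ {n} (B : PlaneBipolarPoset n) → orientedMap B ≅ Φ (decode B)
decode-≅ B = labels⇒≅ B (perm (decode B)) (Code.X.coordinate (toBipolar B))
    (code-labels (toBipolar B))
  (Code.X.coordinate-S (toBipolar B))

-- Pointwise equality does not identify the two lists of covers. Instead the points of `π′` serve as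
-- labels for the map of `π`, which is therefore isomorphic to the diagram of `π′`.
encode-cong : ∀ {n} (π π′ : PlanePermutation n) → perm π Perm.≈ perm π′ → Φ π ≅ Φ π′
encode-cong π π′ p = labels⇒≅ (encode π) (perm π′) Perm.id
  (relabel (toBipolar (encode π)) (encode-labels π) id
    (λ {u} {v} → subst₂ (λ i j → toℕ i < toℕ j) (completion-cong p u) (completion-cong p v)))
  (encode-S π)

decode-encode : ∀ {n} (π : PlanePermutation n) → perm (decode (encode π)) Perm.≈ perm π
decode-encode π = code-unique (toBipolar (encode π)) Perm.id (perm π) (encode-labels π)

proposition5p3 : (n : ℕ) →
    Σ[ F ∈ Inverse (𝓟 n) (𝓑 n) ]
    (((π : PlanePermutation n) → orientedMap (Inverse.to F π) ≡ Φ π) ×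
    ((B : PlaneBipolarPoset n) → points (Inverse.from F B) ≐ Ψ B))
proposition5p3 n = inverse , (λ _ → refl) , points-decode
  where
  inverse : Inverse (𝓟 n) (𝓑 n)
  inverse = record
    { to        = encode
    ; from      = decode
    ; to-cong   = λ {π} {π′} → encode-cong π π′
    ; from-cong = λ {B} {B′} → decode-cong {n} {B} {B′}
    ; inverse   =
        (λ {B} {π} p → ≅-trans (encode-cong π (decode B) p) (≅-sym (decode-≅ B))) ,
        (λ {π} {B} f i → trans (decode-cong {n} {B} {encode π} f i) (decode-encode π i))
    }
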